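{- Let $B$ be a connected flag building set on $[n]$ with flag ordering $O$. Then $\gamma(B)=f(\Gamma(O))$, where $\gamma(B)$ denotes the $\gamma$-polynomial of the nestohedron $P_B$.
   Context: A building set $B$ on a finite set $S$ is a collection of nonempty subsets of $S$ such that (i) if $I,J\in B$ and $I\cap J\neq\emptyset$ then $I\cup J\in B$, and (ii) $\{i\}\in B$ for all $i\in S$; it is connected if $S\in B$. For $I\subseteq[n]$, $\Delta_I$ is the convex hull of the standard basis vectors $e_i$, $i\in I$, and for $B$ on $[n]$ the nestohedron is $P_B=\sum_{I\in B}\Delta_I$ (a simple polytope). $B$ is flag if $P_B$ is flag (every family of pairwise intersecting facets has nonempty intersection). A minimal flag building set on $S$ is a connected flag building set on $S$ no proper subset of which is a connected flag building set on $S$ (equivalently, the sets of leaf-descendants of the vertices of a rooted binary tree with leaf set $S$). For non-singleton $b\in B$, a decomposition of $b$ in $B$ is a subset of $B$ forming a minimal flag building set on $b$. A flag ordering $O=(D,b_1,\dots,b_k)$ of a connected flag building set $B$ on $[n]$ consists of a decomposition $D$ of $[n]$ in $B$ and an enumeration $b_1,\dots,b_k$ of $B\setminus D$ such that $B_j:=D\cup\{b_1,\dots,b_j\}$ is a flag building set for all $0\le j\le k$ ($B_0=D$). For $j\in[k]$: $U_j=\{i<j: b_i\not\subseteq b_j$ and there is no $b\in B_{i-1}$ with $b\setminus b_j=b_i\setminus b_j\}$; $V_j=\{i<j: b_i\subseteq b_j$ and there is $b\in B_{i-1}$ with $b_i\subsetneq b\subsetneq b_j\}$. $\Gamma(O)$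 is the simplicial complex on vertices $v(b_1),\dots,v(b_k)$ whose faces are the cliques of the graph in which, for $i<j$, $v(b_i)$ and $v(b_j)$ are adjacent iff $i\in U_j\cup V_j$ (for $k=0$ it has only the empty face). For a $(d-1)$-dimensional simplicial complex $\Delta$, $f(\Delta)(t)=\sum_{i=0}^{d}f_it^i$, $f_0=1$, $f_i$ = number of $(i-1)$-dimensional faces; $h(\Delta)(t)=(t-1)^df(\Delta)(1/(t-1))$; for a homology sphere $h(\Delta)(t)=\sum_{i}\gamma_it^i(1+t)^{d-2i}$ and $\gamma(\Delta)(t)=\sum_i\gamma_it^i$. For a simple polytope $P$, $\gamma(P)=\gamma(\Delta_P)$ where $\Delta_P$ is the boundary complex of the polar dual of $P$. -}

module Defs where

open import Data.Nat as ℕ using (ℕ; zero; suc; _≤ᵇ_)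
open import Data.Nat.Combinatorics using (_C_)
open import Data.Integer as ℤ using (ℤ)
open import Data.Rational as ℚ using (ℚ; 0ℚ; 1ℚ)
open import Data.Fin using (Fin; toℕ) renaming (_<_ to _<ᶠ_)
open import Data.Fin.Subset as S using (Subset; ⁅_⁆; _∩_; _∪_; _─_; ∣_∣; Nonempty)
  renaming (_∈_ to _∈ₛ_; _∉_ to _∉ₛ_; _⊆_ to _⊆ₛ_; _⊈_ to _⊈ₛ_; _⊂_ to _⊂ₛ_; ⊤ to Full)
open import Data.List using (List; []; _∷_; _++_; take; length; lookup)
open import Data.List.Membership.Propositional using () renaming (_∈_ to _∈ₗ_; _∉_ to _∉ₗ_)
open import Data.List.Relation.Unary.All using (All)
open import Data.List.Relation.Unary.Unique.Propositional using (Unique)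
open import Data.List.Relation.Binary.Permutation.Propositional using (_↭_)
open import Data.Product using (Σ; Σ-syntax; ∃; ∃-syntax; _×_; _,_)
open import Data.Sum using (_⊎_)
open import Data.Bool using (if_then_else_)
open import Relation.Nullary using (¬_)
open import Relation.Binary.PropositionalEquality using (_≡_)

-- Finite families of subsets of [n] = Fin n are represented by lists
-- (required to be duplicate-free where they stand for sets).

record IsBuildingSet {n : ℕ} (B : List (Subset n)) : Set where
  field
    noDup     : Unique B
    nonempty  : All Nonempty B
    union     : ∀ I J → I ∈ₗ B → J ∈ₗ B → Nonempty (I ∩ J) → (I ∪ J) ∈ₗ B
    singleton : ∀ (i : Fin n) → ⁅ i ⁆ ∈ₗ B

IsConnected : ∀ {n} → List (Subset n) → Set
IsConnected B = Full ∈ₗ B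

Point : ℕ → Set
Point n = Fin n → ℚ

sumℚ : ∀ {n} → (Fin n → ℚ) → ℚ
sumℚ {zero}  f = 0ℚ
sumℚ {suc n} f = f Fin.zero ℚ.+ sumℚ (λ i → f (Fin.suc i))

dot : ∀ {n} → Point n → Point n → ℚ
dot w x = sumℚ (λ i → w i ℚ.* x i)

-- x ∈ Δ_I = conv{ e_i : i ∈ I }
InSimplex : ∀ {n} → Subset n → Point n → Set
InSimplex I x = (∀ i → 0ℚ ℚ.≤ x i) × (∀ i → i ∉ₛ I → x i ≡ 0ℚ) × (sumℚ x ≡ 1ℚ)

InMinkowski : ∀ {n} → List (Subset n) → Point n → Set
InMinkowski []      x = ∀ i → x i ≡ 0ℚ
InMinkowski (I ∷ L) x =
  Σ[ y ∈ Point _ ] Σ[ z ∈ Point _ ]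
    (InSimplex I y × InMinkowski L z × (∀ i → x i ≡ y i ℚ.+ z i))

InP : ∀ {n} → List (Subset n) → Point n → Set
InP B x = InMinkowski B x

InFace : ∀ {n} → List (Subset n) → Point n → Point n → Set
InFace B w x = InP B x × (∀ y → InP B y → dot w y ℚ.≤ dot w x)

FaceIsP : ∀ {n} → List (Subset n) → Point n → Set
FaceIsP B w = ∀ x → InP B x → InFace B w x

FaceSub : ∀ {n} → List (Subset n) → Point n → Point n → Set
FaceSub B w v = ∀ x → InFace B w x → InFace B v x

record IsFacet {n : ℕ} (B : List (Subset n)) (w : Point n) : Set where
  field
    nonemptyF : Σ[ x ∈ Point n ] InFace B w x
    proper    : ¬ FaceIsP B w
    maximal   : ∀ v → FaceSub B w v → ¬ (¬ FaceSub B v w × ¬ FaceIsP B v)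

Common : ∀ {n} → List (Subset n) → List (Point n) → Set
Common B ws = Σ[ x ∈ Point _ ] (InP B x × All (λ w → InFace B w x) ws)

IsFlagPolytope : ∀ {n} → List (Subset n) → Set
IsFlagPolytope B =
  ∀ (ws : List (Point _)) → All (IsFacet B) ws →
  (∀ u v → u ∈ₗ ws → v ∈ₗ ws → Σ[ x ∈ Point _ ] (InFace B u x × InFace B v x)) →
  Common B ws

IsConnFlagBS : ∀ {n} → List (Subset n) → Set
IsConnFlagBS B = IsBuildingSet B × IsConnected B × IsFlagPolytope B

IsMinimalFlagBS : ∀ {n} → List (Subset n) → Set
IsMinimalFlagBS {n} D =
  IsConnFlagBS D ×
  (∀ (D' : List (Subset n)) → (∀ b → b ∈ₗ D' → b ∈ₗ D) → (Σ[ b ∈ Subset n ] (b ∈ₗ D × b ∉ₗ D')) →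
     ¬ IsConnFlagBS D')

-- Flag orderings.  Positions are 0-indexed: bs at position p is b_{p+1};
-- Prefix p is B_p = D ∪ {b_1,…,b_p}.

record FlagOrdering {n : ℕ} (B : List (Subset n)) : Set where
  field
    D      : List (Subset n)
    bs     : List (Subset n)
    D⊆B    : ∀ b → b ∈ₗ D → b ∈ₗ B
    decomp : IsMinimalFlagBS D
    enum   : (D ++ bs) ↭ B
    flagPrefix : ∀ j → j ℕ.≤ length bs → IsBuildingSet (D ++ take j bs) × IsFlagPolytope (D ++ take j bs)

module _ {n : ℕ} {B : List (Subset n)} (O : FlagOrdering B) where
  open FlagOrdering O

  k : ℕ
  k = length bs

  b : Fin k → Subset n
  b = lookup bs

  Prefix : ℕ → List (Subset n)
  Prefix p = D ++ take p bs

  -- i ∈ U_j  (p = i-1, q = j-1)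
  InU : Fin k → Fin k → Set
  InU p q = b p ⊈ₛ b q ×
    ¬ (Σ[ c ∈ Subset n ] (c ∈ₗ Prefix (toℕ p) × (c ─ b q ≡ b p ─ b q)))

  InV : Fin k → Fin k → Set
  InV p q = b p ⊆ₛ b q ×
    Σ[ c ∈ Subset n ] (c ∈ₗ Prefix (toℕ p) × b p ⊂ₛ c × c ⊂ₛ b q)

  Adjacent : Fin k → Fin k → Set
  Adjacent p q = p <ᶠ q → InU p q ⊎ InV p q

  -- faces of Γ(O) = cliques (on vertex set positions Fin k)
  IsClique : Subset k → Set
  IsClique S = ∀ p q → p ∈ₛ S → q ∈ₛ S → Adjacent p q

  CliqueOfSize : ℕ → Subset k → Set
  CliqueOfSize i S = ∣ S ∣ ≡ i × IsClique S

HasCount : ∀ {m} → (Subset m → Set) → ℕ → Set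
HasCount {m} P c =
  Σ[ L ∈ List (Subset m) ]
    (Unique L × All P L × (∀ S → P S → S ∈ₗ L) × length L ≡ c)

-- The boundary complex Δ_P of the polar dual of P_B: vertices are the facets
-- of P_B, faces the sets of facets with nonempty common intersection.

record FacetEnum {n : ℕ} (B : List (Subset n)) (m : ℕ) (fs : Fin m → Point n) : Set where
  field
    isFacet  : ∀ j → IsFacet B (fs j)
    distinct : ∀ i j → FaceSub B (fs i) (fs j) → FaceSub B (fs j) (fs i) → i ≡ j
    complete : ∀ w → IsFacet B w → Σ[ j ∈ Fin m ] (FaceSub B w (fs j) × FaceSub B (fs j) w)

FaceOfΔP : ∀ {n} → List (Subset n) → ∀ {m} → (Fin m → Point n) → ℕ → Subset m → Set
FaceOfΔP B fs i S =
  ∣ S ∣ ≡ i × Σ[ x ∈ Point _ ] (InP B x × (∀ j → j ∈ₛ S → InFace B (fs j) x))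

-- d = dim Δ + 1: the largest size of a face
IsTopSize : (ℕ → ℕ) → ℕ → Set
IsTopSize f d = (0 ℕ.< f d) × (∀ i → d ℕ.< i → f i ≡ 0)

sumTo : ℕ → (ℕ → ℤ) → ℤ
sumTo zero    g = g 0
sumTo (suc N) g = sumTo N g ℤ.+ g (suc N)

sign : ℕ → ℤ
sign zero          = ℤ.+ 1
sign (suc zero)    = ℤ.- ℤ.+ 1
sign (suc (suc e)) = sign e

-- h(t) = (t-1)^d f(1/(t-1)) = Σ_i f_i (t-1)^{d-i};  coefficient of t^k
hCoeff : (ℕ → ℕ) → ℕ → ℕ → ℤ
hCoeff f d k = sumTo d (λ i → sign ((d ℕ.∸ i) ℕ.∸ k) ℤ.* ℤ.+ (((d ℕ.∸ i) C k) ℕ.* f i))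

-- coefficient of t^k in t^i (1+t)^{d-2i}  (used only for 2i ≤ d)
tCoeff : ℕ → ℕ → ℕ → ℕ
tCoeff d i k = if i ≤ᵇ k then (d ℕ.∸ (2 ℕ.* i)) C (k ℕ.∸ i) else 0

IsGammaVector : (ℕ → ℕ) → ℕ → (ℕ → ℕ) → Set
IsGammaVector f d g =
  (∀ i → d ℕ.< 2 ℕ.* i → g i ≡ 0) ×
  (∀ k → hCoeff f d k ≡ sumTo d (λ i → ℤ.+ (g i ℕ.* tCoeff d i k)))

{-# OPTIONS --safe #-}
-- With f and γ related by f(t) = Σ γᵢ (t + t²)ⁱ (1 + 2t)^(d − 2i), everything is
-- a statement about f-polynomials.  The boundary complex is the clique complex
-- of a compatibility graph on the proper members of the building set, and
-- adding b = x ⊔ y to the building set subdivides the edge {x, y} of this flag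
-- complex with new vertex b.  Follow the link of a face σ backwards through the
-- flag ordering: if b ∈ σ the link becomes the suspension of the previous one
-- (or is isomorphic to it); if σ ∪ {x, y} is a face with x, y ∉ σ, the
-- f-polynomial gains (t + t²) times that of the link of σ ∪ {x, y}; otherwise
-- nothing changes.  At the start the complex is a cross-polytope, whose links
-- have f-polynomial (1 + 2t)ᵉ.  Starting from σ = ∅, the indices chosen along
-- the way form a set T, the face reached consists of the maximal members of the
-- current building set inside the b_q with q ∈ T, and p can be added to T
-- exactly when p ∈ U_q ∪ V_q for all q ∈ T: the choices are the faces of Γ(O).
module Submission where

open import Defs
open import Data.Bool using (Bool; true; false; _∧_; if_then_else_; T)
open import Data.Bool.ListAction using (all)
import Data.Bool.Properties as 𝔹ₚ
open import Data.Nat as ℕ using (ℕ; zero; suc; _+_; _*_; _∸_; _≤_; _<_; _≤ᵇ_; z≤n; s≤s)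
open import Data.Nat.Combinatorics using (nCk+nC[k+1]≡[n+1]C[k+1]; k>n⇒nCk≡0) renaming (_C_ to _choose_)
open import Data.Nat.Induction using (<-wellFounded)
import Data.Nat.Properties as ℕₚ
import Data.Nat.Tactic.RingSolver as ℕSolver
open import Data.Integer as ℤ using (ℤ)
import Data.Integer.Properties as ℤₚ
import Data.Integer.Tactic.RingSolver as ℤSolver
open import Data.Rational as ℚ using (ℚ; 0ℚ; 1ℚ)
import Data.Rational.Properties as ℚₚ
open import Algebra.Properties.Group ℚₚ.+-0-group using () renaming (⁻¹-involutive to neg-involutive)
open import Data.Fin as Fin using (Fin; toℕ)
import Data.Fin.Properties as Finₚ
open import Data.Fin.Subset using (Subset; ⁅_⁆; _∩_; _∪_; _─_; _-_; ∣_∣; Nonempty; inside; outside)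
  renaming (_∈_ to _∈ₛ_; _∉_ to _∉ₛ_; _⊆_ to _⊆ₛ_; _⊈_ to _⊈ₛ_; _⊂_ to _⊂ₛ_; ⊤ to Full; ⊥ to ∅)
import Data.Fin.Subset.Properties as Sₚ
open import Data.Vec as Vec using ([]; _∷_; here; there)
import Data.Vec.Properties as Vecₚ
open import Data.List using (List; []; _∷_; _++_; filter; filterᵇ; map; length; allFin; take; lookup)
import Data.List.Properties as Listₚ
open import Data.List.Membership.Propositional using (find; lose) renaming (_∈_ to _∈ₗ_; _∉_ to _∉ₗ_)
import Data.List.Membership.Propositional.Properties as ∈ₚ
import Data.List.Membership.DecPropositional as DecMembership
open import Data.List.Relation.Unary.Any as Any using (here; there)
open import Data.List.Relation.Unary.All as All using (All; []; _∷_)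
open import Data.List.Relation.Unary.AllPairs using ([]; _∷_)
open import Data.List.Relation.Unary.Unique.Propositional using (Unique)
import Data.List.Relation.Unary.Unique.Propositional.Properties as Uniqueₚ
open import Data.List.Relation.Binary.Permutation.Propositional as Perm using (_↭_; ↭-sym; ↭-trans; prep)
import Data.List.Relation.Binary.Permutation.Propositional.Properties as Permₚ
import Data.List.Relation.Binary.Permutation.Setoid.Properties as PermSₚ
open import Data.Product using (Σ; Σ-syntax; _×_; _,_; proj₁; proj₂; ∃)
open import Data.Sum using (_⊎_; inj₁; inj₂; [_,_]′)
open import Data.Empty using (⊥; ⊥-elim)
open import Function using (_∘_; id; mk⇔)
open import Induction.WellFounded using (Acc; acc)
open import Relation.Nullary using (¬_; Dec; yes; no; does)
open import Relation.Nullary.Decidable using (_×-dec_; _⊎-dec_; _→-dec_; ¬?; does-⇔; dec-true; dec-false; map′; decidable-stable)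
open import Relation.Binary.Definitions using (tri<; tri≈; tri>)
open import Relation.Binary.PropositionalEquality

-- γ-expansions of polynomials

-- With s = 1/(t - 1) one has t = (1 + s)/s and 1 + t = (1 + 2s)/s, so h(t) = Σ γᵢ tⁱ (1 + t)^(d -
-- 2i) becomes the stated formula for f(s). Clique counts stay natural numbers, and `Expand` is
-- generated by the operations that links undergo, so alternating sums occur only in the passage to
-- h-coefficients. The complex cannot be followed alone: each edge subdivision needs the
-- γ-polynomial of the link of the edge, whose history involves further links. Hence the induction
-- runs over all faces that can be reached, with `length σ + e` constant so that the exponents of
-- the two links in a `join` differ by 2. Polytopes enter through two facts. A connected building
-- set is flag exactly when each non-singleton member is a disjoint union of two members (`Splits`),
-- which provides x and y; and facets correspond to proper members, sets of facets with a common
-- point to cliques. The combinatorial weight lies in matching U and V with the condition that σ ∪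
-- {x, y} is a face (`compatible⇒ready`, `ready⇒compatible`).

Poly : Set
Poly = ℕ → ℕ

sh : Poly → Poly
sh p zero    = 0
sh p (suc i) = p i

δ₀ : Poly
δ₀ zero    = 1
δ₀ (suc _) = 0

-- Expand e g p holds when p = Σᵢ gᵢ (t + t²)ⁱ (1 + 2t)^(e − 2i), the
-- f-polynomial form of the γ-expansion.
data Expand : ℕ → Poly → Poly → Set where
  point : ∀ {g p} → g ≗ δ₀ → p ≗ δ₀ → Expand 0 g p
  susp  : ∀ {e g p q} → Expand e g q → (∀ s → p s ≡ q s + (sh q s + sh q s)) → Expand (suc e) g p
  join  : ∀ {e g g₁ g₂ p p₁ p₂} → Expand (2 + e) g₁ p₁ → Expand e g₂ p₂ →
          (∀ s → g s ≡ g₁ s + sh g₂ s) → (∀ s → p s ≡ p₁ s + (sh p₂ s + sh (sh p₂) s)) →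
          Expand (2 + e) g p

Expand-cong : ∀ {e g g' p p'} → g ≗ g' → p ≗ p' → Expand e g p → Expand e g' p'
Expand-cong gg pp (point g0 p0) = point (λ s → trans (sym (gg s)) (g0 s)) (λ s → trans (sym (pp s)) (p0 s))
Expand-cong gg pp (susp E h) = susp (Expand-cong gg (λ _ → refl) E) (λ s → trans (sym (pp s)) (h s))
Expand-cong gg pp (join E₁ E₂ hg hp) =
  join E₁ E₂ (λ s → trans (sym (gg s)) (hg s)) (λ s → trans (sym (pp s)) (hp s))

Expand-above : ∀ {e g p} → Expand e g p → ∀ i → e < i → p i ≡ 0
Expand-above (point _ p0) (suc i) _ = p0 (suc i)
Expand-above (susp {q = q} E h) (suc i) (s≤s lt)
  rewrite h (suc i) | Expand-above E (suc i) (ℕₚ.m<n⇒m<1+n lt) | Expand-above E i lt = refl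
Expand-above (join E₁ E₂ _ h) (suc (suc i)) (s≤s (s≤s lt))
  rewrite h (suc (suc i)) | Expand-above E₁ (suc (suc i)) (s≤s (s≤s lt))
        | Expand-above E₂ (suc i) (ℕₚ.m<n⇒m<1+n lt) | Expand-above E₂ i lt = refl

-- Each constructor keeps the leading coefficient positive, so `e` can be recovered from `p` alone;
-- this identifies it with the `d` of the theorem, which is known only through `IsTopSize`.
Expand-top : ∀ {e g p} → Expand e g p → 0 < p e
Expand-top (point _ p0) rewrite p0 0 = s≤s z≤n
Expand-top (susp {e} {q = q} E h) rewrite h (suc e) =
  ℕₚ.≤-trans (Expand-top E) (ℕₚ.≤-trans (ℕₚ.m≤m+n (q e) (q e)) (ℕₚ.m≤n+m (q e + q e) (q (suc e))))
Expand-top (join {e} {p₁ = p₁} E₁ _ _ h) rewrite h (2 + e) =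
  ℕₚ.≤-trans (Expand-top E₁) (ℕₚ.m≤m+n (p₁ (2 + e)) _)

Expand-vanish : ∀ {e g p} → Expand e g p → ∀ i → e < 2 * i → g i ≡ 0
Expand-vanish (point g0 _) (suc i) _ = g0 (suc i)
Expand-vanish (susp E _) i lt = Expand-vanish E i (ℕₚ.<-trans (ℕₚ.n<1+n _) lt)
Expand-vanish (join {e} E₁ E₂ h _) (suc i) lt
  rewrite h (suc i) | Expand-vanish E₁ (suc i) lt
        | Expand-vanish E₂ i (ℕₚ.≤-pred (ℕₚ.≤-pred (subst (2 + e <_) (ℕₚ.*-suc 2 i) lt))) = refl

-- Passage from f-polynomials to h- and γ-coefficients.

sumTo-cong : ∀ N {f g : ℕ → ℤ} → (∀ i → i ≤ N → f i ≡ g i) → sumTo N f ≡ sumTo N g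
sumTo-cong zero    h = h 0 z≤n
sumTo-cong (suc N) h = cong₂ ℤ._+_ (sumTo-cong N (λ i le → h i (ℕₚ.m≤n⇒m≤1+n le))) (h (suc N) ℕₚ.≤-refl)

sumTo-+ : ∀ N (f g : ℕ → ℤ) → sumTo N (λ i → f i ℤ.+ g i) ≡ sumTo N f ℤ.+ sumTo N g
sumTo-+ zero f g = refl
sumTo-+ (suc N) f g rewrite sumTo-+ N f g = lem (sumTo N f) (sumTo N g) (f (suc N)) (g (suc N))
  where
  lem : ∀ a b c d → (a ℤ.+ b) ℤ.+ (c ℤ.+ d) ≡ (a ℤ.+ c) ℤ.+ (b ℤ.+ d)
  lem = ℤSolver.solve-∀

sumTo-neg : ∀ N (f : ℕ → ℤ) → sumTo N (λ i → ℤ.- f i) ≡ ℤ.- sumTo N f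
sumTo-neg zero f = refl
sumTo-neg (suc N) f rewrite sumTo-neg N f = sym (ℤₚ.neg-distrib-+ (sumTo N f) (f (suc N)))

sumTo-zero : ∀ N {f : ℕ → ℤ} → (∀ i → i ≤ N → f i ≡ ℤ.+ 0) → sumTo N f ≡ ℤ.+ 0
sumTo-zero zero h = h 0 z≤n
sumTo-zero (suc N) h rewrite sumTo-zero N (λ i le → h i (ℕₚ.m≤n⇒m≤1+n le)) | h (suc N) ℕₚ.≤-refl = refl

sumTo-shift : ∀ N (f : ℕ → ℤ) → sumTo (suc N) f ≡ f 0 ℤ.+ sumTo N (f ∘ suc)
sumTo-shift zero f = refl
sumTo-shift (suc N) f rewrite sumTo-shift N f = ℤₚ.+-assoc (f 0) _ _

sign-suc : ∀ e → sign (suc e) ≡ ℤ.- sign e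
sign-suc zero = refl
sign-suc (suc zero) = refl
sign-suc (suc (suc e)) = sign-suc e

-- powCoeff m k is the coefficient of tᵏ in (t − 1)ᵐ.
powCoeff : ℕ → ℕ → ℤ
powCoeff m k = sign (m ∸ k) ℤ.* ℤ.+ (m choose k)

powCoeff-zero : ∀ m → powCoeff (suc m) 0 ≡ ℤ.- powCoeff m 0
powCoeff-zero m = trans (cong (ℤ._* ℤ.+ 1) (sign-suc m)) (sym (ℤₚ.neg-distribˡ-* (sign m) (ℤ.+ 1)))

powCoeff-suc : ∀ m k → powCoeff (suc m) (suc k) ≡ powCoeff m k ℤ.+ ℤ.- powCoeff m (suc k)
powCoeff-suc m k = trans (cong (λ x → sign (m ∸ k) ℤ.* ℤ.+ x) (sym (nCk+nC[k+1]≡[n+1]C[k+1] m k)))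
  (trans (ℤₚ.*-distribˡ-+ (sign (m ∸ k)) (ℤ.+ (m choose k)) (ℤ.+ (m choose suc k)))
         (cong (ℤ._+_ (powCoeff m k)) (rest (suc k ℕ.≤? m))))
  where
  -- For `m ≤ k` both exponents truncate to 0 and the sign does not flip; there the binomial
  -- coefficient vanishes.
  rest : Dec (suc k ≤ m) → sign (m ∸ k) ℤ.* ℤ.+ (m choose suc k) ≡ ℤ.- (sign (m ∸ suc k) ℤ.* ℤ.+ (m choose suc k))
  rest (yes lt) = trans (cong (ℤ._* ℤ.+ (m choose suc k)) (trans (cong sign (ℕₚ.+-∸-assoc 1 lt)) (sign-suc (m ∸ suc k))))
    (sym (ℤₚ.neg-distribˡ-* (sign (m ∸ suc k)) (ℤ.+ (m choose suc k))))
  rest (no nlt) = trans (vanish (sign (m ∸ k))) (cong ℤ.-_ (sym (vanish (sign (m ∸ suc k)))))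
    where
    vanish : ∀ a → a ℤ.* ℤ.+ (m choose suc k) ≡ ℤ.+ 0
    vanish a = trans (cong (λ c → a ℤ.* ℤ.+ c) (k>n⇒nCk≡0 (ℕₚ.≰⇒> nlt))) (ℤₚ.*-zeroʳ a)

hTerm : (ℕ → ℕ) → ℕ → ℕ → ℕ → ℤ
hTerm f d k i = sign ((d ∸ i) ∸ k) ℤ.* ℤ.+ (((d ∸ i) choose k) * f i)

hTerm-powCoeff : ∀ f d k i → hTerm f d k i ≡ powCoeff (d ∸ i) k ℤ.* ℤ.+ f i
hTerm-powCoeff f d k i = trans (cong (sign ((d ∸ i) ∸ k) ℤ.*_) (ℤₚ.pos-* ((d ∸ i) choose k) (f i)))
  (sym (ℤₚ.*-assoc (sign ((d ∸ i) ∸ k)) (ℤ.+ ((d ∸ i) choose k)) (ℤ.+ f i)))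

hCoeff-powCoeff : ∀ f d k → hCoeff f d k ≡ sumTo d (λ i → powCoeff (d ∸ i) k ℤ.* ℤ.+ f i)
hCoeff-powCoeff f d k = sumTo-cong d (λ i _ → hTerm-powCoeff f d k i)

hCoeff-+ : ∀ {f f₁ f₂ : ℕ → ℕ} d k → (∀ i → f i ≡ f₁ i + f₂ i) → hCoeff f d k ≡ hCoeff f₁ d k ℤ.+ hCoeff f₂ d k
hCoeff-+ {f} {f₁} {f₂} d k h =
  trans (sumTo-cong d (λ i _ → step i)) (sumTo-+ d (hTerm f₁ d k) (hTerm f₂ d k))
  where
  step : ∀ i → hTerm f d k i ≡ hTerm f₁ d k i ℤ.+ hTerm f₂ d k i
  step i = trans (cong (λ x → sign ((d ∸ i) ∸ k) ℤ.* ℤ.+ x)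
             (trans (cong (((d ∸ i) choose k) *_) (h i)) (ℕₚ.*-distribˡ-+ ((d ∸ i) choose k) (f₁ i) (f₂ i))))
    (ℤₚ.*-distribˡ-+ (sign ((d ∸ i) ∸ k)) (ℤ.+ (((d ∸ i) choose k) * f₁ i)) (ℤ.+ (((d ∸ i) choose k) * f₂ i)))

hCoeff-sh : ∀ f d k → hCoeff (sh f) (suc d) k ≡ hCoeff f d k
hCoeff-sh f d k = trans (sumTo-shift d (hTerm (sh f) (suc d) k))
  (trans (cong (ℤ._+ hCoeff f d k) first) (ℤₚ.+-identityˡ _))
  where
  first : hTerm (sh f) (suc d) k 0 ≡ ℤ.+ 0
  first rewrite ℕₚ.*-zeroʳ (suc d choose k) = ℤₚ.*-zeroʳ (sign (suc d ∸ k))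

module _ (f : ℕ → ℕ) (d : ℕ) (top : f (suc d) ≡ 0) where

  private
    drop-top : ∀ k → hCoeff f (suc d) k ≡ sumTo d (λ i → powCoeff (suc (d ∸ i)) k ℤ.* ℤ.+ f i)
    drop-top k = trans (hCoeff-powCoeff f (suc d) k)
      (trans (cong₂ ℤ._+_ (sumTo-cong d (λ i le → cong (λ m → powCoeff m k ℤ.* ℤ.+ f i) (ℕₚ.+-∸-assoc 1 le))) last)
             (ℤₚ.+-identityʳ _))
      where
      last : powCoeff (suc d ∸ suc d) k ℤ.* ℤ.+ f (suc d) ≡ ℤ.+ 0
      last rewrite top = ℤₚ.*-zeroʳ (powCoeff (d ∸ d) k)

  -- With no term of index `suc d`, raising `d` multiplies Σ fᵢ (t - 1)^(d - i) by t - 1. The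
  -- constant coefficient is separate because it has no predecessor.
  hCoeff-raise-zero : hCoeff f (suc d) 0 ≡ ℤ.- hCoeff f d 0
  hCoeff-raise-zero = trans (drop-top 0)
    (trans (sumTo-cong d (λ i _ → trans (cong (ℤ._* ℤ.+ f i) (powCoeff-zero (d ∸ i))) (sym (ℤₚ.neg-distribˡ-* (powCoeff (d ∸ i) 0) (ℤ.+ f i)))))
    (trans (sumTo-neg d _) (cong ℤ.-_ (sym (hCoeff-powCoeff f d 0)))))

  hCoeff-raise-suc : ∀ k → hCoeff f (suc d) (suc k) ≡ hCoeff f d k ℤ.+ ℤ.- hCoeff f d (suc k)
  hCoeff-raise-suc k = trans (drop-top (suc k))
    (trans (sumTo-cong d (λ i _ → trans (cong (ℤ._* ℤ.+ f i) (powCoeff-suc (d ∸ i) k)) (lem (powCoeff (d ∸ i) k) (powCoeff (d ∸ i) (suc k)) (ℤ.+ f i))))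
    (trans (sumTo-+ d _ _)
    (cong₂ ℤ._+_ (sym (hCoeff-powCoeff f d k))
       (trans (sumTo-neg d _) (cong ℤ.-_ (sym (hCoeff-powCoeff f d (suc k))))))))
    where
    lem : ∀ a b c → (a ℤ.+ ℤ.- b) ℤ.* c ≡ a ℤ.* c ℤ.+ ℤ.- (b ℤ.* c)
    lem = ℤSolver.solve-∀

γSum : (ℕ → ℕ) → ℕ → ℕ → ℤ
γSum g d k = sumTo d (λ i → ℤ.+ (g i * tCoeff d i k))

≤⇒≤ᵇ≡true : ∀ {i k} → i ≤ k → (i ≤ᵇ k) ≡ true
≤⇒≤ᵇ≡true {i} {k} le with i ≤ᵇ k | ℕₚ.≤⇒≤ᵇ le
... | true | _ = refl

≰⇒≤ᵇ≡false : ∀ {i k} → k < i → (i ≤ᵇ k) ≡ false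
≰⇒≤ᵇ≡false {i} {k} lt with i ≤ᵇ k in eq
... | false = refl
... | true = ⊥-elim (ℕₚ.<⇒≱ lt (ℕₚ.≤ᵇ⇒≤ i k (subst (λ b → T b) (sym eq) _)))

tCoeff-≤ : ∀ {d i k} → i ≤ k → tCoeff d i k ≡ (d ∸ 2 * i) choose (k ∸ i)
tCoeff-≤ {d} {i} {k} le rewrite ≤⇒≤ᵇ≡true le = refl

tCoeff-> : ∀ {d i k} → k < i → tCoeff d i k ≡ 0
tCoeff-> {d} {i} {k} lt rewrite ≰⇒≤ᵇ≡false lt = refl

tCoeff-raise-zero : ∀ d i → tCoeff (suc d) i 0 ≡ tCoeff d i 0
tCoeff-raise-zero d zero = refl
tCoeff-raise-zero d (suc i) = refl

-- Multiplication by 1 + t, hence Pascal's rule. The bound keeps `d ∸ 2 * i` from truncating, so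
-- that it grows together with `d`.
tCoeff-raise-suc : ∀ d i k → 2 * i ≤ d → tCoeff (suc d) i (suc k) ≡ tCoeff d i k + tCoeff d i (suc k)
tCoeff-raise-suc d i k le with ℕₚ.<-cmp i (suc k)
... | tri< (s≤s i≤k) _ _ rewrite tCoeff-≤ {suc d} (ℕₚ.m≤n⇒m≤1+n i≤k) | tCoeff-≤ {d} i≤k | tCoeff-≤ {d} (ℕₚ.m≤n⇒m≤1+n i≤k)
      | ℕₚ.+-∸-assoc 1 i≤k | ℕₚ.+-∸-assoc 1 le = sym (nCk+nC[k+1]≡[n+1]C[k+1] (d ∸ 2 * i) (k ∸ i))
... | tri≈ _ refl _ rewrite tCoeff-≤ {suc d} (ℕₚ.≤-refl {suc k}) | tCoeff-> {d} (ℕₚ.n<1+n k) | tCoeff-≤ {d} (ℕₚ.≤-refl {suc k})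
      | ℕₚ.n∸n≡0 k = refl
... | tri> _ _ gt rewrite tCoeff-> {suc d} gt | tCoeff-> {d} gt | tCoeff-> {d} {i} {k} (ℕₚ.<-trans (ℕₚ.n<1+n k) gt) = refl

-- The exponent of 1 + t is the same on both sides, since 2 + d - 2(i + 1) = d - 2i; only a factor t
-- is gained.
tCoeff-join : ∀ d i k → tCoeff (2 + d) (suc i) (suc k) ≡ tCoeff d i k
tCoeff-join d i k with ℕₚ.<-cmp i (suc k)
... | tri< (s≤s i≤k) _ _ rewrite tCoeff-≤ {2 + d} (s≤s i≤k) | tCoeff-≤ {d} i≤k | ℕₚ.+-suc i (i + 0) = refl
... | tri≈ _ refl _ rewrite tCoeff-> {2 + d} (s≤s (ℕₚ.n<1+n k)) | tCoeff-> {d} (ℕₚ.n<1+n k) = refl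
... | tri> _ _ gt rewrite tCoeff-> {2 + d} (s≤s (ℕₚ.<-trans (ℕₚ.n<1+n k) gt)) | tCoeff-> {d} {i} {k} (ℕₚ.<-trans (ℕₚ.n<1+n k) gt) = refl

module _ (g : ℕ → ℕ) (d : ℕ) (vanish : ∀ i → d < 2 * i → g i ≡ 0) where

  private
    d<2[1+d] : d < 2 * suc d
    d<2[1+d] = ℕₚ.m≤m+n (suc d) (suc d + 0)

    drop-last : (t : ℕ → ℕ) → sumTo (suc d) (λ i → ℤ.+ (g i * t i)) ≡ sumTo d (λ i → ℤ.+ (g i * t i))
    drop-last t rewrite vanish (suc d) d<2[1+d] = ℤₚ.+-identityʳ _

  γSum-raise-zero : γSum g (suc d) 0 ≡ γSum g d 0
  γSum-raise-zero = trans (drop-last _) (sumTo-cong d (λ i _ → cong (λ x → ℤ.+ (g i * x)) (tCoeff-raise-zero d i)))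

  -- With γ fixed, every summand gains a factor 1 + t. The indices with `d < 2 * i`, where the
  -- exponent truncates, carry a zero coefficient by `vanish`.
  γSum-raise-suc : ∀ k → γSum g (suc d) (suc k) ≡ γSum g d k ℤ.+ γSum g d (suc k)
  γSum-raise-suc k = trans (drop-last _) (trans (sumTo-cong d (λ i _ → term i)) (sumTo-+ d _ _))
    where
    term : ∀ i → ℤ.+ (g i * tCoeff (suc d) i (suc k)) ≡ ℤ.+ (g i * tCoeff d i k) ℤ.+ ℤ.+ (g i * tCoeff d i (suc k))
    term i with 2 * i ℕ.≤? d
    ... | yes le rewrite tCoeff-raise-suc d i k le | ℕₚ.*-distribˡ-+ (g i) (tCoeff d i k) (tCoeff d i (suc k)) = refl
    ... | no nle rewrite vanish i (ℕₚ.≰⇒> nle) = refl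

  γSum-sh-zero : γSum (sh g) (2 + d) 0 ≡ ℤ.+ 0
  γSum-sh-zero = sumTo-zero (2 + d) term
    where
    term : ∀ i → i ≤ 2 + d → ℤ.+ (sh g i * tCoeff (2 + d) i 0) ≡ ℤ.+ 0
    term zero _ = refl
    term (suc i) _ rewrite ℕₚ.*-zeroʳ (g i) = refl

  γSum-sh-suc : ∀ k → γSum (sh g) (2 + d) (suc k) ≡ γSum g d k
  γSum-sh-suc k = trans (sumTo-shift (suc d) _) (trans (ℤₚ.+-identityˡ _)
    (trans (sumTo-cong (suc d) (λ i _ → cong (λ x → ℤ.+ (g i * x)) (tCoeff-join d i k))) (drop-last _)))

γSum-+ : ∀ {g g₁ g₂ : ℕ → ℕ} d k → (∀ i → g i ≡ g₁ i + g₂ i) → γSum g d k ≡ γSum g₁ d k ℤ.+ γSum g₂ d k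
γSum-+ {g} {g₁} {g₂} d k h = trans (sumTo-cong d (λ i _ → term i)) (sumTo-+ d _ _)
  where
  term : ∀ i → ℤ.+ (g i * tCoeff d i k) ≡ ℤ.+ (g₁ i * tCoeff d i k) ℤ.+ ℤ.+ (g₂ i * tCoeff d i k)
  term i rewrite h i | ℕₚ.*-distribʳ-+ (tCoeff d i k) (g₁ i) (g₂ i) = refl

-- A suspension turns h into (t - 1)h + 2h = (1 + t)h, and the second link of a `join` contributes
-- (t - 1)h + h = t h. On the γ side the former keeps γ while d grows by one, and the latter shifts
-- γ by one while d grows by two.
Expand-hCoeff : ∀ {e g p} → Expand e g p → ∀ k → hCoeff p e k ≡ γSum g e k
Expand-hCoeff (point {g} {p} g0 p0) k rewrite g0 0 | p0 0 = lem k
  where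
  lem : ∀ k → sign (0 ∸ k) ℤ.* ℤ.+ ((0 choose k) * 1) ≡ ℤ.+ (1 * tCoeff 0 0 k)
  lem zero = refl
  lem (suc k) = refl
Expand-hCoeff (susp {e} {g} {p} {q} E h) k =
  trans (trans (hCoeff-+ {p} {q} {λ s → sh q s + sh q s} (suc e) k h)
               (cong (ℤ._+_ (hCoeff q (suc e) k)) (trans (hCoeff-+ (suc e) k (λ _ → refl)) (cong₂ ℤ._+_ (hCoeff-sh q e k) (hCoeff-sh q e k)))))
        (go k)
  where
  top = Expand-above E (suc e) (ℕₚ.n<1+n e)
  lem0 : ∀ a → ℤ.- a ℤ.+ (a ℤ.+ a) ≡ a
  lem0 = ℤSolver.solve-∀
  lem1 : ∀ a b → (a ℤ.+ ℤ.- b) ℤ.+ (b ℤ.+ b) ≡ a ℤ.+ b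
  lem1 = ℤSolver.solve-∀
  go : ∀ k → hCoeff q (suc e) k ℤ.+ (hCoeff q e k ℤ.+ hCoeff q e k) ≡ γSum g (suc e) k
  go zero rewrite hCoeff-raise-zero q e top = trans (lem0 (hCoeff q e 0))
    (trans (Expand-hCoeff E 0) (sym (γSum-raise-zero g e (Expand-vanish E))))
  go (suc k) rewrite hCoeff-raise-suc q e top k = trans (lem1 (hCoeff q e k) (hCoeff q e (suc k)))
    (trans (cong₂ ℤ._+_ (Expand-hCoeff E k) (Expand-hCoeff E (suc k))) (sym (γSum-raise-suc g e (Expand-vanish E) k)))
Expand-hCoeff (join {e} {g} {g₁} {g₂} {p} {p₁} {p₂} E₁ E₂ hg hp) k =
  trans (hCoeff-+ {p} {p₁} {λ s → sh p₂ s + sh (sh p₂) s} (2 + e) k hp)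
  (trans (cong₂ ℤ._+_ (Expand-hCoeff E₁ k)
     (trans (hCoeff-+ {f₁ = sh p₂} {sh (sh p₂)} (2 + e) k (λ _ → refl))
     (trans (cong₂ ℤ._+_ (hCoeff-sh p₂ (suc e) k) (trans (hCoeff-sh (sh p₂) (suc e) k) (hCoeff-sh p₂ e k))) (go k))))
  (sym (γSum-+ {g} {g₁} {sh g₂} (2 + e) k hg)))
  where
  top = Expand-above E₂ (suc e) (ℕₚ.n<1+n e)
  lem1 : ∀ a b → (a ℤ.+ ℤ.- b) ℤ.+ b ≡ a
  lem1 = ℤSolver.solve-∀
  go : ∀ k → hCoeff p₂ (suc e) k ℤ.+ hCoeff p₂ e k ≡ γSum (sh g₂) (2 + e) k
  go zero rewrite hCoeff-raise-zero p₂ e top = trans (ℤₚ.+-inverseˡ (hCoeff p₂ e 0)) (sym (γSum-sh-zero g₂ e (Expand-vanish E₂)))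
  go (suc k) rewrite hCoeff-raise-suc p₂ e top k = trans (lem1 (hCoeff p₂ e k) (hCoeff p₂ e (suc k)))
    (trans (Expand-hCoeff E₂ k) (sym (γSum-sh-suc g₂ e (Expand-vanish E₂) k)))

Expand⇒IsGammaVector : ∀ {e g p} → Expand e g p → IsGammaVector p e g
Expand⇒IsGammaVector E = Expand-vanish E , Expand-hCoeff E

Expand⇒IsTopSize : ∀ {e g p} → Expand e g p → IsTopSize p e
Expand⇒IsTopSize E = Expand-top E , Expand-above E

IsTopSize-unique : ∀ {f d d'} → IsTopSize f d → IsTopSize f d' → d ≡ d'
IsTopSize-unique {f} {d} {d'} (pos , above) (pos' , above') with ℕₚ.<-cmp d d'
... | tri< lt _ _ = ⊥-elim (ℕₚ.<⇒≢ pos' (sym (above d' lt)))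
... | tri≈ _ eq _ = eq
... | tri> _ _ gt = ⊥-elim (ℕₚ.<⇒≢ pos (sym (above' d gt)))

-- Clique polynomials and edge subdivisions

sh-cong : ∀ {p q : Poly} → p ≗ q → sh p ≗ sh q
sh-cong h zero    = refl
sh-cong h (suc s) = h s

sh-+ : ∀ (p q : Poly) s → sh (λ s → p s + q s) s ≡ sh p s + sh q s
sh-+ p q zero = refl
sh-+ p q (suc s) = refl

module _ {A : Set} where

  filterᵇ-cong : ∀ {f g : A → Bool} W → (∀ {c} → c ∈ₗ W → f c ≡ g c) → filterᵇ f W ≡ filterᵇ g W
  filterᵇ-cong [] h = refl
  filterᵇ-cong {f} {g} (w ∷ W) h with f w | g w | h (here refl)
  ... | true  | _ | refl = cong (w ∷_) (filterᵇ-cong W (h ∘ there))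
  ... | false | _ | refl = filterᵇ-cong W (h ∘ there)

  filterᵇ-filterᵇ : ∀ (f g : A → Bool) W → filterᵇ f (filterᵇ g W) ≡ filterᵇ (λ c → f c ∧ g c) W
  filterᵇ-filterᵇ f g [] = refl
  filterᵇ-filterᵇ f g (w ∷ W) with g w
  ... | false rewrite 𝔹ₚ.∧-zeroʳ (f w) = filterᵇ-filterᵇ f g W
  ... | true with f w
  ...   | true  = cong (w ∷_) (filterᵇ-filterᵇ f g W)
  ...   | false = filterᵇ-filterᵇ f g W

  filterᵇ-keep : ∀ {f : A → Bool} W → (∀ {c} → c ∈ₗ W → f c ≡ true) → filterᵇ f W ≡ W
  filterᵇ-keep [] h = refl
  filterᵇ-keep {f} (w ∷ W) h with f w | h (here refl)
  ... | true | refl = cong (w ∷_) (filterᵇ-keep W (h ∘ there))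

  filterᵇ-accept : ∀ (f : A → Bool) w W → f w ≡ true → filterᵇ f (w ∷ W) ≡ w ∷ filterᵇ f W
  filterᵇ-accept f w W h with f w | h
  ... | true | refl = refl

  filterᵇ-reject : ∀ (f : A → Bool) w W → f w ≡ false → filterᵇ f (w ∷ W) ≡ filterᵇ f W
  filterᵇ-reject f w W h with f w | h
  ... | false | refl = refl

  ∈-filterᵇ⁻ : ∀ {f : A → Bool} W {c} → c ∈ₗ filterᵇ f W → c ∈ₗ W × f c ≡ true
  ∈-filterᵇ⁻ {f} (w ∷ W) p with f w in eq
  ... | false = let q , r = ∈-filterᵇ⁻ W p in there q , r
  ∈-filterᵇ⁻ {f} (w ∷ W) (here refl) | true = here refl , eq
  ∈-filterᵇ⁻ {f} (w ∷ W) (there p) | true = let q , r = ∈-filterᵇ⁻ W p in there q , r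

  ∈-filterᵇ⁺ : ∀ {f : A → Bool} {W c} → c ∈ₗ W → f c ≡ true → c ∈ₗ filterᵇ f W
  ∈-filterᵇ⁺ {f} {w ∷ W} (here refl) h rewrite filterᵇ-accept f w W h = here refl
  ∈-filterᵇ⁺ {f} {w ∷ W} (there p) h with f w
  ... | true  = there (∈-filterᵇ⁺ p h)
  ... | false = ∈-filterᵇ⁺ p h

  filterᵇ-↭ : ∀ (f : A → Bool) {W W'} → W ↭ W' → filterᵇ f W ↭ filterᵇ f W'
  filterᵇ-↭ f = Permₚ.filter-↭ _

  all-cong : ∀ {f g : A → Bool} σ → (∀ {s} → s ∈ₗ σ → f s ≡ g s) → all f σ ≡ all g σ
  all-cong [] h = refl
  all-cong (s ∷ σ) h = cong₂ _∧_ (h (here refl)) (all-cong σ (h ∘ there))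

  all-true⁺ : ∀ {f : A → Bool} σ → (∀ {s} → s ∈ₗ σ → f s ≡ true) → all f σ ≡ true
  all-true⁺ [] h = refl
  all-true⁺ {f} (s ∷ σ) h rewrite h (here refl) = all-true⁺ σ (h ∘ there)

  all-true⁻ : ∀ {f : A → Bool} {σ} → all f σ ≡ true → ∀ {s} → s ∈ₗ σ → f s ≡ true
  all-true⁻ {f} {s ∷ σ} h (here refl) = 𝔹ₚ.∧-conicalˡ (f s) _ h
  all-true⁻ {f} {s ∷ σ} h (there p) = all-true⁻ {σ = σ} (𝔹ₚ.∧-conicalʳ (f s) _ h) p

  all-false⁺ : ∀ {f : A → Bool} {σ s} → s ∈ₗ σ → f s ≡ false → all f σ ≡ false
  all-false⁺ {f} {σ = _ ∷ σ} (here refl) h = cong (_∧ all f σ) h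
  all-false⁺ {f} {σ = t ∷ _} (there p) h = trans (cong (f t ∧_) (all-false⁺ p h)) (𝔹ₚ.∧-zeroʳ (f t))

  all-∧ : ∀ (f g : A → Bool) σ → all (λ s → f s ∧ g s) σ ≡ all f σ ∧ all g σ
  all-∧ f g [] = refl
  all-∧ f g (s ∷ σ) rewrite all-∧ f g σ with f s | g s
  ... | true  | true  = refl
  ... | true  | false = sym (𝔹ₚ.∧-zeroʳ (all f σ))
  ... | false | _     = refl

  all-↭ : ∀ (f : A → Bool) {σ τ} → σ ↭ τ → all f σ ≡ all f τ
  all-↭ f Perm.refl = refl
  all-↭ f (Perm.prep x p) = cong (f x ∧_) (all-↭ f p)
  all-↭ f (Perm.swap x y p) rewrite all-↭ f p with f x | f y
  ... | true  | true  = refl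
  ... | true  | false = refl
  ... | false | true  = refl
  ... | false | false = refl
  all-↭ f (Perm.trans p q) = trans (all-↭ f p) (all-↭ f q)

  -- cl a s W counts the s-element cliques of the graph a inside W.
  cl : (A → A → Bool) → ℕ → List A → ℕ
  cl a zero    W       = 1
  cl a (suc s) []      = 0
  cl a (suc s) (w ∷ W) = cl a (suc s) W + cl a s (filterᵇ (a w) W)

  clᵖ : (A → A → Bool) → List A → Poly
  clᵖ a W s = cl a s W

  clᵖ-[] : ∀ a → clᵖ a [] ≗ δ₀
  clᵖ-[] a zero    = refl
  clᵖ-[] a (suc s) = refl

  clᵖ-∷ : ∀ a w W s → clᵖ a (w ∷ W) s ≡ clᵖ a W s + sh (clᵖ a (filterᵇ (a w) W)) s
  clᵖ-∷ a w W zero    = refl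
  clᵖ-∷ a w W (suc s) = refl

  cl-cong : ∀ {a a' : A → A → Bool} s W → (∀ {c d} → c ∈ₗ W → d ∈ₗ W → a c d ≡ a' c d) → cl a s W ≡ cl a' s W
  cl-cong zero W h = refl
  cl-cong (suc s) [] h = refl
  cl-cong {a} {a'} (suc s) (w ∷ W) h = cong₂ _+_ (cl-cong (suc s) W (λ p q → h (there p) (there q)))
    (trans (cong (cl a s) (filterᵇ-cong W (λ p → h (here refl) (there p))))
           (cl-cong s (filterᵇ (a' w) W) (λ p q → h (there (proj₁ (∈-filterᵇ⁻ W p))) (there (proj₁ (∈-filterᵇ⁻ W q))))))

  module _ (a : A → A → Bool) (a-sym : ∀ c d → a c d ≡ a d c) where

    -- A clique is counted at its first vertex in the list, so the cliques through both `x` and `y`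
    -- move from one summand to the other; either way they are counted over the common neighbours.
    cl-swap : ∀ s x y W → cl a s (x ∷ y ∷ W) ≡ cl a s (y ∷ x ∷ W)
    cl-swap zero x y W = refl
    cl-swap (suc s) x y W rewrite a-sym y x with a x y
    ... | false = lem (cl a (suc s) W) (cl a s (filterᵇ (a y) W)) (cl a s (filterᵇ (a x) W))
      where
      lem : ∀ p q r → p + q + r ≡ p + r + q
      lem = ℕSolver.solve-∀
    ... | true rewrite clᵖ-∷ a y (filterᵇ (a x) W) s | clᵖ-∷ a x (filterᵇ (a y) W) s
                     | filterᵇ-filterᵇ (a y) (a x) W | filterᵇ-filterᵇ (a x) (a y) W
                     | filterᵇ-cong {λ c → a x c ∧ a y c} {λ c → a y c ∧ a x c} W (λ {c} _ → 𝔹ₚ.∧-comm (a x c) (a y c)) =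
      lem (cl a (suc s) W) (cl a s (filterᵇ (a y) W)) (cl a s (filterᵇ (a x) W)) _
      where
      lem : ∀ p q r u → p + q + (r + u) ≡ p + r + (q + u)
      lem = ℕSolver.solve-∀

    cl-↭ : ∀ s {W W'} → W ↭ W' → cl a s W ≡ cl a s W'
    cl-↭ zero p = refl
    cl-↭ (suc s) Perm.refl = refl
    cl-↭ (suc s) (Perm.prep x p) = cong₂ _+_ (cl-↭ (suc s) p) (cl-↭ s (filterᵇ-↭ (a x) p))
    cl-↭ (suc s) {_ ∷ _ ∷ W} (Perm.swap x y p) = trans (cl-swap (suc s) x y W)
      (cong₂ _+_ (cong₂ _+_ (cl-↭ (suc s) p) (cl-↭ s (filterᵇ-↭ (a x) p)))
                 (cl-↭ s (filterᵇ-↭ (a y) (Perm.prep x p))))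
    cl-↭ (suc s) (Perm.trans p q) = trans (cl-↭ (suc s) p) (cl-↭ (suc s) q)

  -- The link of the face `σ` in the clique complex. For irreflexive `e` the vertices of `σ` drop
  -- out by themselves.
  lk : (A → A → Bool) → List A → List A → List A
  lk e σ V = filterᵇ (λ c → all (e c) σ) V

  lk-↭ˡ : ∀ e {σ τ} V → σ ↭ τ → lk e σ V ≡ lk e τ V
  lk-↭ˡ e V p = filterᵇ-cong V (λ {c} _ → all-↭ (e c) p)

  lk-take : ∀ e σ w W → (∀ {s} → s ∈ₗ σ → e w s ≡ true) → lk e σ (w ∷ W) ≡ w ∷ lk e σ W
  lk-take e σ w W h = filterᵇ-accept (λ c → all (e c) σ) w W (all-true⁺ σ h)

  lk-drop : ∀ e σ w W {s} → s ∈ₗ σ → e w s ≡ false → lk e σ (w ∷ W) ≡ lk e σ W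
  lk-drop e σ w W p h = filterᵇ-reject (λ c → all (e c) σ) w W (all-false⁺ p h)

  -- e' is the graph of the flag complex obtained from that of e by the
  -- stellar subdivision of the edge xy with new vertex v.
  record Subdivision (e e' : A → A → Bool) (x y v : A) (V₀ : List A) : Set where
    field
      irrefl  : ∀ c → e c c ≡ false
      irrefl' : ∀ c → e' c c ≡ false
      symm    : ∀ c d → e c d ≡ e d c
      symm'   : ∀ c d → e' c d ≡ e' d c
      edge    : e x y ≡ true
      cut     : e' x y ≡ false
      old     : ∀ {c d} → c ∈ₗ V₀ → d ∈ₗ V₀ → e' c d ≡ e c d
      oldx    : ∀ {c} → c ∈ₗ V₀ → e' x c ≡ e x c
      oldy    : ∀ {c} → c ∈ₗ V₀ → e' y c ≡ e y c
      newx    : e' v x ≡ true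
      newy    : e' v y ≡ true
      new     : ∀ {c} → c ∈ₗ V₀ → e' v c ≡ e x c ∧ e y c

  module _ {e e' : A → A → Bool} {x y v : A} {V₀ : List A} (S : Subdivision e e' x y v V₀) where
    open Subdivision S

    private
      cl'≡cl : ∀ s {f : A → Bool} → cl e' s (filterᵇ f V₀) ≡ cl e s (filterᵇ f V₀)
      cl'≡cl s {f} = cl-cong s (filterᵇ f V₀) (λ p q → old (proj₁ (∈-filterᵇ⁻ V₀ p)) (proj₁ (∈-filterᵇ⁻ V₀ q)))

      filter₀ : ∀ {f g : A → Bool} → (∀ {c} → c ∈ₗ V₀ → f c ≡ g c) → filterᵇ f V₀ ≡ filterᵇ g V₀
      filter₀ = filterᵇ-cong V₀

      link₀ : ∀ {σ} → (∀ {s} → s ∈ₗ σ → s ∈ₗ V₀) → lk e' σ V₀ ≡ lk e σ V₀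
      link₀ {σ} σ⊆ = filter₀ (λ p → all-cong σ (λ q → old p (σ⊆ q)))

      x-old : ∀ {c} → c ∈ₗ V₀ → e' c x ≡ e c x
      x-old {c} p = trans (symm' c x) (trans (oldx p) (symm x c))

      y-old : ∀ {c} → c ∈ₗ V₀ → e' c y ≡ e c y
      y-old {c} p = trans (symm' c y) (trans (oldy p) (symm y c))

      v-old : ∀ {c} → c ∈ₗ V₀ → e' c v ≡ e c x ∧ e c y
      v-old {c} p = trans (symm' c v) (trans (new p) (cong₂ _∧_ (symm x c) (symm y c)))

    -- In the link of v and τ the vertices `x` and `y` are no longer adjacent, and both are joined
    -- to all the rest, which is the old link of x, y and τ.
    link-v : ∀ {τ} → (∀ {s} → s ∈ₗ τ → s ∈ₗ V₀) → (∀ {s} → s ∈ₗ τ → e' v s ≡ true) →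
             let q = clᵖ e (lk e (x ∷ y ∷ τ) (x ∷ y ∷ V₀)) in
             ∀ s → clᵖ e' (lk e' (v ∷ τ) (v ∷ x ∷ y ∷ V₀)) s ≡ q s + (sh q s + sh q s)
    link-v {τ} τ⊆ adj s = begin
        cl e' s (lk e' (v ∷ τ) (v ∷ x ∷ y ∷ V₀))  ≡⟨ cong (cl e' s) lk'≡ ⟩
        cl e' s (x ∷ y ∷ Z)                        ≡⟨ clᵖ-∷ e' x (y ∷ Z) s ⟩
        clᵖ e' (y ∷ Z) s + sh (clᵖ e' (filterᵇ (e' x) (y ∷ Z))) s
          ≡⟨ cong₂ (λ a W → a + sh (clᵖ e' W) s) (clᵖ-∷ e' y Z s) (trans (filterᵇ-reject (e' x) y Z cut) (filterᵇ-keep Z x-keep)) ⟩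
        clᵖ e' Z s + sh (clᵖ e' (filterᵇ (e' y) Z)) s + sh (clᵖ e' Z) s
          ≡⟨ cong (λ W → clᵖ e' Z s + sh (clᵖ e' W) s + sh (clᵖ e' Z) s) (filterᵇ-keep Z y-keep) ⟩
        clᵖ e' Z s + sh (clᵖ e' Z) s + sh (clᵖ e' Z) s ≡⟨ ℕₚ.+-assoc (clᵖ e' Z s) _ _ ⟩
        clᵖ e' Z s + (sh (clᵖ e' Z) s + sh (clᵖ e' Z) s)
          ≡⟨ cong₂ (λ a b → a + (b + b)) (cl'≡cl s) (sh-cong (λ t → cl'≡cl t) s) ⟩
        clᵖ e Z s + (sh (clᵖ e Z) s + sh (clᵖ e Z) s)
          ≡⟨ cong (λ W → clᵖ e W s + (sh (clᵖ e W) s + sh (clᵖ e W) s)) (sym lk≡) ⟩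
        _ ∎
      where
      open ≡-Reasoning
      Z : List A
      Z = lk e (x ∷ y ∷ τ) V₀
      x-keep : ∀ {c} → c ∈ₗ Z → e' x c ≡ true
      x-keep {c} p = let q , r = ∈-filterᵇ⁻ V₀ p in trans (oldx q) (trans (symm x c) (all-true⁻ {f = e c} {x ∷ y ∷ τ} r (here refl)))
      y-keep : ∀ {c} → c ∈ₗ Z → e' y c ≡ true
      y-keep {c} p = let q , r = ∈-filterᵇ⁻ V₀ p in trans (oldy q) (trans (symm y c) (all-true⁻ {f = e c} {x ∷ y ∷ τ} r (there (here refl))))
      xτ : ∀ {s} → s ∈ₗ τ → e' x s ≡ true
      xτ {s} p = trans (oldx (τ⊆ p)) (𝔹ₚ.∧-conicalˡ _ _ (trans (sym (new (τ⊆ p))) (adj p)))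
      yτ : ∀ {s} → s ∈ₗ τ → e' y s ≡ true
      yτ {s} p = trans (oldy (τ⊆ p)) (𝔹ₚ.∧-conicalʳ (e x s) _ (trans (sym (new (τ⊆ p))) (adj p)))
      lk'≡ : lk e' (v ∷ τ) (v ∷ x ∷ y ∷ V₀) ≡ x ∷ y ∷ Z
      lk'≡ = trans (lk-drop e' (v ∷ τ) v (x ∷ y ∷ V₀) (here refl) (irrefl' v))
        (trans (lk-take e' (v ∷ τ) x (y ∷ V₀) λ { (here refl) → trans (symm' x v) newx ; (there p) → xτ p })
        (cong (x ∷_) (trans (lk-take e' (v ∷ τ) y V₀ λ { (here refl) → trans (symm' y v) newy ; (there p) → yτ p })
        (cong (y ∷_) (filter₀ (λ {c} p → trans (cong₂ _∧_ (v-old p) (all-cong τ (λ q → old p (τ⊆ q)))) (𝔹ₚ.∧-assoc (e c x) (e c y) (all (e c) τ))))))))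
      lk≡ : lk e (x ∷ y ∷ τ) (x ∷ y ∷ V₀) ≡ Z
      lk≡ = trans (lk-drop e (x ∷ y ∷ τ) x (y ∷ V₀) (here refl) (irrefl x))
        (lk-drop e (x ∷ y ∷ τ) y V₀ (there (here refl)) (irrefl y))

    -- `y` is cut off from `x`, and among the remaining vertices the common neighbours of `v` and
    -- `x` are those of `y` and `x`; the two links are the same list.
    link-vx : ∀ {τ} → (∀ {s} → s ∈ₗ τ → s ∈ₗ V₀) →
              ∀ s → clᵖ e' (lk e' (v ∷ x ∷ τ) (v ∷ x ∷ y ∷ V₀)) s ≡ clᵖ e (lk e (y ∷ x ∷ τ) (x ∷ y ∷ V₀)) s
    link-vx {τ} τ⊆ s = trans (cong (cl e' s) lk'≡) (trans (cl'≡cl s) (cong (cl e s) (sym lk≡)))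
      where
      Z : List A
      Z = lk e (y ∷ x ∷ τ) V₀
      lk'≡ : lk e' (v ∷ x ∷ τ) (v ∷ x ∷ y ∷ V₀) ≡ Z
      lk'≡ = trans (lk-drop e' (v ∷ x ∷ τ) v (x ∷ y ∷ V₀) (here refl) (irrefl' v))
        (trans (lk-drop e' (v ∷ x ∷ τ) x (y ∷ V₀) (there (here refl)) (irrefl' x))
        (trans (lk-drop e' (v ∷ x ∷ τ) y V₀ (there (here refl)) (trans (symm' y x) cut))
        (filter₀ (λ {c} p → trans (cong₂ _∧_ (v-old p) (cong₂ _∧_ (x-old p) (all-cong τ (λ q → old p (τ⊆ q))))) (lem (e c x) (e c y) (all (e c) τ))))))
        where
        lem : ∀ a b c → (a ∧ b) ∧ (a ∧ c) ≡ b ∧ (a ∧ c)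
        lem true b c = refl
        lem false b c = sym (𝔹ₚ.∧-zeroʳ b)
      lk≡ : lk e (y ∷ x ∷ τ) (x ∷ y ∷ V₀) ≡ Z
      lk≡ = trans (lk-drop e (y ∷ x ∷ τ) x (y ∷ V₀) (there (here refl)) (irrefl x))
        (lk-drop e (y ∷ x ∷ τ) y V₀ (here refl) (irrefl y))

    -- The cliques through both `x` and `y`, counted by t² q, are lost; those through `v`, counted
    -- by t (1 + 2t) q, are gained. The balance is (t + t²) q.
    link-ready : ∀ {σ} → (∀ {s} → s ∈ₗ σ → s ∈ₗ V₀) → (∀ {s} → s ∈ₗ σ → e x s ≡ true) → (∀ {s} → s ∈ₗ σ → e y s ≡ true) →
      let q = clᵖ e (lk e (x ∷ y ∷ σ) (x ∷ y ∷ V₀)) in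
      ∀ s → clᵖ e' (lk e' σ (v ∷ x ∷ y ∷ V₀)) s ≡ clᵖ e (lk e σ (x ∷ y ∷ V₀)) s + (sh q s + sh (sh q) s)
    link-ready {σ} σ⊆ xσ yσ s = begin
        clᵖ e' (lk e' σ (v ∷ x ∷ y ∷ V₀)) s  ≡⟨ cong (cl e' s) lk'≡ ⟩
        clᵖ e' (v ∷ x ∷ y ∷ Z) s             ≡⟨ clᵖ-∷ e' v (x ∷ y ∷ Z) s ⟩
        clᵖ e' (x ∷ y ∷ Z) s + sh (clᵖ e' (filterᵇ (e' v) (x ∷ y ∷ Z))) s
          ≡⟨ cong₂ (λ a W → a + sh (clᵖ e' W) s) (clᵖ-∷ e' x (y ∷ Z) s) Nv ⟩
        clᵖ e' (y ∷ Z) s + sh (clᵖ e' (filterᵇ (e' x) (y ∷ Z))) s + sh (clᵖ e' (x ∷ y ∷ Y)) s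
          ≡⟨ cong₂ _+_ (cong₂ (λ a W → a + sh (clᵖ e' W) s) (clᵖ-∷ e' y Z s) (filterᵇ-reject (e' x) y Z cut)) (sh-cong xyY s) ⟩
        clᵖ e' Z s + sh (clᵖ e' (filterᵇ (e' y) Z)) s + sh (clᵖ e' (filterᵇ (e' x) Z)) s
           + sh (λ s → P s + (sh P s + sh P s)) s
          ≡⟨ cong₂ (λ a b → clᵖ e' Z s + a + b + sh (λ s → P s + (sh P s + sh P s)) s) (sh-cong (λ t → toE (e' y) (e y) t oldy) s) (sh-cong (λ t → toE (e' x) (e x) t oldx) s) ⟩
        clᵖ e' Z s + sh Cy s + sh Cx s + sh (λ s → P s + (sh P s + sh P s)) s
          ≡⟨ cong₂ (λ a b → a + sh Cy s + sh Cx s + b) (cl'≡cl s) (trans (sh-+ P _ s) (cong (sh P s +_) (sh-+ (sh P) (sh P) s))) ⟩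
        clᵖ e Z s + sh Cy s + sh Cx s + (sh P s + (sh (sh P) s + sh (sh P) s))
          ≡⟨ lem (clᵖ e Z s) (sh Cy s) (sh Cx s) (sh P s) (sh (sh P) s) ⟩
        clᵖ e Z s + sh Cy s + (sh Cx s + sh (sh P) s) + (sh P s + sh (sh P) s)
          ≡⟨ cong₂ _+_ (sym old-side) (sym new-side) ⟩
        _ ∎
      where
      open ≡-Reasoning
      Z Y : List A
      Z = lk e σ V₀
      Y = filterᵇ (e y) (filterᵇ (e x) Z)
      Cx Cy P : Poly
      Cx = clᵖ e (filterᵇ (e x) Z)
      Cy = clᵖ e (filterᵇ (e y) Z)
      P = clᵖ e Y
      lem : ∀ a b c d f → a + b + c + (d + (f + f)) ≡ a + b + (c + f) + (d + f)
      lem = ℕSolver.solve-∀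
      Z⊆ : ∀ {c} → c ∈ₗ Z → c ∈ₗ V₀
      Z⊆ = proj₁ ∘ ∈-filterᵇ⁻ V₀
      Y⊆Z : ∀ {c} → c ∈ₗ Y → c ∈ₗ Z
      Y⊆Z = proj₁ ∘ ∈-filterᵇ⁻ Z ∘ proj₁ ∘ ∈-filterᵇ⁻ (filterᵇ (e x) Z)
      toE : ∀ (f' f : A → Bool) t → (∀ {c} → c ∈ₗ V₀ → f' c ≡ f c) → clᵖ e' (filterᵇ f' Z) t ≡ clᵖ e (filterᵇ f Z) t
      toE f' f t h = trans (cong (cl e' t) (filterᵇ-cong Z (h ∘ Z⊆)))
        (cl-cong t (filterᵇ f Z) (λ p q → old (Z⊆ (proj₁ (∈-filterᵇ⁻ Z p))) (Z⊆ (proj₁ (∈-filterᵇ⁻ Z q)))))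
      v-nbr : ∀ {s} → s ∈ₗ σ → e' v s ≡ true
      v-nbr p = trans (new (σ⊆ p)) (cong₂ _∧_ (xσ p) (yσ p))
      lk'≡ : lk e' σ (v ∷ x ∷ y ∷ V₀) ≡ v ∷ x ∷ y ∷ Z
      lk'≡ = trans (lk-take e' σ v (x ∷ y ∷ V₀) v-nbr)
        (cong (v ∷_) (trans (lk-take e' σ x (y ∷ V₀) (λ p → trans (oldx (σ⊆ p)) (xσ p)))
        (cong (x ∷_) (trans (lk-take e' σ y V₀ (λ p → trans (oldy (σ⊆ p)) (yσ p)))
        (cong (y ∷_) (link₀ σ⊆))))))
      Nv : filterᵇ (e' v) (x ∷ y ∷ Z) ≡ x ∷ y ∷ Y
      Nv = trans (filterᵇ-accept (e' v) x (y ∷ Z) newx) (cong (x ∷_) (trans (filterᵇ-accept (e' v) y Z newy)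
        (cong (y ∷_) (trans (filterᵇ-cong Z (λ {c} p → trans (new (Z⊆ p)) (𝔹ₚ.∧-comm (e x c) (e y c)))) (sym (filterᵇ-filterᵇ (e y) (e x) Z))))))
      xyY : ∀ t → clᵖ e' (x ∷ y ∷ Y) t ≡ P t + (sh P t + sh P t)
      xyY t = begin
        clᵖ e' (x ∷ y ∷ Y) t ≡⟨ clᵖ-∷ e' x (y ∷ Y) t ⟩
        clᵖ e' (y ∷ Y) t + sh (clᵖ e' (filterᵇ (e' x) (y ∷ Y))) t
          ≡⟨ cong₂ (λ a W → a + sh (clᵖ e' W) t) (clᵖ-∷ e' y Y t) (trans (filterᵇ-reject (e' x) y Y cut) (filterᵇ-keep Y x-keep)) ⟩
        clᵖ e' Y t + sh (clᵖ e' (filterᵇ (e' y) Y)) t + sh (clᵖ e' Y) t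
          ≡⟨ cong (λ W → clᵖ e' Y t + sh (clᵖ e' W) t + sh (clᵖ e' Y) t) (filterᵇ-keep Y y-keep) ⟩
        clᵖ e' Y t + sh (clᵖ e' Y) t + sh (clᵖ e' Y) t ≡⟨ ℕₚ.+-assoc (clᵖ e' Y t) _ _ ⟩
        clᵖ e' Y t + (sh (clᵖ e' Y) t + sh (clᵖ e' Y) t) ≡⟨ cong₂ (λ a b → a + (b + b)) (Y≡ t) (sh-cong Y≡ t) ⟩
        P t + (sh P t + sh P t) ∎
        where
        x-keep : ∀ {c} → c ∈ₗ Y → e' x c ≡ true
        x-keep p = trans (oldx (Z⊆ (Y⊆Z p))) (proj₂ (∈-filterᵇ⁻ {f = e x} Z (proj₁ (∈-filterᵇ⁻ (filterᵇ (e x) Z) p))))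
        y-keep : ∀ {c} → c ∈ₗ Y → e' y c ≡ true
        y-keep p = trans (oldy (Z⊆ (Y⊆Z p))) (proj₂ (∈-filterᵇ⁻ {f = e y} (filterᵇ (e x) Z) p))
        Y≡ : ∀ t → clᵖ e' Y t ≡ P t
        Y≡ t = cl-cong t Y (λ p q → old (Z⊆ (Y⊆Z p)) (Z⊆ (Y⊆Z q)))
      old-side : clᵖ e (lk e σ (x ∷ y ∷ V₀)) s ≡ clᵖ e Z s + sh Cy s + (sh Cx s + sh (sh P) s)
      old-side = begin
        clᵖ e (lk e σ (x ∷ y ∷ V₀)) s
          ≡⟨ cong (cl e s) (trans (lk-take e σ x (y ∷ V₀) xσ) (cong (x ∷_) (lk-take e σ y V₀ yσ))) ⟩
        clᵖ e (x ∷ y ∷ Z) s ≡⟨ clᵖ-∷ e x (y ∷ Z) s ⟩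
        clᵖ e (y ∷ Z) s + sh (clᵖ e (filterᵇ (e x) (y ∷ Z))) s
          ≡⟨ cong₂ (λ a W → a + sh (clᵖ e W) s) (clᵖ-∷ e y Z s) (filterᵇ-accept (e x) y Z edge) ⟩
        clᵖ e Z s + sh Cy s + sh (clᵖ e (y ∷ filterᵇ (e x) Z)) s
          ≡⟨ cong (clᵖ e Z s + sh Cy s +_) (trans (sh-cong (clᵖ-∷ e y (filterᵇ (e x) Z)) s) (sh-+ Cx (sh P) s)) ⟩
        _ ∎
      new-side : let q = clᵖ e (lk e (x ∷ y ∷ σ) (x ∷ y ∷ V₀)) in sh q s + sh (sh q) s ≡ sh P s + sh (sh P) s
      new-side = cong (λ W → sh (clᵖ e W) s + sh (sh (clᵖ e W)) s)
        (trans (lk-drop e (x ∷ y ∷ σ) x (y ∷ V₀) (here refl) (irrefl x))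
        (trans (lk-drop e (x ∷ y ∷ σ) y V₀ (there (here refl)) (irrefl y))
        (sym (trans (cong (filterᵇ (e y)) (filterᵇ-filterᵇ (e x) (λ c → all (e c) σ) V₀))
          (trans (filterᵇ-filterᵇ (e y) (λ c → e x c ∧ all (e c) σ) V₀)
          (filter₀ (λ {c} _ → trans (lem2 (e y c) (e x c) (all (e c) σ)) (cong₂ (λ a b → a ∧ (b ∧ all (e c) σ)) (symm x c) (symm y c)))))))))
        where
        lem2 : ∀ a b c → a ∧ (b ∧ c) ≡ b ∧ (a ∧ c)
        lem2 true b c = refl
        lem2 false b c = sym (𝔹ₚ.∧-zeroʳ b)

    -- Over neighbours of `x`, adjacency to `v` is the old adjacency to `y`, so `v` takes the place
    -- of `y`; each belongs to its link exactly when `y` is adjacent to all of `τ`.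
    link-x : ∀ {τ} → (∀ {s} → s ∈ₗ τ → s ∈ₗ V₀) → (∀ {s} → s ∈ₗ τ → e' x s ≡ true) →
             ∀ s → clᵖ e' (lk e' (x ∷ τ) (v ∷ x ∷ y ∷ V₀)) s ≡ clᵖ e (lk e (x ∷ τ) (x ∷ y ∷ V₀)) s
    link-x {τ} τ⊆ adj s = go (all (e y) τ) refl
      where
      open ≡-Reasoning
      Z : List A
      Z = lk e (x ∷ τ) V₀
      Z⊆ : ∀ {c} → c ∈ₗ Z → c ∈ₗ V₀
      Z⊆ = proj₁ ∘ ∈-filterᵇ⁻ V₀
      x-true : ∀ {c} → c ∈ₗ Z → e x c ≡ true
      x-true {c} p = trans (symm x c) (all-true⁻ {f = e c} {x ∷ τ} (proj₂ (∈-filterᵇ⁻ V₀ p)) (here refl))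
      vτ : all (e' v) (x ∷ τ) ≡ all (e y) τ
      vτ = trans (cong (_∧ all (e' v) τ) newx) (all-cong τ (λ {t} p → trans (new (τ⊆ p)) (cong (_∧ e y t) (trans (sym (oldx (τ⊆ p))) (adj p)))))
      yτ : all (e y) (x ∷ τ) ≡ all (e y) τ
      yτ = cong (_∧ all (e y) τ) (trans (symm y x) edge)
      lk'-rest : lk e' (x ∷ τ) (x ∷ y ∷ V₀) ≡ Z
      lk'-rest = trans (lk-drop e' (x ∷ τ) x (y ∷ V₀) (here refl) (irrefl' x)) (trans (lk-drop e' (x ∷ τ) y V₀ (here refl) (trans (symm' y x) cut))
          (filter₀ (λ p → cong₂ _∧_ (x-old p) (all-cong τ (λ q → old p (τ⊆ q))))))
      go : ∀ r → all (e y) τ ≡ r → clᵖ e' (lk e' (x ∷ τ) (v ∷ x ∷ y ∷ V₀)) s ≡ clᵖ e (lk e (x ∷ τ) (x ∷ y ∷ V₀)) s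
      go false eq = begin
        cl e' s (lk e' (x ∷ τ) (v ∷ x ∷ y ∷ V₀)) ≡⟨ cong (cl e' s) (trans (filterᵇ-reject (λ c → all (e' c) (x ∷ τ)) v (x ∷ y ∷ V₀) (trans vτ eq)) lk'-rest) ⟩
        cl e' s Z ≡⟨ cl'≡cl s ⟩
        cl e s Z ≡⟨ cong (cl e s) (sym (trans (lk-drop e (x ∷ τ) x (y ∷ V₀) (here refl) (irrefl x)) (filterᵇ-reject (λ c → all (e c) (x ∷ τ)) y V₀ (trans yτ eq)))) ⟩
        cl e s (lk e (x ∷ τ) (x ∷ y ∷ V₀)) ∎
      go true eq = begin
        cl e' s (lk e' (x ∷ τ) (v ∷ x ∷ y ∷ V₀))
          ≡⟨ cong (cl e' s) (trans (filterᵇ-accept (λ c → all (e' c) (x ∷ τ)) v (x ∷ y ∷ V₀) (trans vτ eq)) (cong (v ∷_) lk'-rest)) ⟩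
        cl e' s (v ∷ Z) ≡⟨ clᵖ-∷ e' v Z s ⟩
        clᵖ e' Z s + sh (clᵖ e' (filterᵇ (e' v) Z)) s ≡⟨ cong₂ _+_ (cl'≡cl s) (sh-cong v≈y s) ⟩
        clᵖ e Z s + sh (clᵖ e (filterᵇ (e y) Z)) s ≡⟨ sym (clᵖ-∷ e y Z s) ⟩
        cl e s (y ∷ Z)
          ≡⟨ cong (cl e s) (sym (trans (lk-drop e (x ∷ τ) x (y ∷ V₀) (here refl) (irrefl x)) (filterᵇ-accept (λ c → all (e c) (x ∷ τ)) y V₀ (trans yτ eq)))) ⟩
        cl e s (lk e (x ∷ τ) (x ∷ y ∷ V₀)) ∎
        where
        v≈y : ∀ t → clᵖ e' (filterᵇ (e' v) Z) t ≡ clᵖ e (filterᵇ (e y) Z) t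
        v≈y t = trans (cong (cl e' t) (filterᵇ-cong Z (λ {c} p → trans (new (Z⊆ p)) (cong (_∧ e y c) (x-true p)))))
          (cl-cong t (filterᵇ (e y) Z) (λ p q → old (Z⊆ (proj₁ (∈-filterᵇ⁻ Z p))) (Z⊆ (proj₁ (∈-filterᵇ⁻ Z q)))))

    -- `v` stays outside the link, and `x` and `y` are not both inside it, so the link never sees
    -- the one old pair whose adjacency changes.
    link-unready : ∀ {σ} → (∀ {s} → s ∈ₗ σ → s ∈ₗ V₀) → all (e x) σ ∧ all (e y) σ ≡ false →
      ∀ s → clᵖ e' (lk e' σ (v ∷ x ∷ y ∷ V₀)) s ≡ clᵖ e (lk e σ (x ∷ y ∷ V₀)) s
    link-unready {σ} σ⊆ unready s =
      trans (cong (cl e' s) (filterᵇ-reject (λ c → all (e' c) σ) v (x ∷ y ∷ V₀)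
           (trans (trans (all-cong σ (λ p → new (σ⊆ p))) (all-∧ (e x) (e y) σ)) unready)))
        (trans (cong (cl e' s) lk'≡lk) (cl-cong s (lk e σ (x ∷ y ∷ V₀)) same))
      where
      W : List A
      W = lk e σ (x ∷ y ∷ V₀)
      lk'≡lk : lk e' σ (x ∷ y ∷ V₀) ≡ W
      lk'≡lk = filterᵇ-cong {λ c → all (e' c) σ} {λ c → all (e c) σ} (x ∷ y ∷ V₀) λ
        { (here refl) → all-cong σ (λ p → oldx (σ⊆ p))
        ; (there (here refl)) → all-cong σ (λ p → oldy (σ⊆ p))
        ; (there (there p)) → all-cong σ (λ q → old p (σ⊆ q)) }
      both : x ∈ₗ W → y ∈ₗ W → ∀ {B : Set} → B
      both p q with trans (sym unready) (cong₂ _∧_ (proj₂ (∈-filterᵇ⁻ {f = λ c → all (e c) σ} (x ∷ y ∷ V₀) p)) (proj₂ (∈-filterᵇ⁻ {f = λ c → all (e c) σ} (x ∷ y ∷ V₀) q)))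
      ... | ()
      same : ∀ {c d} → c ∈ₗ W → d ∈ₗ W → e' c d ≡ e c d
      same {c} {d} p q with proj₁ (∈-filterᵇ⁻ {f = λ c → all (e c) σ} (x ∷ y ∷ V₀) p) | proj₁ (∈-filterᵇ⁻ {f = λ c → all (e c) σ} (x ∷ y ∷ V₀) q)
      ... | here refl | here refl = trans (irrefl' x) (sym (irrefl x))
      ... | here refl | there (here refl) = both p q
      ... | here refl | there (there d∈) = oldx d∈
      ... | there (here refl) | here refl = both q p
      ... | there (here refl) | there (here refl) = trans (irrefl' y) (sym (irrefl y))
      ... | there (here refl) | there (there d∈) = oldy d∈
      ... | there (there c∈) | here refl = x-old c∈
      ... | there (there c∈) | there (here refl) = y-old c∈
      ... | there (there c∈) | there (there d∈) = old c∈ d∈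

-- Counting cliques

module _ {A : Set} where

  Unique-∷⁻ : ∀ {x : A} {xs} → Unique (x ∷ xs) → x ∉ₗ xs × Unique xs
  Unique-∷⁻ u@(_ ∷ us) = Uniqueₚ.Unique[x∷xs]⇒x∉xs u , us

  Unique-∷⁺ : ∀ {x : A} {xs} → x ∉ₗ xs → Unique xs → Unique (x ∷ xs)
  Unique-∷⁺ {x} {xs} x∉ us = All.tabulate (λ {y} y∈ x≡y → x∉ (subst (_∈ₗ xs) (sym x≡y) y∈)) ∷ us

  Unique-↭ : ∀ {xs ys : List A} → xs ↭ ys → Unique xs → Unique ys
  Unique-↭ p = PermSₚ.Unique-resp-↭ (setoid A) (Perm.↭⇒↭ₛ p)

  ∈⇒↭∷ : ∀ {x : A} {xs} → x ∈ₗ xs → Σ[ ys ∈ List A ] xs ↭ x ∷ ys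
  ∈⇒↭∷ {x} p with ∈ₚ.∈-∃++ p
  ... | as , bs , refl = as ++ bs , Permₚ.shift x as bs

  Unique-⊆⊇⇒↭ : ∀ {xs ys : List A} → Unique xs → Unique ys →
    (∀ {x} → x ∈ₗ xs → x ∈ₗ ys) → (∀ {x} → x ∈ₗ ys → x ∈ₗ xs) → xs ↭ ys
  Unique-⊆⊇⇒↭ {[]} {[]} us vs f g = Perm.refl
  Unique-⊆⊇⇒↭ {[]} {y ∷ ys} us vs f g with g (here refl)
  ... | ()
  Unique-⊆⊇⇒↭ {x ∷ xs} {ys} us vs f g with ∈⇒↭∷ (f (here refl))
  ... | zs , ys↭ = ↭-trans (prep x (Unique-⊆⊇⇒↭ (proj₂ (Unique-∷⁻ us)) (proj₂ (Unique-∷⁻ vs')) f' g')) (↭-sym ys↭)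
    where
    vs' = Unique-↭ ys↭ vs
    f' : ∀ {z} → z ∈ₗ xs → z ∈ₗ zs
    f' z∈ with Permₚ.∈-resp-↭ ys↭ (f (there z∈))
    ... | here refl = ⊥-elim (proj₁ (Unique-∷⁻ us) z∈)
    ... | there q = q
    g' : ∀ {z} → z ∈ₗ zs → z ∈ₗ xs
    g' z∈ with g (Permₚ.∈-resp-↭ (↭-sym ys↭) (there z∈))
    ... | here refl = ⊥-elim (proj₁ (Unique-∷⁻ vs') z∈)
    ... | there q = q

Unique-map : ∀ {A B : Set} {f : A → B} {xs : List A} → (∀ {x y} → x ∈ₗ xs → y ∈ₗ xs → f x ≡ f y → x ≡ y) →
             Unique xs → Unique (map f xs)
Unique-map {xs = []} inj [] = []
Unique-map {f = f} {xs = x ∷ xs} inj u = Unique-∷⁺ fx∉ (Unique-map (λ p q → inj (there p) (there q)) (proj₂ (Unique-∷⁻ u)))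
  where
  fx∉ : f x ∉ₗ map f xs
  fx∉ p = let y , y∈ , eq = ∈ₚ.∈-map⁻ f p in
    proj₁ (Unique-∷⁻ u) (subst (_∈ₗ xs) (sym (inj (here refl) (there y∈) eq)) y∈)

HasCount-length : ∀ {m} {P : Subset m → Set} {c} {L : List (Subset m)} → HasCount P c → Unique L →
  (∀ {S} → S ∈ₗ L → P S) → (∀ {S} → P S → S ∈ₗ L) → c ≡ length L
HasCount-length {L = L} (L' , u' , sound' , complete' , refl) u sound complete =
  Permₚ.↭-length (Unique-⊆⊇⇒↭ u' u (λ p → complete (All.lookup sound' p)) (λ p → complete' _ (sound p)))

Disjoint : ∀ {n} → Subset n → Subset n → Set
Disjoint p q = ∀ {i} → i ∈ₛ p → i ∉ₛ q

∣∪∣-disjoint : ∀ {n} (p q : Subset n) → Disjoint p q → ∣ p ∪ q ∣ ≡ ∣ p ∣ + ∣ q ∣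
∣∪∣-disjoint [] [] d = refl
∣∪∣-disjoint (inside ∷ p) (inside ∷ q) d = ⊥-elim (d here here)
∣∪∣-disjoint (inside ∷ p) (outside ∷ q) d = cong suc (∣∪∣-disjoint p q (λ i j → d (there i) (there j)))
∣∪∣-disjoint (outside ∷ p) (inside ∷ q) d =
  trans (cong suc (∣∪∣-disjoint p q (λ i j → d (there i) (there j)))) (sym (ℕₚ.+-suc ∣ p ∣ ∣ q ∣))
∣∪∣-disjoint (outside ∷ p) (outside ∷ q) d = ∣∪∣-disjoint p q (λ i j → d (there i) (there j))

x∈p─q⇒x∉q : ∀ {n} (p q : Subset n) {x} → x ∈ₛ p ─ q → x ∉ₛ q
x∈p─q⇒x∉q (_ ∷ p) (outside ∷ q) {Fin.zero} _ ()
x∈p─q⇒x∉q (_ ∷ p) (inside ∷ q) {Fin.zero} () _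
x∈p─q⇒x∉q (_ ∷ p) (_ ∷ q) {Fin.suc x} (there r) (there s) = x∈p─q⇒x∉q p q r s

insert : ∀ {n} → Fin n → Subset n → Subset n
insert v S = S ∪ ⁅ v ⁆

∈-insert⁻ : ∀ {n} {v} (S : Subset n) {p} → p ∈ₛ insert v S → p ∈ₛ S ⊎ p ≡ v
∈-insert⁻ {v = v} S p∈ with Sₚ.x∈p∪q⁻ S ⁅ v ⁆ p∈
... | inj₁ q = inj₁ q
... | inj₂ q = inj₂ (Sₚ.x∈⁅y⁆⇒x≡y v q)

insert-remove : ∀ {n} {v} (S : Subset n) → v ∈ₛ S → insert v (S - v) ≡ S
insert-remove {v = v} S v∈ = Sₚ.⊆-antisym
  (λ p → [ Sₚ.p─q⊆p S ⁅ v ⁆ , (λ { refl → v∈ }) ]′ (∈-insert⁻ (S - v) p))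
  λ {x} p → Sₚ.x∈p∪q⁺ (aux x p)
  where
  aux : ∀ x → x ∈ₛ S → x ∈ₛ S - v ⊎ x ∈ₛ ⁅ v ⁆
  aux x p with x Finₚ.≟ v
  ... | yes refl = inj₂ (Sₚ.x∈⁅x⁆ v)
  ... | no ne = inj₁ (Sₚ.x∈p∧x≢y⇒x∈p-y p ne)

∣insert∣ : ∀ {n} {v} (S : Subset n) → v ∉ₛ S → ∣ insert v S ∣ ≡ suc ∣ S ∣
∣insert∣ {v = v} S v∉ = trans (∣∪∣-disjoint S ⁅ v ⁆ (λ p q → v∉ (subst (_∈ₛ S) (Sₚ.x∈⁅y⁆⇒x≡y v q) p)))
  (trans (cong (∣ S ∣ +_) (Sₚ.∣⁅x⁆∣≡1 v)) (ℕₚ.+-comm ∣ S ∣ 1))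

insert-injective : ∀ {n} {v} {S S' : Subset n} → v ∉ₛ S → v ∉ₛ S' → insert v S ≡ insert v S' → S ≡ S'
insert-injective {v = v} {S} {S'} v∉ v∉' eq = Sₚ.⊆-antisym (half S S' v∉ eq) (half S' S v∉' (sym eq))
  where
  half : ∀ R R' → v ∉ₛ R → insert v R ≡ insert v R' → R ⊆ₛ R'
  half R R' n e {x} p with ∈-insert⁻ R' (subst (x ∈ₛ_) e (Sₚ.x∈p∪q⁺ (inj₁ p)))
  ... | inj₁ q = q
  ... | inj₂ refl = ⊥-elim (n p)

∣S∣≡0⇒S≡∅ : ∀ {n} (S : Subset n) → ∣ S ∣ ≡ 0 → S ≡ ∅
∣S∣≡0⇒S≡∅ [] eq = refl
∣S∣≡0⇒S≡∅ (inside ∷ S) ()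
∣S∣≡0⇒S≡∅ (outside ∷ S) eq = cong (outside ∷_) (∣S∣≡0⇒S≡∅ S eq)

module CliqueCount {m : ℕ} (a : Fin m → Fin m → Bool) (a-sym : ∀ p q → a p q ≡ a q p) where

  -- Follows the recursion of `cl` clause by clause, so that its length is the clique count.
  cliques : ℕ → List (Fin m) → List (Subset m)
  cliques zero    W       = ∅ ∷ []
  cliques (suc s) []      = []
  cliques (suc s) (v ∷ W) = cliques (suc s) W ++ map (insert v) (cliques s (filterᵇ (a v) W))

  length-cliques : ∀ s W → length (cliques s W) ≡ cl a s W
  length-cliques zero W = refl
  length-cliques (suc s) [] = refl
  length-cliques (suc s) (v ∷ W) = trans (Listₚ.length-++ (cliques (suc s) W))
    (cong₂ _+_ (length-cliques (suc s) W)
      (trans (Listₚ.length-map (insert v) (cliques s (filterᵇ (a v) W))) (length-cliques s (filterᵇ (a v) W))))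

  IsCliqueIn : ℕ → List (Fin m) → Subset m → Set
  IsCliqueIn s W S = ∣ S ∣ ≡ s × (∀ {p} → p ∈ₛ S → p ∈ₗ W) × (∀ {p q} → p ∈ₛ S → q ∈ₛ S → p ≢ q → a p q ≡ true)

  cliques-sound : ∀ s W → Unique W → ∀ {S} → S ∈ₗ cliques s W → IsCliqueIn s W S
  cliques-sound zero W u (here refl) = Sₚ.∣⊥∣≡0 m , (λ p → ⊥-elim (Sₚ.∉⊥ p)) , (λ p → ⊥-elim (Sₚ.∉⊥ p))
  cliques-sound (suc s) (v ∷ W) u {S} S∈ =
    step (cliques-sound (suc s) W (proj₂ (Unique-∷⁻ u))) (cliques-sound s (filterᵇ (a v) W) (Uniqueₚ.filter⁺ _ (proj₂ (Unique-∷⁻ u))))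
    where
    step : (∀ {S} → S ∈ₗ cliques (suc s) W → IsCliqueIn (suc s) W S) →
           (∀ {S} → S ∈ₗ cliques s (filterᵇ (a v) W) → IsCliqueIn s (filterᵇ (a v) W) S) → IsCliqueIn (suc s) (v ∷ W) S
    step ih₁ ih₂ with ∈ₚ.∈-++⁻ (cliques (suc s) W) S∈
    ... | inj₁ q = let c , w , e = ih₁ q in c , there ∘ w , e
    ... | inj₂ q with ∈ₚ.∈-map⁻ (insert v) q
    ...   | R , R∈ , refl with ih₂ R∈
    ...     | c , w , e = trans (∣insert∣ R v∉R) (cong suc c) , inW , clique
      where
      v∉R : v ∉ₛ R
      v∉R p = proj₁ (Unique-∷⁻ u) (proj₁ (∈-filterᵇ⁻ W (w p)))
      inW : ∀ {p} → p ∈ₛ insert v R → p ∈ₗ v ∷ W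
      inW p∈ with ∈-insert⁻ R p∈
      ... | inj₁ p∈R = there (proj₁ (∈-filterᵇ⁻ W (w p∈R)))
      ... | inj₂ refl = here refl
      clique : ∀ {p q} → p ∈ₛ insert v R → q ∈ₛ insert v R → p ≢ q → a p q ≡ true
      clique {p} {q} p∈ q∈ ne with ∈-insert⁻ R p∈ | ∈-insert⁻ R q∈
      ... | inj₁ x | inj₁ y = e x y ne
      ... | inj₁ x | inj₂ refl = trans (a-sym p v) (proj₂ (∈-filterᵇ⁻ W (w x)))
      ... | inj₂ refl | inj₁ y = proj₂ (∈-filterᵇ⁻ W (w y))
      ... | inj₂ refl | inj₂ refl = ⊥-elim (ne refl)

  cliques-complete : ∀ s W {S} → IsCliqueIn s W S → S ∈ₗ cliques s W
  cliques-complete zero W {S} (c , _ , _) = here (∣S∣≡0⇒S≡∅ S c)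
  cliques-complete (suc s) [] {S} (c , w , _) with Sₚ.nonempty? S
  ... | yes (p , p∈) with w p∈
  ...   | ()
  cliques-complete (suc s) [] {S} (c , w , _) | no e with trans (sym c) (trans (cong ∣_∣ (Sₚ.Empty-unique e)) (Sₚ.∣⊥∣≡0 m))
  ... | ()
  cliques-complete (suc s) (v ∷ W) {S} (c , w , e) = step (cliques-complete (suc s) W) (cliques-complete s (filterᵇ (a v) W))
    where
    step : (∀ {S} → IsCliqueIn (suc s) W S → S ∈ₗ cliques (suc s) W) →
           (∀ {S} → IsCliqueIn s (filterᵇ (a v) W) S → S ∈ₗ cliques s (filterᵇ (a v) W)) → S ∈ₗ cliques (suc s) (v ∷ W)
    step ih₁ ih₂ with v Sₚ.∈? S
    ... | no v∉ = ∈ₚ.∈-++⁺ˡ (ih₁ (c , w' , e))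
      where
      w' : ∀ {p} → p ∈ₛ S → p ∈ₗ W
      w' p∈ with w p∈
      ... | here refl = ⊥-elim (v∉ p∈)
      ... | there q = q
    ... | yes v∈ = ∈ₚ.∈-++⁺ʳ (cliques (suc s) W) (subst (_∈ₗ map (insert v) (cliques s (filterᵇ (a v) W))) (insert-remove S v∈)
        (∈ₚ.∈-map⁺ (insert v) (ih₂ (c' , w' , λ p q → e (old p) (old q)))))
      where
      old : ∀ {p} → p ∈ₛ S - v → p ∈ₛ S
      old = Sₚ.p─q⊆p S ⁅ v ⁆
      v∉ : v ∉ₛ S - v
      v∉ p = x∈p─q⇒x∉q S ⁅ v ⁆ p (Sₚ.x∈⁅x⁆ v)
      c' : ∣ S - v ∣ ≡ s
      c' = ℕₚ.suc-injective (trans (sym (∣insert∣ (S - v) v∉)) (trans (cong ∣_∣ (insert-remove S v∈)) c))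
      w' : ∀ {p} → p ∈ₛ S - v → p ∈ₗ filterᵇ (a v) W
      w' {p} p∈ with w (old p∈)
      ... | here refl = ⊥-elim (v∉ p∈)
      ... | there q = ∈-filterᵇ⁺ q (e v∈ (old p∈) (λ { refl → v∉ p∈ }))

  cliques-unique : ∀ s W → Unique W → Unique (cliques s W)
  cliques-unique zero W u = [] ∷ []
  cliques-unique (suc s) [] u = []
  cliques-unique (suc s) (v ∷ W) u = Uniqueₚ.++⁺ (cliques-unique (suc s) W uW)
      (Unique-map (λ p q → insert-injective (v∉ p) (v∉ q)) (cliques-unique s (filterᵇ (a v) W) uF)) disj
    where
    uW = proj₂ (Unique-∷⁻ u)
    uF = Uniqueₚ.filter⁺ _ uW
    v∉ : ∀ {R} → R ∈ₗ cliques s (filterᵇ (a v) W) → v ∉ₛ R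
    v∉ R∈ p = proj₁ (Unique-∷⁻ u) (proj₁ (∈-filterᵇ⁻ W (proj₁ (proj₂ (cliques-sound s _ uF R∈)) p)))
    disj : ∀ {R} → ¬ (R ∈ₗ cliques (suc s) W × R ∈ₗ map (insert v) (cliques s (filterᵇ (a v) W)))
    disj (p , q) with ∈ₚ.∈-map⁻ (insert v) q
    ... | R' , _ , refl = proj₁ (Unique-∷⁻ u) (proj₁ (proj₂ (cliques-sound (suc s) W uW p)) (Sₚ.q⊆p∪q R' ⁅ v ⁆ (Sₚ.x∈⁅x⁆ v)))

  count≡cl : ∀ {s c W} {P : Subset m → Set} → Unique W → (∀ p → p ∈ₗ W) → HasCount P c →
    (∀ {S} → P S → ∣ S ∣ ≡ s × (∀ {p q} → p ∈ₛ S → q ∈ₛ S → p ≢ q → a p q ≡ true)) →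
    (∀ {S} → ∣ S ∣ ≡ s → (∀ {p q} → p ∈ₛ S → q ∈ₛ S → p ≢ q → a p q ≡ true) → P S) → c ≡ cl a s W
  count≡cl {s} {W = W} u full hc to from = trans
    (HasCount-length hc (cliques-unique s W u)
      (λ S∈ → let c , _ , e = cliques-sound s W u S∈ in from c e)
      (λ P → let c , e = to P in cliques-complete s W (c , (λ {p} _ → full p) , e)))
    (length-cliques s W)

-- Building sets

_≟ₛ_ : ∀ {n} (p q : Subset n) → Dec (p ≡ q)
_≟ₛ_ = Vecₚ.≡-dec 𝔹ₚ._≟_

_∈?ₗ_ : ∀ {n} (c : Subset n) (B : List (Subset n)) → Dec (c ∈ₗ B)
_∈?ₗ_ = DecMembership._∈?_ _≟ₛ_

does⁻ : ∀ {P : Set} (P? : Dec P) → does P? ≡ true → P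
does⁻ (yes p) _ = p
does⁻ (no _) ()

module _ {n : ℕ} where

  ∪-least : ∀ {p q u : Subset n} → p ⊆ₛ u → q ⊆ₛ u → p ∪ q ⊆ₛ u
  ∪-least {p} {q} f g i∈ = [ f , g ]′ (Sₚ.x∈p∪q⁻ p q i∈)

  ∪ˡ : ∀ {p q : Subset n} → p ⊆ₛ p ∪ q
  ∪ˡ {p} {q} = Sₚ.p⊆p∪q q

  ∪ʳ : ∀ {p q : Subset n} → q ⊆ₛ p ∪ q
  ∪ʳ {p} {q} = Sₚ.q⊆p∪q p q

  meet : ∀ {p q : Subset n} {i} → i ∈ₛ p → i ∈ₛ q → Nonempty (p ∩ q)
  meet i∈p i∈q = _ , Sₚ.x∈p∩q⁺ (i∈p , i∈q)

  0<∣∣ : ∀ {p : Subset n} → Nonempty p → 0 < ∣ p ∣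
  0<∣∣ {p} (i , i∈) = subst (_≤ ∣ p ∣) (Sₚ.∣⁅x⁆∣≡1 i)
    (Sₚ.p⊆q⇒∣p∣≤∣q∣ (λ j∈ → subst (_∈ₛ p) (sym (Sₚ.x∈⁅y⁆⇒x≡y i j∈)) i∈))

  disjoint-∣∣<ˡ : ∀ {x y u : Subset n} → Disjoint x y → x ∪ y ≡ u → Nonempty y → ∣ x ∣ < ∣ u ∣
  disjoint-∣∣<ˡ {x} {y} disj refl ne = subst (∣ x ∣ <_) (sym (∣∪∣-disjoint x y disj))
    (subst (_< ∣ x ∣ + ∣ y ∣) (ℕₚ.+-identityʳ ∣ x ∣) (ℕₚ.+-monoʳ-< ∣ x ∣ (0<∣∣ ne)))

  disjoint-∣∣<ʳ : ∀ {x y u : Subset n} → Disjoint x y → x ∪ y ≡ u → Nonempty x → ∣ y ∣ < ∣ u ∣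
  disjoint-∣∣<ʳ {x} {y} disj eq = disjoint-∣∣<ˡ (λ p q → disj q p) (trans (Sₚ.∪-comm y x) eq)

  -- Reflexive, unlike `Edge`: in `cover` the sets found for the two halves may coincide.
  Adj : List (Subset n) → Subset n → Subset n → Set
  Adj B c d = c ⊆ₛ d ⊎ d ⊆ₛ c ⊎ c ∪ d ∉ₗ B

  -- Two distinct members of B are joined by an edge when they are compatible in
  -- the nested set complex: overlapping members always have their union in B.
  Edge : List (Subset n) → Subset n → Subset n → Set
  Edge B c d = c ≢ d × Adj B c d

  Edge? : ∀ B c d → Dec (Edge B c d)
  Edge? B c d = ¬? (c ≟ₛ d) ×-dec (c Sₚ.⊆? d ⊎-dec (d Sₚ.⊆? c ⊎-dec ¬? ((c ∪ d) ∈?ₗ B)))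

  edge : List (Subset n) → Subset n → Subset n → Bool
  edge B c d = does (Edge? B c d)

  edge⁺ : ∀ {B c d} → Edge B c d → edge B c d ≡ true
  edge⁺ {B} {c} {d} = dec-true (Edge? B c d)

  edge⁻ : ∀ {B c d} → edge B c d ≡ true → Edge B c d
  edge⁻ {B} {c} {d} = does⁻ (Edge? B c d)

  Adj-sym : ∀ {B c d} → Adj B c d → Adj B d c
  Adj-sym (inj₁ p) = inj₂ (inj₁ p)
  Adj-sym (inj₂ (inj₁ p)) = inj₁ p
  Adj-sym {B} {c} {d} (inj₂ (inj₂ p)) = inj₂ (inj₂ (λ q → p (subst (_∈ₗ B) (Sₚ.∪-comm d c) q)))

  Edge-sym : ∀ {B c d} → Edge B c d → Edge B d c
  Edge-sym (ne , a) = ne ∘ sym , Adj-sym a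

  edge-sym : ∀ B c d → edge B c d ≡ edge B d c
  edge-sym B c d = does-⇔ (mk⇔ Edge-sym Edge-sym) (Edge? B c d) (Edge? B d c)

  edge-irrefl : ∀ B c → edge B c c ≡ false
  edge-irrefl B c = dec-false (Edge? B c c) (λ p → proj₁ p refl)

  -- Flagness in combinatorial form; `flag⇒splits` and `splits⇒flag` give the equivalence for
  -- connected building sets.
  Splits : List (Subset n) → Set
  Splits B = ∀ {u} → u ∈ₗ B → (∃ λ i → u ≡ ⁅ i ⁆) ⊎
    (Σ[ x ∈ Subset n ] Σ[ y ∈ Subset n ] (x ∈ₗ B × y ∈ₗ B × Disjoint x y × x ∪ y ≡ u))

  record SplitBS (B : List (Subset n)) : Set where
    field
      isBS   : IsBuildingSet B
      full   : IsConnected B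
      splits : Splits B
    open IsBuildingSet isBS public

    nonempty-∈ : ∀ {c} → c ∈ₗ B → Nonempty c
    nonempty-∈ c∈ = All.lookup nonempty c∈

    union-⊇ : ∀ {c d u} → c ∈ₗ B → d ∈ₗ B → Nonempty (c ∩ d) → c ∪ d ≡ u → u ∈ₗ B
    union-⊇ c∈ d∈ ne refl = union _ _ c∈ d∈ ne

    -- A union of pairwise compatible members never contains a member that is
    -- not inside one of them; this is where flagness of the complex comes from.
    cover : ∀ (N : Subset n → Set) → (∀ {c} → N c → c ∈ₗ B) → (∀ {c d} → N c → N d → Adj B c d) →
      ∀ {u} → u ∈ₗ B → (∀ {i} → i ∈ₛ u → Σ[ c ∈ Subset n ] (N c × i ∈ₛ c)) → Σ[ c ∈ Subset n ] (N c × u ⊆ₛ c)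
    cover N N⊆B adj {u} u∈ cov = go u (<-wellFounded ∣ u ∣) u∈ cov
      where
      go : ∀ u → Acc _<_ ∣ u ∣ → u ∈ₗ B → (∀ {i} → i ∈ₛ u → Σ[ c ∈ Subset n ] (N c × i ∈ₛ c)) → Σ[ c ∈ Subset n ] (N c × u ⊆ₛ c)
      go u (acc rec) u∈ cov with splits u∈
      ... | inj₁ (i , refl) with cov (Sₚ.x∈⁅x⁆ i)
      ...   | c , Nc , i∈c = c , Nc , λ j∈ → subst (_∈ₛ c) (sym (Sₚ.x∈⁅y⁆⇒x≡y i j∈)) i∈c
      go u (acc rec) u∈ cov | inj₂ (x , y , x∈ , y∈ , disj , refl)
        with go x (rec (disjoint-∣∣<ˡ disj refl (nonempty-∈ y∈))) x∈ (cov ∘ ∪ˡ)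
           | go y (rec (disjoint-∣∣<ʳ disj refl (nonempty-∈ x∈))) y∈ (cov ∘ ∪ʳ {p = x})
      ... | c , Nc , x⊆c | d , Nd , y⊆d with adj Nc Nd
      ...   | inj₁ c⊆d = d , Nd , ∪-least (c⊆d ∘ x⊆c) y⊆d
      ...   | inj₂ (inj₁ d⊆c) = c , Nc , ∪-least x⊆c (d⊆c ∘ y⊆d)
      -- `c ∪ u` is a member because `c` meets `u` in `x`, and it meets `d` in `y`; its union with
      -- `d` is just `c ∪ d`.
      ...   | inj₂ (inj₂ c∪d∉) = ⊥-elim (c∪d∉ (union-⊇ {c ∪ (x ∪ y)} {d} c∪u∈ (N⊆B Nd) meets eq))
        where
        i∈y : Nonempty y
        i∈y = nonempty-∈ y∈
        c∪u∈ : c ∪ (x ∪ y) ∈ₗ B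
        c∪u∈ = union _ _ (N⊆B Nc) u∈ (let i , i∈ = nonempty-∈ x∈ in meet (x⊆c i∈) (∪ˡ i∈))
        meets : Nonempty ((c ∪ (x ∪ y)) ∩ d)
        meets = meet (∪ʳ {p = c} (∪ʳ {p = x} (proj₂ i∈y))) (y⊆d (proj₂ i∈y))
        eq : (c ∪ (x ∪ y)) ∪ d ≡ c ∪ d
        eq = Sₚ.⊆-antisym (∪-least (∪-least ∪ˡ (∪-least (∪ˡ ∘ x⊆c) (∪ʳ {p = c} ∘ y⊆d))) (∪ʳ {p = c}))
               (∪-least (∪ˡ ∘ ∪ˡ) (∪ʳ {p = c ∪ (x ∪ y)}))

  -- The components of the restriction of `B` to `X`. For a building set they partition `X`, but the
  -- definition makes sense for any list, which `maximal-part` exploits.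
  Comp : List (Subset n) → Subset n → Subset n → Set
  Comp B X c = c ∈ₗ B × c ⊆ₛ X × (∀ {d} → d ∈ₗ B → d ⊆ₛ X → c ⊆ₛ d → d ⊆ₛ c)

  abstract
    comp-exists : ∀ B {X d : Subset n} → d ∈ₗ B → d ⊆ₛ X → Σ[ c ∈ Subset n ] (Comp B X c × d ⊆ₛ c)
    comp-exists B {X} {d} d∈ d⊆X = go d (<-wellFounded (n ∸ ∣ d ∣)) d∈ d⊆X
      where
      go : ∀ d → Acc _<_ (n ∸ ∣ d ∣) → d ∈ₗ B → d ⊆ₛ X → Σ[ c ∈ Subset n ] (Comp B X c × d ⊆ₛ c)
      go d (acc rec) d∈ d⊆X with Any.any? (λ c → (c Sₚ.⊆? X) ×-dec (d Sₚ.⊂? c)) B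
      ... | no none = d , (d∈ , d⊆X , maximal) , id
        where
        maximal : ∀ {c} → c ∈ₗ B → c ⊆ₛ X → d ⊆ₛ c → c ⊆ₛ d
        maximal {c} c∈ c⊆X d⊆c {i} i∈c with i Sₚ.∈? d
        ... | yes i∈d = i∈d
        ... | no i∉d = ⊥-elim (none (lose {P = λ c → c ⊆ₛ X × d ⊂ₛ c} c∈ ((λ {_} → c⊆X) , (λ {_} → d⊆c) , i , i∈c , i∉d)))
      ... | yes found with find found
      ...   | c , c∈ , c⊆X , d⊂c with go c (rec (ℕₚ.∸-monoʳ-< (Sₚ.p⊂q⇒∣p∣<∣q∣ d⊂c) (Sₚ.∣p∣≤n c))) c∈ c⊆X
      ...     | c' , comp , c⊆c' = c' , comp , c⊆c' ∘ proj₁ d⊂c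

  module _ {B : List (Subset n)} (bs : IsBuildingSet B) where
    open IsBuildingSet bs

    comp-absorb : ∀ {X c d : Subset n} → Comp B X c → d ∈ₗ B → d ⊆ₛ X → Nonempty (c ∩ d) → d ⊆ₛ c
    comp-absorb {c = c} (c∈ , c⊆ , maxi) d∈ d⊆X ne = maxi (union _ _ c∈ d∈ ne) (∪-least c⊆ d⊆X) ∪ˡ ∘ ∪ʳ {p = c}

    comp-cover : ∀ {X : Subset n} {i} → i ∈ₛ X → Σ[ c ∈ Subset n ] (Comp B X c × i ∈ₛ c)
    comp-cover {X} {i} i∈ with comp-exists B {X} {⁅ i ⁆} (singleton i) (λ j∈ → subst (_∈ₛ X) (sym (Sₚ.x∈⁅y⁆⇒x≡y i j∈)) i∈)
    ... | c , comp , sub = c , comp , sub (Sₚ.x∈⁅x⁆ i)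

    comp-adj : ∀ {X c d : Subset n} → Comp B X c → Comp B X d → Adj B c d
    comp-adj {X} {c} {d} C@(c∈ , c⊆ , cmax) D@(d∈ , d⊆ , dmax) with (c ∪ d) ∈?ₗ B
    ... | no c∪d∉ = inj₂ (inj₂ c∪d∉)
    ... | yes c∪d∈ = inj₁ (dmax c∪d∈ (∪-least c⊆ d⊆) (∪ʳ {p = c}) ∘ ∪ˡ)

  -- Adding one set to a flag building set.

  record Extension (B B' : List (Subset n)) (v x y : Subset n) : Set where
    field
      old  : SplitBS B
      new  : SplitBS B'
      v∉B  : v ∉ₗ B
      v∈B' : v ∈ₗ B'
      B⊆B' : ∀ {c} → c ∈ₗ B → c ∈ₗ B'
      B'⊆B : ∀ {c} → c ∈ₗ B' → c ≢ v → c ∈ₗ B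
      x∈B  : x ∈ₗ B
      y∈B  : y ∈ₗ B
      disj : Disjoint x y
      x∪y  : x ∪ y ≡ v

  -- The two parts of `v` in `B'` differ from `v`, since the other part is nonempty, and so lie in
  -- `B`. A singleton `v` would already be in `B`.
  mkExtension : ∀ {B B' v} → SplitBS B → SplitBS B' → v ∉ₗ B → v ∈ₗ B' → (∀ {c} → c ∈ₗ B → c ∈ₗ B') →
    (∀ {c} → c ∈ₗ B' → c ≢ v → c ∈ₗ B) → Σ[ x ∈ Subset n ] Σ[ y ∈ Subset n ] Extension B B' v x y
  mkExtension {B} {B'} {v} S S' v∉B v∈B' up down with SplitBS.splits S' v∈B'
  ... | inj₁ (i , refl) = ⊥-elim (v∉B (SplitBS.singleton S i))
  ... | inj₂ (x , y , x∈ , y∈ , disj , refl) = x , y , record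
    { old = S ; new = S' ; v∉B = v∉B ; v∈B' = v∈B' ; B⊆B' = up ; B'⊆B = down
    ; x∈B = down x∈ x≢ ; y∈B = down y∈ y≢ ; disj = disj ; x∪y = refl }
    where
    x≢ : x ≢ x ∪ y
    x≢ eq = let i , i∈ = SplitBS.nonempty-∈ S' y∈ in disj (subst (i ∈ₛ_) (sym eq) (∪ʳ {p = x} i∈)) i∈
    y≢ : y ≢ x ∪ y
    y≢ eq = let i , i∈ = SplitBS.nonempty-∈ S' x∈ in disj i∈ (subst (i ∈ₛ_) (sym eq) (∪ˡ i∈))

  Extension-swap : ∀ {B B' v x y} → Extension B B' v x y → Extension B B' v y x
  Extension-swap {x = x} {y} E = record
    { old = old ; new = new ; v∉B = v∉B ; v∈B' = v∈B' ; B⊆B' = B⊆B' ; B'⊆B = B'⊆B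
    ; x∈B = y∈B ; y∈B = x∈B ; disj = λ p q → disj q p ; x∪y = trans (Sₚ.∪-comm y x) x∪y }
    where open Extension E

  module ExtensionProps {B B' : List (Subset n)} {v x y : Subset n} (E : Extension B B' v x y) where
    open Extension E
    open SplitBS old using (union; union-⊇; nonempty-∈; cover)

    x⊆v : x ⊆ₛ v
    x⊆v i∈ = subst (_ ∈ₛ_) x∪y (∪ˡ i∈)

    y⊆v : y ⊆ₛ v
    y⊆v i∈ = subst (_ ∈ₛ_) x∪y (∪ʳ {p = x} i∈)

    v⊆ : ∀ {i} → i ∈ₛ v → i ∈ₛ x ⊎ i ∈ₛ y
    v⊆ i∈ = Sₚ.x∈p∪q⁻ x y (subst (_ ∈ₛ_) (sym x∪y) i∈)

    ix : Nonempty x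
    ix = nonempty-∈ x∈B

    iy : Nonempty y
    iy = nonempty-∈ y∈B

    x⊈y : x ⊈ₛ y
    x⊈y s = disj (proj₂ ix) (s (proj₂ ix))

    y⊈x : y ⊈ₛ x
    y⊈x s = disj (s (proj₂ iy)) (proj₂ iy)

    v⊈x : v ⊈ₛ x
    v⊈x s = y⊈x (s ∘ y⊆v)

    v⊈y : v ⊈ₛ y
    v⊈y s = x⊈y (s ∘ x⊆v)

    -- A member crossing from `x` to `y` inside `v` would glue them: `c ∪ x ∪ y` is `v`, which is
    -- not in `B`. Hence `x` and `y` are the components of `v` in `B`.
    no-crossing : ∀ {c} → c ∈ₗ B → c ⊆ₛ v → Nonempty (c ∩ x) → ¬ Nonempty (c ∩ y)
    no-crossing {c} c∈ c⊆v cx (i , i∈) = v∉B (union-⊇ {c ∪ x} {y} (union _ _ c∈ x∈B cx) y∈B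
      (let p , q = Sₚ.x∈p∩q⁻ c y i∈ in meet (∪ˡ p) q)
      (trans (Sₚ.∪-assoc c x y) (trans (cong (c ∪_) x∪y) (Sₚ.⊆-antisym (∪-least c⊆v id) (∪ʳ {p = c})))))

    inside-part : ∀ {c} → c ∈ₗ B → c ⊆ₛ v → c ⊆ₛ x ⊎ c ⊆ₛ y
    inside-part {c} c∈ c⊆v with Sₚ.nonempty? (c ∩ x)
    ... | yes cx = inj₁ λ i∈ → [ id , (λ i∈y → ⊥-elim (no-crossing c∈ c⊆v cx (meet i∈ i∈y))) ]′ (v⊆ (c⊆v i∈))
    ... | no ¬cx = inj₂ λ i∈ → [ (λ i∈x → ⊥-elim (¬cx (meet i∈ i∈x))) , id ]′ (v⊆ (c⊆v i∈))

    Adj-down : ∀ {c d} → Adj B' c d → Adj B c d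
    Adj-down (inj₁ p) = inj₁ p
    Adj-down (inj₂ (inj₁ p)) = inj₂ (inj₁ p)
    Adj-down (inj₂ (inj₂ p)) = inj₂ (inj₂ (p ∘ B⊆B'))

    -- Compatibility can be lost only through a union equal to `v`. By `inside-part` each set then
    -- lies in one half, and covering `v` forces the two sets to be `x` and `y`.
    Adj-up : ∀ {c d} → c ∈ₗ B → d ∈ₗ B → ¬ (c ≡ x × d ≡ y) → ¬ (c ≡ y × d ≡ x) → Adj B c d → Adj B' c d
    Adj-up c∈ d∈ n₁ n₂ (inj₁ p) = inj₁ p
    Adj-up c∈ d∈ n₁ n₂ (inj₂ (inj₁ p)) = inj₂ (inj₁ p)
    Adj-up {c} {d} c∈ d∈ n₁ n₂ (inj₂ (inj₂ p)) = inj₂ (inj₂ λ q → p (B'⊆B q not-v))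
      where
      both : ∀ {a b p q} → a ∪ b ≡ v → Disjoint p q → p ⊆ₛ v → a ⊆ₛ p → b ⊆ₛ q → a ≡ p
      both {a} {b} eq pq p⊆v a⊆p b⊆q = Sₚ.⊆-antisym a⊆p λ i∈p →
        [ id , (λ i∈b → ⊥-elim (pq i∈p (b⊆q i∈b))) ]′ (Sₚ.x∈p∪q⁻ a b (subst (_ ∈ₛ_) (sym eq) (p⊆v i∈p)))
      not-v : c ∪ d ≢ v
      not-v eq with inside-part c∈ (λ i∈ → subst (_ ∈ₛ_) eq (∪ˡ i∈)) | inside-part d∈ (λ i∈ → subst (_ ∈ₛ_) eq (∪ʳ {p = c} i∈))
      ... | inj₁ c⊆x | inj₁ d⊆x = v⊈x (λ i∈ → ∪-least c⊆x d⊆x (subst (_ ∈ₛ_) (sym eq) i∈))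
      ... | inj₂ c⊆y | inj₂ d⊆y = v⊈y (λ i∈ → ∪-least c⊆y d⊆y (subst (_ ∈ₛ_) (sym eq) i∈))
      ... | inj₁ c⊆x | inj₂ d⊆y = n₁ (both eq disj x⊆v c⊆x d⊆y , both (trans (Sₚ.∪-comm d c) eq) (λ p q → disj q p) y⊆v d⊆y c⊆x)
      ... | inj₂ c⊆y | inj₁ d⊆x = n₂ (both eq (λ p q → disj q p) y⊆v c⊆y d⊆x , both (trans (Sₚ.∪-comm d c) eq) disj x⊆v d⊆x c⊆y)

    Adj-xy : Adj B x y
    Adj-xy = inj₂ (inj₂ (subst (_∉ₗ B) (sym x∪y) v∉B))

    x≢y : x ≢ y
    x≢y refl = x⊈y id

    Edge-xy : Edge B x y
    Edge-xy = x≢y , Adj-xy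

    ¬Edge'-xy : ¬ Edge B' x y
    ¬Edge'-xy (_ , inj₁ p) = x⊈y p
    ¬Edge'-xy (_ , inj₂ (inj₁ p)) = y⊈x p
    ¬Edge'-xy (_ , inj₂ (inj₂ p)) = p (subst (_∈ₗ B') (sym x∪y) v∈B')

    -- A union `x ∪ c` in `B` would put `v ∪ c` into `B'`; for `c` inside `y` it would cross from
    -- `x` to `y`, against `no-crossing`.
    Adj-v⇒x : ∀ {c} → c ∈ₗ B → c ≢ y → Adj B' v c → Adj B x c
    Adj-v⇒x c∈ c≢y (inj₁ v⊆c) = inj₁ (v⊆c ∘ x⊆v)
    Adj-v⇒x {c} c∈ c≢y (inj₂ (inj₁ c⊆v)) with inside-part c∈ c⊆v
    ... | inj₁ c⊆x = inj₂ (inj₁ c⊆x)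
    ... | inj₂ c⊆y = inj₂ (inj₂ λ x∪c∈ → no-crossing x∪c∈ (∪-least x⊆v c⊆v) (meet (∪ˡ (proj₂ ix)) (proj₂ ix))
        (let i , i∈ = nonempty-∈ c∈ in meet (∪ʳ {p = x} i∈) (c⊆y i∈)))
    Adj-v⇒x {c} c∈ c≢y (inj₂ (inj₂ v∪c∉)) = inj₂ (inj₂ λ x∪c∈ → v∪c∉
      (SplitBS.union-⊇ new {v} {x ∪ c} v∈B' (B⊆B' x∪c∈) (meet (x⊆v (proj₂ ix)) (∪ˡ (proj₂ ix)))
        (trans (sym (Sₚ.∪-assoc v x c)) (cong (_∪ c) (Sₚ.⊆-antisym (∪-least id x⊆v) ∪ˡ)))))

    -- For `c` not inside `v`, a member `v ∪ c` would already be in `B` and would be covered by the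
    -- pairwise compatible sets `x`, `y` and `c`; `cover` would put it inside one of them.
    Adj-xy⇒v : ∀ {c} → c ∈ₗ B → Adj B x c → Adj B y c → Adj B' v c
    Adj-xy⇒v {c} c∈ ax ay with v Sₚ.⊆? c
    ... | yes v⊆c = inj₁ v⊆c
    ... | no v⊈c with c Sₚ.⊆? v
    ...   | yes c⊆v = inj₂ (inj₁ c⊆v)
    ...   | no c⊈v = inj₂ (inj₂ contra)
      where
      N : Subset n → Set
      N d = d ≡ x ⊎ d ≡ y ⊎ d ≡ c
      N⊆B : ∀ {d} → N d → d ∈ₗ B
      N⊆B (inj₁ refl) = x∈B
      N⊆B (inj₂ (inj₁ refl)) = y∈B
      N⊆B (inj₂ (inj₂ refl)) = c∈
      N-adj : ∀ {d e} → N d → N e → Adj B d e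
      N-adj (inj₁ refl) (inj₁ refl) = inj₁ id
      N-adj (inj₁ refl) (inj₂ (inj₁ refl)) = Adj-xy
      N-adj (inj₁ refl) (inj₂ (inj₂ refl)) = ax
      N-adj (inj₂ (inj₁ refl)) (inj₁ refl) = Adj-sym Adj-xy
      N-adj (inj₂ (inj₁ refl)) (inj₂ (inj₁ refl)) = inj₁ id
      N-adj (inj₂ (inj₁ refl)) (inj₂ (inj₂ refl)) = ay
      N-adj (inj₂ (inj₂ refl)) (inj₁ refl) = Adj-sym ax
      N-adj (inj₂ (inj₂ refl)) (inj₂ (inj₁ refl)) = Adj-sym ay
      N-adj (inj₂ (inj₂ refl)) (inj₂ (inj₂ refl)) = inj₁ id
      contra : v ∪ c ∉ₗ B'
      contra v∪c∈ with cover N N⊆B N-adj (B'⊆B v∪c∈ (λ eq → c⊈v (λ i∈ → subst (_ ∈ₛ_) eq (∪ʳ {p = v} i∈))))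
           (λ i∈ → [ (λ i∈v → [ (λ p → x , inj₁ refl , p) , (λ p → y , inj₂ (inj₁ refl) , p) ]′ (v⊆ i∈v))
                   , (λ p → c , inj₂ (inj₂ refl) , p) ]′ (Sₚ.x∈p∪q⁻ v c i∈))
      ... | d , inj₁ refl , sub = v⊈x (sub ∘ ∪ˡ)
      ... | d , inj₂ (inj₁ refl) , sub = v⊈y (sub ∘ ∪ˡ)
      ... | d , inj₂ (inj₂ refl) , sub = v⊈c (sub ∘ ∪ˡ)

    comp-down : ∀ {X c} → Comp B' X c → c ≢ v → Comp B X c
    comp-down (c∈ , c⊆ , maxi) ne = B'⊆B c∈ ne , c⊆ , maxi ∘ B⊆B'

    -- A larger member inside `X` is absorbed by the component `v` and so lies in one half.
    comp-v⇒x : ∀ {X} → Comp B' X v → Comp B X x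
    comp-v⇒x C@(_ , v⊆X , _) = x∈B , v⊆X ∘ x⊆v , maxi
      where
      maxi : ∀ {d} → d ∈ₗ B → d ⊆ₛ _ → x ⊆ₛ d → d ⊆ₛ x
      maxi d∈ d⊆X x⊆d with inside-part d∈ (comp-absorb (SplitBS.isBS new) C (B⊆B' d∈) d⊆X (meet (x⊆v (proj₂ ix)) (x⊆d (proj₂ ix))))
      ... | inj₁ d⊆x = d⊆x
      ... | inj₂ d⊆y = ⊥-elim (x⊈y (d⊆y ∘ x⊆d))

  module _ {B B' : List (Subset n)} {v x y : Subset n} (E : Extension B B' v x y) where
    open Extension E
    open ExtensionProps E
    open SplitBS old using (union; union-⊇; nonempty-∈; cover)
    private module Eʸ = ExtensionProps (Extension-swap E)

    comp-v⇒y : ∀ {X} → Comp B' X v → Comp B X y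
    comp-v⇒y = Eʸ.comp-v⇒x

    -- A component of `X` in `B` stops being maximal only by lying inside the new set `v`;
    -- `inside-part` and its own maximality then leave only the halves.
    comp-up : ∀ {X c} → Comp B X c → (Comp B' X c × c ≢ v) ⊎ (Comp B' X v × (c ≡ x ⊎ c ≡ y))
    comp-up {X} {c} (c∈ , c⊆X , maxi) with comp-exists B' {X} {c} (B⊆B' c∈) c⊆X
    ... | c' , C' , c⊆c' with c' ≟ₛ v
    ...   | no ne rewrite Sₚ.⊆-antisym c⊆c' (maxi (B'⊆B (proj₁ C') ne) (proj₁ (proj₂ C')) c⊆c') = inj₁ (C' , ne)
    ...   | yes refl with inside-part c∈ c⊆c'
    ...     | inj₁ c⊆x = inj₂ (C' , inj₁ (Sₚ.⊆-antisym c⊆x (maxi x∈B (proj₁ (proj₂ C') ∘ x⊆v) c⊆x)))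
    ...     | inj₂ c⊆y = inj₂ (C' , inj₂ (Sₚ.⊆-antisym c⊆y (maxi y∈B (proj₁ (proj₂ C') ∘ y⊆v) c⊆y)))

    -- For `v = b O p`, `X = b O q` and `B` the prefix before `p`, this unfolds to
    -- `InU O p q ⊎ InV O p q`, so adjacency in Γ(O) can be used as it is.
    Compatible : Subset n → Set
    Compatible X = (v ⊈ₛ X × ¬ (Σ[ c ∈ Subset n ] (c ∈ₗ B × c ─ X ≡ v ─ X)))
                 ⊎ (v ⊆ₛ X × Σ[ c ∈ Subset n ] (c ∈ₗ B × v ⊂ₛ c × c ⊂ₛ X))

    -- The face formed by the components of `X` avoids `v`, `x` and `y`, and extends by `x` and `y`
    -- in the old complex. `Edge` in place of `Adj` is what excludes `x` and `y` themselves.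
    Ready : Subset n → Set
    Ready X = ∀ {s} → Comp B' X s → s ≢ v × Edge B x s × Edge B y s

    -- Under V, a component meeting `v` absorbs the intermediate set and so properly contains `v`;
    -- one that misses `v` cannot merge with a half, by maximality in `X`. Under U, an obstruction
    -- yields a member agreeing with `v` off `X`: the other half if a component is `x` or `y`, and
    -- `v ∪ s` if a half merges with a component `s` not inside `v`.
    compatible⇒ready : ∀ {X} → Compatible X → Ready X
    compatible⇒ready {X} (inj₂ (v⊆X , c , c∈ , v⊂c , c⊂X)) {s} C@(s∈' , s⊆X , maxi) with Sₚ.nonempty? (s ∩ v)
    ... | yes (i , i∈) = ≢v , ((λ eq → v⊈x (subst (v ⊆ₛ_) (sym eq) v⊆s)) , inj₁ (v⊆s ∘ x⊆v))
                            , ((λ eq → v⊈y (subst (v ⊆ₛ_) (sym eq) v⊆s)) , inj₁ (v⊆s ∘ y⊆v))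
      where
      c⊆s : c ⊆ₛ s
      c⊆s = comp-absorb (SplitBS.isBS new) C (B⊆B' c∈) (proj₁ c⊂X) (let p , q = Sₚ.x∈p∩q⁻ s v i∈ in meet p (proj₁ v⊂c q))
      v⊆s : v ⊆ₛ s
      v⊆s = c⊆s ∘ proj₁ v⊂c
      ≢v : s ≢ v
      ≢v refl = let j , j∈c , j∉v = proj₂ v⊂c in j∉v (c⊆s j∈c)
    ... | no ¬meet = (λ { refl → ¬meet (meet (x⊆v (proj₂ ix)) (x⊆v (proj₂ ix))) }) , part x⊆v ix , part y⊆v iy
      where
      part : ∀ {z} → z ⊆ₛ v → Nonempty z → Edge B z s
      part {z} z⊆v (i , i∈) = (λ { refl → ¬meet (meet i∈ (z⊆v i∈)) }) , inj₂ (inj₂ λ z∪s∈ →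
        ¬meet (meet (maxi (B⊆B' z∪s∈) (∪-least (v⊆X ∘ z⊆v) s⊆X) (∪ʳ {p = z}) (∪ˡ i∈)) (z⊆v i∈)))
    compatible⇒ready {X} (inj₁ (v⊈X , unseen)) {s} C@(s∈' , s⊆X , maxi) =
        s≢v , (x≢s , adj-part E s≢x s≢y) , (y≢s , adj-part (Extension-swap E) s≢y s≢x)
      where
      restrict : ∀ {c d : Subset n} → (∀ {i} → i ∈ₛ c → i ∉ₛ X → i ∈ₛ d) → (∀ {i} → i ∈ₛ d → i ∉ₛ X → i ∈ₛ c) → c ─ X ≡ d ─ X
      restrict {c} {d} f g = Sₚ.⊆-antisym
        (λ i∈ → Sₚ.x∈p∧x∉q⇒x∈p─q (f (Sₚ.p─q⊆p c X i∈) (x∈p─q⇒x∉q c X i∈)) (x∈p─q⇒x∉q c X i∈))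
        (λ i∈ → Sₚ.x∈p∧x∉q⇒x∈p─q (g (Sₚ.p─q⊆p d X i∈) (x∈p─q⇒x∉q d X i∈)) (x∈p─q⇒x∉q d X i∈))
      s≢v : s ≢ v
      s≢v refl = v⊈X s⊆X
      s≢x : s ≢ x
      s≢x refl = unseen (y , y∈B , restrict (λ p _ → y⊆v p) (λ p i∉X → [ (λ i∈x → ⊥-elim (i∉X (s⊆X i∈x))) , id ]′ (v⊆ p)))
      s≢y : s ≢ y
      s≢y refl = unseen (x , x∈B , restrict (λ p _ → x⊆v p) (λ p i∉X → [ id , (λ i∈y → ⊥-elim (i∉X (s⊆X i∈y))) ]′ (v⊆ p)))
      x≢s : x ≢ s
      x≢s = s≢x ∘ sym
      y≢s : y ≢ s
      y≢s = s≢y ∘ sym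
      s∈ : s ∈ₗ B
      s∈ = B'⊆B s∈' s≢v
      adj-part : ∀ {z w} → Extension B B' v z w → s ≢ z → s ≢ w → Adj B z s
      adj-part {z} {w} E' s≢z s≢w with (z ∪ s) ∈?ₗ B
      ... | no z∪s∉ = inj₂ (inj₂ z∪s∉)
      ... | yes z∪s∈ with (v ∪ s) ≟ₛ v
      ...   | no ne = ⊥-elim (unseen (v ∪ s , B'⊆B v∪s∈ ne , restrict (λ p i∉X → [ id , (λ q → ⊥-elim (i∉X (s⊆X q))) ]′ (Sₚ.x∈p∪q⁻ v s p)) (λ p _ → ∪ˡ p)))
        where
        module Eᶻ = ExtensionProps E'
        v∪s∈ : v ∪ s ∈ₗ B'
        v∪s∈ = SplitBS.union-⊇ new {v} {z ∪ s} v∈B' (B⊆B' z∪s∈) (meet (Eᶻ.x⊆v (proj₂ Eᶻ.ix)) (∪ˡ (proj₂ Eᶻ.ix)))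
          (trans (sym (Sₚ.∪-assoc v z s)) (cong (_∪ s) (Sₚ.⊆-antisym (∪-least id Eᶻ.x⊆v) ∪ˡ)))
      ...   | yes eq with ExtensionProps.inside-part E' s∈ (λ i∈ → subst (_ ∈ₛ_) eq (∪ʳ {p = v} i∈))
      ...     | inj₁ s⊆z = inj₂ (inj₁ s⊆z)
      ...     | inj₂ s⊆w = ⊥-elim (Eᶻ.no-crossing z∪s∈ (∪-least Eᶻ.x⊆v (Eᶻ.y⊆v ∘ s⊆w)) (meet (∪ˡ (proj₂ Eᶻ.ix)) (proj₂ Eᶻ.ix))
                  (let i , i∈ = nonempty-∈ s∈ in meet (∪ʳ {p = z} i∈) (s⊆w i∈)))
        where module Eᶻ = ExtensionProps E'

    -- If `v ⊆ X`, the component around `v` is the intermediate set; it differs from `X` because `X`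
    -- is not a member yet. Otherwise suppose that `c` agrees with `v` off `X`. If `c ⊆ v`, then `c`
    -- lies in one half, and the other half lies in a component of `X` that is incompatible with the
    -- first. If not, `c ∪ v` is covered by `x`, `y` and the components of `X`, and `cover` puts it
    -- inside one of them, although none contains `v`.
    ready⇒compatible : ∀ {X} → X ∉ₗ B' → Ready X → Compatible X
    ready⇒compatible {X} X∉ ready with v Sₚ.⊆? X
    ... | yes v⊆X with comp-exists B' {X} {v} v∈B' v⊆X
    ...   | s , C@(s∈' , s⊆X , _) , v⊆s = inj₂ (v⊆X , s , B'⊆B s∈' s≢v , proper v⊆s (s≢v ∘ sym) , proper s⊆X (λ { refl → X∉ s∈' }))
      where
      s≢v : s ≢ v
      s≢v = proj₁ (ready C)
      proper : ∀ {p q : Subset n} → p ⊆ₛ q → p ≢ q → p ⊂ₛ q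
      proper {p} {q} p⊆q p≢q with q Sₚ.⊆? p
      ... | yes q⊆p = ⊥-elim (p≢q (Sₚ.⊆-antisym p⊆q q⊆p))
      ... | no q⊈p with Finₚ.any? (λ i → (i Sₚ.∈? q) ×-dec ¬? (i Sₚ.∈? p))
      ...   | yes w = p⊆q , w
      ...   | no none = ⊥-elim (q⊈p λ {i} i∈q → decide i i∈q)
        where
        decide : ∀ i → i ∈ₛ q → i ∈ₛ p
        decide i i∈q with i Sₚ.∈? p
        ... | yes i∈p = i∈p
        ... | no i∉p = ⊥-elim (none (i , i∈q , i∉p))
    ready⇒compatible {X} X∉ ready | no v⊈X = inj₁ (v⊈X , λ { (c , c∈ , eq) → contra c c∈ eq })
      where
      N : Subset n → Set
      N d = d ≡ x ⊎ d ≡ y ⊎ Comp B' X d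
      N⊆B : ∀ {d} → N d → d ∈ₗ B
      N⊆B (inj₁ refl) = x∈B
      N⊆B (inj₂ (inj₁ refl)) = y∈B
      N⊆B (inj₂ (inj₂ C)) = B'⊆B (proj₁ C) (proj₁ (ready C))
      N-adj : ∀ {d e} → N d → N e → Adj B d e
      N-adj (inj₁ refl) (inj₁ refl) = inj₁ id
      N-adj (inj₁ refl) (inj₂ (inj₁ refl)) = Adj-xy
      N-adj (inj₁ refl) (inj₂ (inj₂ C)) = proj₂ (proj₁ (proj₂ (ready C)))
      N-adj (inj₂ (inj₁ refl)) (inj₁ refl) = Adj-sym Adj-xy
      N-adj (inj₂ (inj₁ refl)) (inj₂ (inj₁ refl)) = inj₁ id
      N-adj (inj₂ (inj₁ refl)) (inj₂ (inj₂ C)) = proj₂ (proj₂ (proj₂ (ready C)))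
      N-adj (inj₂ (inj₂ C)) (inj₁ refl) = Adj-sym (proj₂ (proj₁ (proj₂ (ready C))))
      N-adj (inj₂ (inj₂ C)) (inj₂ (inj₁ refl)) = Adj-sym (proj₂ (proj₂ (proj₂ (ready C))))
      N-adj (inj₂ (inj₂ C)) (inj₂ (inj₂ C')) = Adj-down (comp-adj (SplitBS.isBS new) C C')

      outside-v : Nonempty (v ─ X)
      outside-v with Sₚ.nonempty? (v ─ X)
      ... | yes w = w
      ... | no none = ⊥-elim (v⊈X λ {i} i∈ → decide i i∈)
        where
        decide : ∀ i → i ∈ₛ v → i ∈ₛ X
        decide i i∈v with i Sₚ.∈? X
        ... | yes i∈X = i∈X
        ... | no i∉X = ⊥-elim (none (i , Sₚ.x∈p∧x∉q⇒x∈p─q i∈v i∉X))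

      -- c lies in the part z of v and agrees with v off X, so the other part w
      -- is inside X, and the component of X around w is incompatible with z.
      part : ∀ {z w} → Extension B B' v z w → (∀ {s} → Comp B' X s → Edge B z s × Edge B w s) →
             ∀ {c} → c ─ X ≡ v ─ X → c ⊆ₛ z → ∀ {P : Set} → P
      part {z} {w} E' rd {c} eq c⊆z with comp-exists B' {X} {w} (B⊆B' (Extension.y∈B E')) w⊆X
        where
        w⊆X : w ⊆ₛ X
        w⊆X {i} i∈w with i Sₚ.∈? X
        ... | yes i∈X = i∈X
        ... | no i∉X = ⊥-elim (Extension.disj E' (c⊆z (Sₚ.p─q⊆p c X (subst (i ∈ₛ_) (sym eq)
              (Sₚ.x∈p∧x∉q⇒x∈p─q (ExtensionProps.y⊆v E' i∈w) i∉X)))) i∈w)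
      ... | s , C , w⊆s with rd C
      ...   | (_ , inj₁ z⊆s) , _ = ⊥-elim (v⊈X (λ i∈ → proj₁ (proj₂ C) ([ z⊆s , w⊆s ]′ (ExtensionProps.v⊆ E' i∈))))
      ...   | (_ , inj₂ (inj₁ s⊆z)) , _ = ⊥-elim (ExtensionProps.y⊈x E' (s⊆z ∘ w⊆s))
      ...   | (_ , inj₂ (inj₂ z∪s∉)) , (w≢s , _) with (z ∪ s) ≟ₛ v
      ...     | no ne = ⊥-elim (z∪s∉ (B'⊆B (SplitBS.union-⊇ new {v} {s} v∈B' (proj₁ C)
                 (let i , i∈ = ExtensionProps.iy E' in meet (ExtensionProps.y⊆v E' i∈) (w⊆s i∈))
                 (Sₚ.⊆-antisym (∪-least (λ i∈ → [ ∪ˡ , ∪ʳ {p = z} ∘ w⊆s ]′ (ExtensionProps.v⊆ E' i∈)) (∪ʳ {p = z}))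
                    (∪-least (∪ˡ ∘ ExtensionProps.x⊆v E') (∪ʳ {p = v})))) ne))
      ...     | yes eq' with ExtensionProps.inside-part E' (N⊆B (inj₂ (inj₂ C))) (λ i∈ → subst (_ ∈ₛ_) eq' (∪ʳ {p = z} i∈))
      ...       | inj₁ s⊆z = ⊥-elim (ExtensionProps.y⊈x E' (s⊆z ∘ w⊆s))
      ...       | inj₂ s⊆w = ⊥-elim (w≢s (Sₚ.⊆-antisym w⊆s s⊆w))

      contra : ∀ c → c ∈ₗ B → c ─ X ≡ v ─ X → ∀ {P : Set} → P
      contra c c∈ eq with (c ∪ v) ≟ₛ v
      ... | yes c∪v≡v with inside-part c∈ (λ i∈ → subst (_ ∈ₛ_) c∪v≡v (∪ˡ i∈))
      ...   | inj₁ c⊆x = part E (λ C → proj₂ (ready C)) eq c⊆x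
      ...   | inj₂ c⊆y = part (Extension-swap E) (λ C → let p , q = proj₂ (ready C) in q , p) eq c⊆y
      contra c c∈ eq | no ne with cover N N⊆B N-adj (B'⊆B c∪v∈ ne) covered
        where
        i = proj₁ outside-v
        c∪v∈ : c ∪ v ∈ₗ B'
        c∪v∈ = SplitBS.union new _ _ (B⊆B' c∈) v∈B' (meet (Sₚ.p─q⊆p c X (subst (i ∈ₛ_) (sym eq) (proj₂ outside-v))) (Sₚ.p─q⊆p v X (proj₂ outside-v)))
        in-v : ∀ {i} → i ∈ₛ v → Σ[ d ∈ Subset n ] (N d × i ∈ₛ d)
        in-v i∈ = [ (λ p → x , inj₁ refl , p) , (λ p → y , inj₂ (inj₁ refl) , p) ]′ (v⊆ i∈)
        covered : ∀ {i} → i ∈ₛ c ∪ v → Σ[ d ∈ Subset n ] (N d × i ∈ₛ d)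
        covered {i} i∈ with Sₚ.x∈p∪q⁻ c v i∈
        ... | inj₂ i∈v = in-v i∈v
        ... | inj₁ i∈c with i Sₚ.∈? X
        ...   | yes i∈X = let d , C , p = comp-cover (SplitBS.isBS new) i∈X in d , inj₂ (inj₂ C) , p
        ...   | no i∉X = in-v (Sₚ.p─q⊆p v X (subst (i ∈ₛ_) eq (Sₚ.x∈p∧x∉q⇒x∈p─q i∈c i∉X)))
      ... | d , inj₁ refl , sub = ⊥-elim (v⊈x (sub ∘ ∪ʳ {p = c}))
      ... | d , inj₂ (inj₁ refl) , sub = ⊥-elim (v⊈y (sub ∘ ∪ʳ {p = c}))
      ... | d , inj₂ (inj₂ C) , sub = ⊥-elim (v⊈X (proj₁ (proj₂ C) ∘ sub ∘ ∪ʳ {p = c}))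

-- Faces of Minkowski sums of simplices

sumℚ-cong : ∀ {n} {f g : Fin n → ℚ} → (∀ i → f i ≡ g i) → sumℚ f ≡ sumℚ g
sumℚ-cong {zero} h = refl
sumℚ-cong {suc n} h = cong₂ ℚ._+_ (h Fin.zero) (sumℚ-cong (h ∘ Fin.suc))

+-interchange : ∀ a b c d → (a ℚ.+ b) ℚ.+ (c ℚ.+ d) ≡ (a ℚ.+ c) ℚ.+ (b ℚ.+ d)
+-interchange a b c d = trans (ℚₚ.+-assoc a b (c ℚ.+ d)) (trans (cong (a ℚ.+_)
  (trans (sym (ℚₚ.+-assoc b c d)) (trans (cong (ℚ._+ d) (ℚₚ.+-comm b c)) (ℚₚ.+-assoc c b d)))) (sym (ℚₚ.+-assoc a c (b ℚ.+ d))))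

sumℚ-+ : ∀ {n} (f g : Fin n → ℚ) → sumℚ (λ i → f i ℚ.+ g i) ≡ sumℚ f ℚ.+ sumℚ g
sumℚ-+ {zero} f g = refl
sumℚ-+ {suc n} f g = trans (cong ((f Fin.zero ℚ.+ g Fin.zero) ℚ.+_) (sumℚ-+ (f ∘ Fin.suc) (g ∘ Fin.suc))) (+-interchange (f Fin.zero) (g Fin.zero) _ _)

sumℚ-* : ∀ {n} c (f : Fin n → ℚ) → sumℚ (λ i → c ℚ.* f i) ≡ c ℚ.* sumℚ f
sumℚ-* {zero} c f = sym (ℚₚ.*-zeroʳ c)
sumℚ-* {suc n} c f = trans (cong (c ℚ.* f Fin.zero ℚ.+_) (sumℚ-* c (f ∘ Fin.suc))) (sym (ℚₚ.*-distribˡ-+ c (f Fin.zero) (sumℚ (f ∘ Fin.suc))))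

sumℚ-zero : ∀ {n} {f : Fin n → ℚ} → (∀ i → f i ≡ 0ℚ) → sumℚ f ≡ 0ℚ
sumℚ-zero {zero} h = refl
sumℚ-zero {suc n} h = trans (cong₂ ℚ._+_ (h Fin.zero) (sumℚ-zero (h ∘ Fin.suc))) (ℚₚ.+-identityˡ 0ℚ)

sumℚ-mono : ∀ {n} {f g : Fin n → ℚ} → (∀ i → f i ℚ.≤ g i) → sumℚ f ℚ.≤ sumℚ g
sumℚ-mono {zero} h = ℚₚ.≤-refl
sumℚ-mono {suc n} h = ℚₚ.+-mono-≤ (h Fin.zero) (sumℚ-mono (h ∘ Fin.suc))

sumℚ-≡⇒≥ : ∀ {n} {f g : Fin n → ℚ} → (∀ i → f i ℚ.≤ g i) → sumℚ f ≡ sumℚ g → ∀ i → g i ℚ.≤ f i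
sumℚ-≡⇒≥ {suc n} {f} {g} h eq i with g i ℚₚ.≤? f i
... | yes le = le
... | no nle = ⊥-elim (ℚₚ.<⇒≢ (strict i (ℚₚ.≰⇒> nle) h) eq)
  where
  strict : ∀ {n} {f g : Fin n → ℚ} i → f i ℚ.< g i → (∀ i → f i ℚ.≤ g i) → sumℚ f ℚ.< sumℚ g
  strict Fin.zero lt h = ℚₚ.+-mono-<-≤ lt (sumℚ-mono (h ∘ Fin.suc))
  strict (Fin.suc i) lt h = ℚₚ.+-mono-≤-< (h Fin.zero) (strict i lt (h ∘ Fin.suc))

+-cancelʳ-≤ : ∀ {p q} r → p ℚ.+ r ℚ.≤ q ℚ.+ r → p ℚ.≤ q
+-cancelʳ-≤ {p} {q} r le with p ℚₚ.≤? q
... | yes p≤q = p≤q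
... | no p≰q = ⊥-elim (ℚₚ.<-irrefl refl (ℚₚ.<-≤-trans (ℚₚ.+-monoˡ-< r (ℚₚ.≰⇒> p≰q)) le))

+-cancelˡ-≤ : ∀ {p q} r → r ℚ.+ p ℚ.≤ r ℚ.+ q → p ℚ.≤ q
+-cancelˡ-≤ {p} {q} r le = +-cancelʳ-≤ r (subst₂ ℚ._≤_ (ℚₚ.+-comm r p) (ℚₚ.+-comm r q) le)

*-monoʳ : ∀ {r p q} → 0ℚ ℚ.≤ r → p ℚ.≤ q → p ℚ.* r ℚ.≤ q ℚ.* r
*-monoʳ {r} 0≤r = ℚₚ.*-monoʳ-≤-nonNeg r {{ℚ.nonNegative 0≤r}}

≢0⇒0< : ∀ {p} → 0ℚ ℚ.≤ p → p ≢ 0ℚ → 0ℚ ℚ.< p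
≢0⇒0< {p} 0≤p p≢0 = ℚₚ.≰⇒> (λ p≤0 → p≢0 (ℚₚ.≤-antisym p≤0 0≤p))

-- Mx w J i: i is an element of J maximising w, i.e. e_i is a vertex of the face
-- of Δ_J in direction w.
Mx : ∀ {n} → Point n → Subset n → Fin n → Set
Mx w J i = i ∈ₛ J × (∀ {j} → j ∈ₛ J → w j ℚ.≤ w i)

argmax : ∀ {n} (w : Point n) (J : Subset n) → Nonempty J → Σ[ i ∈ Fin n ] Mx w J i
argmax {suc n} w (s ∷ J) ne with Sₚ.nonempty? J
argmax {suc n} w (outside ∷ J) (Fin.suc i , there i∈) | no e = ⊥-elim (e (i , i∈))
argmax {suc n} w (inside ∷ J) ne | no e = Fin.zero , here , λ { {Fin.zero} _ → ℚₚ.≤-refl ; {Fin.suc j} (there j∈) → ⊥-elim (e (j , j∈)) }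
... | yes ne' with argmax (w ∘ Fin.suc) J ne'
argmax {suc n} w (outside ∷ J) ne | yes ne' | i , i∈ , hi = Fin.suc i , there i∈ , λ { {Fin.suc j} (there j∈) → hi j∈ }
argmax {suc n} w (inside ∷ J) ne | yes ne' | i , i∈ , hi with ℚₚ.≤-total (w Fin.zero) (w (Fin.suc i))
... | inj₁ le = Fin.suc i , there i∈ , λ { {Fin.zero} _ → le ; {Fin.suc j} (there j∈) → hi j∈ }
... | inj₂ ge = Fin.zero , here , λ { {Fin.zero} _ → ℚₚ.≤-refl ; {Fin.suc j} (there j∈) → ℚₚ.≤-trans (hi j∈) ge }

module _ {n : ℕ} where

  dot-cong : ∀ (w x y : Point n) → (∀ i → x i ≡ y i) → dot w x ≡ dot w y
  dot-cong w x y h = sumℚ-cong (λ i → cong (w i ℚ.*_) (h i))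

  dot-+ : ∀ (w x y z : Point n) → (∀ i → x i ≡ y i ℚ.+ z i) → dot w x ≡ dot w y ℚ.+ dot w z
  dot-+ w x y z h = trans (sumℚ-cong (λ i → trans (cong (w i ℚ.*_) (h i)) (ℚₚ.*-distribˡ-+ (w i) (y i) (z i)))) (sumℚ-+ (λ i → w i ℚ.* y i) (λ i → w i ℚ.* z i))

  dot-const : ∀ {J : Subset n} {w x : Point n} M → InSimplex J x → (∀ i → x i ≢ 0ℚ → w i ≡ M) → dot w x ≡ M
  dot-const {J} {w} {x} M (_ , _ , sum1) h = trans (sumℚ-cong term) (trans (sumℚ-* M x) (trans (cong (M ℚ.*_) sum1) (ℚₚ.*-identityʳ M)))
    where
    term : ∀ i → w i ℚ.* x i ≡ M ℚ.* x i
    term i with x i ℚₚ.≟ 0ℚ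
    ... | yes eq = trans (cong (w i ℚ.*_) eq) (trans (ℚₚ.*-zeroʳ (w i)) (sym (trans (cong (M ℚ.*_) eq) (ℚₚ.*-zeroʳ M))))
    ... | no ne = cong (ℚ._* x i) (h i ne)

  simplex-term-≤ : ∀ {J : Subset n} {w x : Point n} {M} → InSimplex J x → (∀ {j} → j ∈ₛ J → w j ℚ.≤ M) → ∀ i → w i ℚ.* x i ℚ.≤ M ℚ.* x i
  simplex-term-≤ {J} {w} {x} {M} (nonneg , off , _) h i with i Sₚ.∈? J
  ... | yes i∈ = *-monoʳ (nonneg i) (h i∈)
  ... | no i∉ = ℚₚ.≤-reflexive (trans (cong (w i ℚ.*_) (off i i∉)) (trans (ℚₚ.*-zeroʳ (w i)) (sym (trans (cong (M ℚ.*_) (off i i∉)) (ℚₚ.*-zeroʳ M)))))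

  M*sum : ∀ {J : Subset n} {x : Point n} M → InSimplex J x → sumℚ (λ i → M ℚ.* x i) ≡ M
  M*sum {x = x} M (_ , _ , sum1) = trans (sumℚ-* M x) (trans (cong (M ℚ.*_) sum1) (ℚₚ.*-identityʳ M))

  dot-≤ : ∀ {J : Subset n} {w x : Point n} {M} → InSimplex J x → (∀ {j} → j ∈ₛ J → w j ℚ.≤ M) → dot w x ℚ.≤ M
  dot-≤ {w = w} {x} {M = M} sx h = subst (dot w x ℚ.≤_) (M*sum M sx) (sumℚ-mono (simplex-term-≤ {w = w} sx h))

  support-∈ : ∀ {J : Subset n} {x : Point n} {i} → InSimplex J x → x i ≢ 0ℚ → i ∈ₛ J
  support-∈ {J} {i = i} (_ , off , _) ne with i Sₚ.∈? J
  ... | yes i∈ = i∈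
  ... | no i∉ = ⊥-elim (ne (off i i∉))

  support-exists : ∀ {J : Subset n} {x : Point n} → InSimplex J x → Σ[ i ∈ Fin n ] x i ≢ 0ℚ
  support-exists {J} {x} (_ , _ , sum1) with Finₚ.any? (λ i → ¬? (x i ℚₚ.≟ 0ℚ))
  ... | yes w = w
  ... | no none = ⊥-elim (ℚₚ.<⇒≢ (ℚₚ.positive⁻¹ 1ℚ)
          (trans (sym (sumℚ-zero (λ i → decidable-stable (x i ℚₚ.≟ 0ℚ) (λ ne → none (i , ne))))) sum1))

  unit : Fin n → Point n
  unit i j = if does (j Finₚ.≟ i) then 1ℚ else 0ℚ

  unit-same : ∀ i → unit i i ≡ 1ℚ
  unit-same i rewrite dec-true (i Finₚ.≟ i) refl = refl

  unit-other : ∀ {i j} → j ≢ i → unit i j ≡ 0ℚ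
  unit-other {i} {j} ne rewrite dec-false (j Finₚ.≟ i) ne = refl

sum-unit : ∀ {n} (i : Fin n) → sumℚ (unit i) ≡ 1ℚ
sum-unit {suc n} Fin.zero = trans (cong (1ℚ ℚ.+_) (sumℚ-zero {n} (λ _ → refl))) (ℚₚ.+-identityʳ 1ℚ)
sum-unit {suc n} (Fin.suc i) = trans (ℚₚ.+-identityˡ _) (trans (sumℚ-cong {n} same) (sum-unit i))
  where
  same : ∀ j → unit (Fin.suc i) (Fin.suc j) ≡ unit i j
  same j with j Finₚ.≟ i
  ... | yes _ = refl
  ... | no _ = refl

module _ {n : ℕ} where

  unit-simplex : ∀ {J : Subset n} {i} → i ∈ₛ J → InSimplex J (unit i)
  unit-simplex {J} {i} i∈ = nonneg , (λ j j∉ → unit-other {i = i} {j} (λ { refl → j∉ i∈ })) , sum-unit i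
    where
    nonneg : ∀ j → 0ℚ ℚ.≤ unit i j
    nonneg j with j Finₚ.≟ i
    ... | yes _ = ℚₚ.nonNegative⁻¹ 1ℚ
    ... | no _ = ℚₚ.≤-refl

  dot-unit : ∀ (w : Point n) i → dot w (unit i) ≡ w i
  dot-unit w i = dot-const {J = Full} {w} (w i) (unit-simplex Sₚ.∈⊤) same
    where
    same : ∀ j → unit i j ≢ 0ℚ → w j ≡ w i
    same j ne with j Finₚ.≟ i
    ... | yes refl = refl
    ... | no _ = ⊥-elim (ne refl)

  InSimplexFace : Subset n → Point n → Point n → Set
  InSimplexFace J w x = InSimplex J x × (∀ y → InSimplex J y → dot w y ℚ.≤ dot w x)

  -- Complementary slackness: with `M` the maximum, the bounds `w i * x i ≤ M * x i` have equal
  -- sums, so each is tight, and a positive `x i` can be cancelled.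
  support-Mx : ∀ {J : Subset n} w x → InSimplexFace J w x → ∀ {i} → x i ≢ 0ℚ → Mx w J i
  support-Mx {J} w x (sx@(nonneg , _ , _) , maxi) {i} ne = support-∈ sx ne , λ j∈ → ℚₚ.≤-trans (top j∈) M≤wi
    where
    M = dot w x
    top : ∀ {j} → j ∈ₛ J → w j ℚ.≤ M
    top {j} j∈ = subst (ℚ._≤ M) (dot-unit w j) (maxi (unit j) (unit-simplex j∈))
    M≤wi : M ℚ.≤ w i
    M≤wi = ℚₚ.*-cancelʳ-≤-pos (x i) {{ℚ.positive (≢0⇒0< (nonneg i) ne)}}
      (sumℚ-≡⇒≥ (simplex-term-≤ {w = w} sx top) (sym (M*sum M sx)) i)

  Mx-support : ∀ {J : Subset n} w x → InSimplex J x → (∀ {i} → x i ≢ 0ℚ → Mx w J i) → InSimplexFace J w x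
  Mx-support {J} w x sx h = sx , λ y sy → subst (dot w y ℚ.≤_) (sym value) (dot-≤ {w = w} sy (proj₂ (h ne)))
    where
    i = proj₁ (support-exists sx)
    ne = proj₂ (support-exists sx)
    value : dot w x ≡ w i
    value = dot-const {w = w} (w i) sx (λ j ne' → ℚₚ.≤-antisym (proj₂ (h ne) (proj₁ (h ne'))) (proj₂ (h ne') (proj₁ (h ne))))

  -- Vary one summand while the other is held fixed. This works for every decomposition of `x`, not
  -- only for a suitable one.
  face-split : ∀ {I L} (w x y z : Point n) → InSimplex I y → InMinkowski L z → (∀ i → x i ≡ y i ℚ.+ z i) →
    InFace (I ∷ L) w x → InSimplexFace I w y × InFace L w z
  face-split w x y z sy mz eq (_ , maxi) =
    (sy , λ y' sy' → +-cancelʳ-≤ (dot w z) (subst₂ ℚ._≤_ (dot-+ w (λ i → y' i ℚ.+ z i) y' z (λ _ → refl)) (dot-+ w x y z eq) (maxi (λ i → y' i ℚ.+ z i) (y' , z , sy' , mz , λ _ → refl)))) ,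
    (mz , λ z' mz' → +-cancelˡ-≤ (dot w y) (subst₂ ℚ._≤_ (dot-+ w (λ i → y i ℚ.+ z' i) y z' (λ _ → refl)) (dot-+ w x y z eq) (maxi (λ i → y i ℚ.+ z' i) (y , z' , sy , mz' , λ _ → refl))))

  face-join : ∀ {I L} (w x y z : Point n) → (∀ i → x i ≡ y i ℚ.+ z i) → InSimplexFace I w y → InFace L w z → InFace (I ∷ L) w x
  face-join w x y z eq (sy , maxy) (mz , maxz) = (y , z , sy , mz , eq) , λ { x' (y' , z' , sy' , mz' , eq') →
    subst₂ ℚ._≤_ (sym (dot-+ w x' y' z' eq')) (sym (dot-+ w x y z eq)) (ℚₚ.+-mono-≤ (maxy y' sy') (maxz z' mz')) }

  face-[] : ∀ (w x : Point n) → InMinkowski [] x → InFace [] w x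
  face-[] w x h = h , λ y h' → ℚₚ.≤-reflexive (dot-cong w y x (λ i → trans (h' i) (sym (h i))))

  -- In a decomposition of `x`, any index in the support of the summand from Δ_J is optimal for all
  -- directions at once. `W` is a predicate so that single directions, pairs and lists are treated
  -- alike.
  common⇒Mx : ∀ (W : Point n → Set) L {x} → InP L x → (∀ {w} → W w → InFace L w x) →
    ∀ {J} → J ∈ₗ L → Σ[ i ∈ Fin n ] (i ∈ₛ J × ∀ {w} → W w → Mx w J i)
  common⇒Mx W (I ∷ L) {x} (y , z , sy , mz , eq) h (here refl) =
    let i , ne = support-exists sy in i , support-∈ sy ne , λ {w} Ww → support-Mx w y (proj₁ (face-split w x y z sy mz eq (h Ww))) ne
  common⇒Mx W (I ∷ L) {x} (y , z , sy , mz , eq) h (there J∈) =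
    common⇒Mx W L mz (λ {w} Ww → proj₂ (face-split w x y z sy mz eq (h Ww))) J∈

  -- The common point is the sum of the vertices e_i chosen in the summands.
  Mx⇒common : ∀ (W : Point n → Set) L → (∀ {J} → J ∈ₗ L → Σ[ i ∈ Fin n ] (i ∈ₛ J × ∀ {w} → W w → Mx w J i)) →
    Σ[ x ∈ Point n ] (InP L x × (∀ {w} → W w → InFace L w x))
  Mx⇒common W [] h = (λ _ → 0ℚ) , (λ _ → refl) , λ {w} _ → face-[] w (λ _ → 0ℚ) (λ _ → refl)
  Mx⇒common W (I ∷ L) h with Mx⇒common W L (h ∘ there) | h (here refl)
  ... | z , mz , hz | i , i∈ , hi = (λ j → unit i j ℚ.+ z j) , (unit i , z , unit-simplex i∈ , mz , λ _ → refl) ,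
    λ {w} Ww → face-join w (λ j → unit i j ℚ.+ z j) (unit i) z (λ _ → refl) (unit-face (hi Ww)) (hz Ww)
    where
    unit-face : ∀ {w} → Mx w I i → InSimplexFace I w (unit i)
    unit-face {w} m = Mx-support w (unit i) (unit-simplex i∈) only
      where
      only : ∀ {j} → unit i j ≢ 0ℚ → Mx w I j
      only {j} ne with j Finₚ.≟ i
      ... | yes refl = m
      ... | no _ = ⊥-elim (ne refl)

  module _ {B : List (Subset n)} (nonempty : ∀ {J} → J ∈ₗ B → Nonempty J) where

    -- The point takes e_i in the summand `J` and a `w`-maximiser in every other one. Any face
    -- containing it can be split along this very decomposition, which makes `i` optimal in `J`;
    -- thus inclusions of faces become statements about `Mx`.
    vertexThrough : ∀ {w : Point n} L → (∀ {J} → J ∈ₗ L → Nonempty J) → ∀ {J i} → J ∈ₗ L → Mx w J i →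
      Σ[ x ∈ Point n ] (InFace L w x × (∀ {v} → InFace L v x → Mx v J i))
    vertexThrough {w} (I ∷ L) ne {i = i} (here refl) m with Mx⇒common (_≡ w) L
         (λ J∈ → let k , mk = argmax w _ (ne (there J∈)) in k , proj₁ mk , λ { refl → mk })
    ... | z , mz , hz = (λ j → unit i j ℚ.+ z j) ,
        face-join w (λ j → unit i j ℚ.+ z j) (unit i) z (λ _ → refl) (Mx-support w (unit i) si only) (hz refl) ,
        λ {v} f → support-Mx v (unit i) (proj₁ (face-split v (λ j → unit i j ℚ.+ z j) (unit i) z si mz (λ _ → refl) f)) one≢0
      where
      si = unit-simplex (proj₁ m)
      one≢0 : unit i i ≢ 0ℚ
      one≢0 eq = ℚₚ.<⇒≢ (ℚₚ.positive⁻¹ 1ℚ) (sym (trans (sym (unit-same i)) eq))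
      only : ∀ {j} → unit i j ≢ 0ℚ → Mx w I j
      only {j} ne with j Finₚ.≟ i
      ... | yes refl = m
      ... | no _ = ⊥-elim (ne refl)
    vertexThrough {w} (I ∷ L) ne (there J∈) m with vertexThrough L (ne ∘ there) J∈ m | argmax w I (ne (here refl))
    ... | z , fz , hz | k , mk = (λ j → unit k j ℚ.+ z j) ,
        face-join w (λ j → unit k j ℚ.+ z j) (unit k) z (λ _ → refl) (Mx-support w (unit k) sk only) fz ,
        λ {v} f → hz (proj₂ (face-split v (λ j → unit k j ℚ.+ z j) (unit k) z sk (proj₁ fz) (λ _ → refl) f))
      where
      sk = unit-simplex (proj₁ mk)
      only : ∀ {j} → unit k j ≢ 0ℚ → Mx w I j
      only {j} ne with j Finₚ.≟ k
      ... | yes refl = mk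
      ... | no _ = ⊥-elim (ne refl)

    FaceSub⇒Mx : ∀ (w v : Point n) → FaceSub B w v → ∀ {J i} → J ∈ₗ B → Mx w J i → Mx v J i
    FaceSub⇒Mx w v sub J∈ m with vertexThrough B nonempty J∈ m
    ... | x , fx , hx = hx (sub x fx)

    face-nonempty : ∀ (w : Point n) → Σ[ x ∈ Point n ] InFace B w x
    face-nonempty w with Mx⇒common (_≡ w) B (λ J∈ → let k , mk = argmax w _ (nonempty J∈) in k , proj₁ mk , λ { refl → mk })
    ... | x , _ , h = x , h refl

  Mx⇒FaceSub : ∀ L (w v : Point n) → (∀ {J i} → J ∈ₗ L → Mx w J i → Mx v J i) → FaceSub L w v
  Mx⇒FaceSub [] w v h x (mx , _) = face-[] v x mx
  Mx⇒FaceSub (I ∷ L) w v h x f@((y , z , sy , mz , eq) , _) with face-split w x y z sy mz eq f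
  ... | fy , fz = face-join v x y z eq (Mx-support v y sy (λ ne → h (here refl) (support-Mx w y fy ne))) (Mx⇒FaceSub L w v (h ∘ there) z fz)

  -- Its face is all of `P_B`, so that `FaceIsP` becomes a case of `FaceSub`.
  zeroDir : Point n
  zeroDir _ = 0ℚ

  Mx-zeroDir : ∀ {J : Subset n} {i} → i ∈ₛ J → Mx zeroDir J i
  Mx-zeroDir i∈ = i∈ , λ _ → ℚₚ.≤-refl

  dot-zeroDir : ∀ (x : Point n) → dot zeroDir x ≡ 0ℚ
  dot-zeroDir x = sumℚ-zero (λ i → ℚₚ.*-zeroˡ (x i))

  FaceIsP⇒FaceSub : ∀ {B} (w : Point n) → FaceIsP B w → FaceSub B zeroDir w
  FaceIsP⇒FaceSub w h x f = h x (proj₁ f)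

  FaceSub⇒FaceIsP : ∀ {B} (w : Point n) → FaceSub B zeroDir w → FaceIsP B w
  FaceSub⇒FaceIsP w sub x px = sub x (px , λ y _ → ℚₚ.≤-reflexive (trans (dot-zeroDir y) (sym (dot-zeroDir x))))

-- Facets and flagness

module _ {n : ℕ} where

  outside-of : ∀ {p q : Subset n} → p ⊈ₛ q → Σ[ i ∈ Fin n ] (i ∈ₛ p × i ∉ₛ q)
  outside-of {p} {q} p⊈q with Finₚ.any? (λ i → (i Sₚ.∈? p) ×-dec ¬? (i Sₚ.∈? q))
  ... | yes w = w
  ... | no none = ⊥-elim (p⊈q (λ {i} i∈p → decidable-stable (i Sₚ.∈? q) (λ i∉q → none (i , i∈p , i∉q))))

  ⊆⊤-≡ : ∀ {c : Subset n} → Full ⊆ₛ c → c ≡ Full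
  ⊆⊤-≡ f = Sₚ.⊆-antisym (λ _ → Sₚ.∈⊤) f

  ∈-─ : ∀ {p q : Subset n} {i} → i ∈ₛ p ─ q → i ∈ₛ p × i ∉ₛ q
  ∈-─ {p} {q} i∈ = Sₚ.p─q⊆p p q i∈ , x∈p─q⇒x∉q p q i∈

  -- The direction −1_c, whose face is the facet {x(c) minimal} of P_B.
  normal : Subset n → Point n
  normal c i = if does (i Sₚ.∈? c) then ℚ.- 1ℚ else 0ℚ

  normal-in : ∀ {c i} → i ∈ₛ c → normal c i ≡ ℚ.- 1ℚ
  normal-in {c} {i} i∈ rewrite dec-true (i Sₚ.∈? c) i∈ = refl

  normal-out : ∀ {c i} → i ∉ₛ c → normal c i ≡ 0ℚ
  normal-out {c} {i} i∉ rewrite dec-false (i Sₚ.∈? c) i∉ = refl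

  -1≤0 : ℚ.- 1ℚ ℚ.≤ 0ℚ
  -1≤0 = ℚₚ.nonPositive⁻¹ (ℚ.- 1ℚ)

  Mx-normal⁻ : ∀ {c J i} → Mx (normal c) J i → i ∈ₛ c → J ⊆ₛ c
  Mx-normal⁻ {c} {J} {i} (_ , maxi) i∈c {j} j∈J = decidable-stable (j Sₚ.∈? c) λ j∉c →
    ℚₚ.<-irrefl refl (ℚₚ.≤-<-trans (subst₂ ℚ._≤_ (normal-out j∉c) (normal-in i∈c) (maxi j∈J)) (ℚₚ.negative⁻¹ (ℚ.- 1ℚ)))

  Mx-normal⁺ : ∀ {c J i} → i ∈ₛ J → (i ∈ₛ c → J ⊆ₛ c) → Mx (normal c) J i
  Mx-normal⁺ {c} {J} {i} i∈J h = i∈J , le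
    where
    le : ∀ {j} → j ∈ₛ J → normal c j ℚ.≤ normal c i
    le {j} j∈J with i Sₚ.∈? c
    ... | yes i∈c = ℚₚ.≤-reflexive (normal-in (h i∈c j∈J))
    ... | no i∉c with j Sₚ.∈? c
    ...   | yes _ = -1≤0
    ...   | no _ = ℚₚ.≤-refl

  ∈-tabulate : ∀ {m} (f : Fin m → Bool) {i} → i ∈ₛ Vec.tabulate f → f i ≡ true
  ∈-tabulate f {i} i∈ = trans (sym (Vecₚ.lookup∘tabulate f i)) (Vecₚ.[]=⇒lookup i∈)

  tabulate-∈ : ∀ {m} (f : Fin m → Bool) {i} → f i ≡ true → i ∈ₛ Vec.tabulate f
  tabulate-∈ f {i} eq = Vecₚ.lookup⇒[]= i (Vec.tabulate f) (trans (Vecₚ.lookup∘tabulate f i) eq)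

  module Facets {B : List (Subset n)} (bs : IsBuildingSet B) (full : IsConnected B) where
    open IsBuildingSet bs

    private
      ne : ∀ {c} → c ∈ₗ B → Nonempty c
      ne c∈ = All.lookup nonempty c∈

    FaceIsP⇒Mx : ∀ w → FaceIsP B w → ∀ {J i} → J ∈ₗ B → i ∈ₛ J → Mx w J i
    FaceIsP⇒Mx w h J∈ i∈ = FaceSub⇒Mx ne zeroDir w (FaceIsP⇒FaceSub w h) J∈ (Mx-zeroDir i∈)

    Mx⇒FaceIsP : ∀ w → (∀ {i j} → w j ℚ.≤ w i) → FaceIsP B w
    Mx⇒FaceIsP w const = FaceSub⇒FaceIsP w (Mx⇒FaceSub B zeroDir w (λ _ m → proj₁ m , λ _ → const))

    normal-proper : ∀ {c} → c ∈ₗ B → c ≢ Full → ¬ FaceIsP B (normal c)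
    normal-proper {c} c∈ c≢ h = let i , i∈ = ne c∈ in
      c≢ (⊆⊤-≡ (Mx-normal⁻ (FaceIsP⇒Mx (normal c) h full (Sₚ.∈⊤ {x = i})) i∈))

    -- If the face of `normal c` lies in that of `v`, testing on `c` makes `v` constant on `c`, and
    -- testing on `Full` makes it constant and maximal off `c`. Only the order of two values
    -- remains: equality gives all of `P_B`, strict inequality the same face.
    normal-facet : ∀ {c} → c ∈ₗ B → c ≢ Full → IsFacet B (normal c)
    normal-facet {c} c∈ c≢ = record { nonemptyF = face-nonempty ne (normal c) ; proper = normal-proper c∈ c≢ ; maximal = maxi }
      where
      i₀ = proj₁ (ne c∈)
      i₀∈ = proj₂ (ne c∈)
      out = outside-of {Full} {c} (c≢ ∘ ⊆⊤-≡)
      j₀ = proj₁ out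
      j₀∉ = proj₂ (proj₂ out)
      maxi : ∀ v → FaceSub B (normal c) v → ¬ (¬ FaceSub B v (normal c) × ¬ FaceIsP B v)
      maxi v sub (n₁ , n₂) = cases (v j₀ ℚₚ.≤? v i₀)
        where
        in-c : ∀ {i j} → i ∈ₛ c → j ∈ₛ c → v j ℚ.≤ v i
        in-c i∈ j∈ = proj₂ (FaceSub⇒Mx ne (normal c) v sub c∈ (Mx-normal⁺ i∈ (λ _ → id))) j∈
        off-c : ∀ {i j} → i ∉ₛ c → v j ℚ.≤ v i
        off-c i∉ = proj₂ (FaceSub⇒Mx ne (normal c) v sub full (Mx-normal⁺ Sₚ.∈⊤ (λ i∈ → ⊥-elim (i∉ i∈)))) Sₚ.∈⊤
        cases : Dec (v j₀ ℚ.≤ v i₀) → ⊥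
        cases (yes le) = n₂ (Mx⇒FaceIsP v const)
          where
          const : ∀ {i j} → v j ℚ.≤ v i
          const {i} {j} with i Sₚ.∈? c
          ... | no i∉ = off-c i∉
          ... | yes i∈ = ℚₚ.≤-trans (off-c j₀∉) (ℚₚ.≤-trans le (in-c i∈ i₀∈))
        cases (no nle) = n₁ (Mx⇒FaceSub B v (normal c) (λ J∈ m → Mx-normal⁺ (proj₁ m) (λ i∈c {j} j∈J →
          decidable-stable (j Sₚ.∈? c) (λ j∉c → nle (ℚₚ.≤-trans (off-c j∉c) (ℚₚ.≤-trans (proj₂ m j∈J) (in-c i₀∈ i∈c)))))))

    normal-injective : ∀ {c d} → c ∈ₗ B → d ∈ₗ B → d ≢ Full → FaceSub B (normal c) (normal d) → c ≡ d
    normal-injective {c} {d} c∈ d∈ d≢ sub = Sₚ.⊆-antisym c⊆d d⊆c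
      where
      d⊆c : d ⊆ₛ c
      d⊆c {i} i∈d = decidable-stable (i Sₚ.∈? c) λ i∉c →
        d≢ (⊆⊤-≡ (Mx-normal⁻ (FaceSub⇒Mx ne (normal c) (normal d) sub full (Mx-normal⁺ Sₚ.∈⊤ (λ i∈c → ⊥-elim (i∉c i∈c)))) i∈d))
      c⊆d : c ⊆ₛ d
      c⊆d = let i , i∈d = ne d∈ in Mx-normal⁻ (FaceSub⇒Mx ne (normal c) (normal d) sub c∈ (Mx-normal⁺ (d⊆c i∈d) (λ _ → id))) i∈d

    -- `IsFacet.maximal` yields only a double negation; it can be removed because the order on ℚ is
    -- decidable.
    FaceSub-stable : ∀ v w → ¬ ¬ FaceSub B v w → FaceSub B v w
    FaceSub-stable v w nn x f = proj₁ f , λ y py → decidable-stable (dot w y ℚₚ.≤? dot w x) (λ n≤ → nn (λ sub → n≤ (proj₂ (sub x f) y py)))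

    module _ (w : Point n) (i₀ : Fin n) (w-min : ∀ j → w i₀ ℚ.≤ w j) where

      private
        isMin : Fin n → Bool
        isMin i = does (w i ℚₚ.≤? w i₀)

      argmin : Subset n
      argmin = Vec.tabulate isMin

      ∈-argmin⁻ : ∀ {i} → i ∈ₛ argmin → w i ℚ.≤ w i₀
      ∈-argmin⁻ {i} i∈ = does⁻ (w i ℚₚ.≤? w i₀) (∈-tabulate isMin i∈)

      ∈-argmin⁺ : ∀ {i} → w i ℚ.≤ w i₀ → i ∈ₛ argmin
      ∈-argmin⁺ {i} le = tabulate-∈ isMin (dec-true (w i ℚₚ.≤? w i₀) le)

      -- `A` is the set where `w` is minimal. A member with a `w`-maximiser in the component `c` is
      -- contained in `A`, hence in `c`. So the face of `w` lies in that of `normal c`, and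
      -- maximality of the facet gives equality.
      facet-normal-comp : IsFacet B w → ∀ {A c} → (∀ {i} → i ∈ₛ A → w i ℚ.≤ w i₀) → (∀ {i} → w i ℚ.≤ w i₀ → i ∈ₛ A) → Comp B A c →
        c ∈ₗ B × c ≢ Full × FaceSub B w (normal c) × FaceSub B (normal c) w
      facet-normal-comp F {A} {c} ∈A A∋ C@(c∈ , c⊆A , _) =
          c∈ , c≢ , sub , FaceSub-stable (normal c) w (λ nsub → IsFacet.maximal F (normal c) sub (nsub , normal-proper c∈ c≢))
        where
        c≢ : c ≢ Full
        c≢ eq = IsFacet.proper F (Mx⇒FaceIsP w (λ {i} {j} → ℚₚ.≤-trans (∈A (c⊆A (subst (j ∈ₛ_) (sym eq) Sₚ.∈⊤))) (w-min i)))
        sub : FaceSub B w (normal c)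
        sub = Mx⇒FaceSub B w (normal c) (λ {J} {i} J∈ mx → Mx-normal⁺ (proj₁ mx) (λ i∈c →
          comp-absorb bs C J∈ (λ {j} j∈ → A∋ (ℚₚ.≤-trans (proj₂ mx j∈) (∈A (c⊆A i∈c)))) (meet i∈c (proj₁ mx))))

    facet-normal : ∀ {w} → IsFacet B w →
      Σ[ c ∈ Subset n ] (c ∈ₗ B × c ≢ Full × FaceSub B w (normal c) × FaceSub B (normal c) w)
    facet-normal {w} F with argmax (λ i → ℚ.- w i) Full (ne full)
    ... | i₀ , _ , maxi = normalOf (comp-cover bs {argmin w i₀ w-min} {i₀} (∈-argmin⁺ w i₀ w-min ℚₚ.≤-refl))
      where
      w-min : ∀ j → w i₀ ℚ.≤ w j
      w-min j = subst₂ ℚ._≤_ (neg-involutive (w i₀)) (neg-involutive (w j)) (ℚₚ.neg-antimono-≤ (maxi (Sₚ.∈⊤ {x = j})))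
      normalOf : Σ[ c ∈ Subset n ] (Comp B (argmin w i₀ w-min) c × i₀ ∈ₛ c) →
        Σ[ c ∈ Subset n ] (c ∈ₗ B × c ≢ Full × FaceSub B w (normal c) × FaceSub B (normal c) w)
      normalOf (c , C , _) = c , facet-normal-comp w i₀ w-min F (∈-argmin⁻ w i₀ w-min) (∈-argmin⁺ w i₀ w-min) C

    common⇒Adj : ∀ {c d x} → InP B x → InFace B (normal c) x → InFace B (normal d) x → Adj B c d
    common⇒Adj {c} {d} {x} px fc fd with (c ∪ d) ∈?ₗ B
    ... | no c∪d∉ = inj₂ (inj₂ c∪d∉)
    ... | yes c∪d∈ with common⇒Mx (λ w → w ≡ normal c ⊎ w ≡ normal d) B px (λ { (inj₁ refl) → fc ; (inj₂ refl) → fd }) c∪d∈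
    ...   | i , i∈ , h with Sₚ.x∈p∪q⁻ c d i∈
    ...     | inj₁ i∈c = inj₂ (inj₁ (Mx-normal⁻ (h (inj₁ refl)) i∈c ∘ ∪ʳ {p = c}))
    ...     | inj₂ i∈d = inj₁ (Mx-normal⁻ (h (inj₂ refl)) i∈d ∘ ∪ˡ)

    -- A vertex of Δ_J optimal for both directions could be lacking only when `J` lies in `c ∪ d`
    -- but in neither set; then `J` meets both, and `J ∪ c ∪ d`, which is `c ∪ d`, is a member.
    Adj⇒common : ∀ {c d} → c ∈ₗ B → d ∈ₗ B → Adj B c d → Σ[ x ∈ Point n ] (InFace B (normal c) x × InFace B (normal d) x)
    Adj⇒common {c} {d} c∈ d∈ adj with Mx⇒common (λ w → w ≡ normal c ⊎ w ≡ normal d) B select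
      where
      pick : ∀ {J} → J ∈ₗ B → Σ[ i ∈ Fin n ] (i ∈ₛ J × (i ∈ₛ c → J ⊆ₛ c) × (i ∈ₛ d → J ⊆ₛ d))
      pick {J} J∈ with J Sₚ.⊆? c | J Sₚ.⊆? d
      ... | yes p | yes q = let i , i∈ = ne J∈ in i , i∈ , (λ _ → p) , (λ _ → q)
      ... | yes p | no q = let i , i∈ , i∉ = outside-of q in i , i∈ , (λ _ → p) , λ i∈d → ⊥-elim (i∉ i∈d)
      ... | no p | yes q = let i , i∈ , i∉ = outside-of p in i , i∈ , (λ i∈c → ⊥-elim (i∉ i∈c)) , λ _ → q
      ... | no p | no q with J Sₚ.⊆? (c ∪ d)
      ...   | no r = let i , i∈ , i∉ = outside-of r in i , i∈ , (λ i∈c → ⊥-elim (i∉ (∪ˡ i∈c))) , λ i∈d → ⊥-elim (i∉ (∪ʳ {p = c} i∈d))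
      ...   | yes J⊆ = ⊥-elim (bad adj)
        where
        bad : ¬ Adj B c d
        bad (inj₁ c⊆d) = q λ i∈ → [ c⊆d , id ]′ (Sₚ.x∈p∪q⁻ c d (J⊆ i∈))
        bad (inj₂ (inj₁ d⊆c)) = p λ i∈ → [ id , d⊆c ]′ (Sₚ.x∈p∪q⁻ c d (J⊆ i∈))
        bad (inj₂ (inj₂ c∪d∉)) with outside-of p | outside-of q
        ... | i , i∈J , i∉c | j , j∈J , j∉d = c∪d∉ (subst (_∈ₗ B) eq (union (J ∪ c) d (union J c J∈ c∈ meet-c) d∈ meet-d))
          where
          meet-c = meet j∈J ([ id , (λ j∈d → ⊥-elim (j∉d j∈d)) ]′ (Sₚ.x∈p∪q⁻ c d (J⊆ j∈J)))
          meet-d = meet (∪ˡ {p = J} {q = c} i∈J) ([ (λ i∈c → ⊥-elim (i∉c i∈c)) , id ]′ (Sₚ.x∈p∪q⁻ c d (J⊆ i∈J)))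
          eq : (J ∪ c) ∪ d ≡ c ∪ d
          eq = Sₚ.⊆-antisym (∪-least (∪-least J⊆ ∪ˡ) (∪ʳ {p = c})) (∪-least (∪ˡ ∘ ∪ʳ {p = J}) (∪ʳ {p = J ∪ c}))
      select : ∀ {J} → J ∈ₗ B → Σ[ i ∈ Fin n ] (i ∈ₛ J × ∀ {w} → w ≡ normal c ⊎ w ≡ normal d → Mx w J i)
      select J∈ = let i , i∈ , hc , hd = pick J∈ in
        i , i∈ , λ { (inj₁ refl) → Mx-normal⁺ i∈ hc ; (inj₂ refl) → Mx-normal⁺ i∈ hd }
    ... | x , px , h = x , h (inj₁ refl) , h (inj₂ refl)

    module _ (splits : Splits B) where

      private
        S : SplitBS B
        S = record { isBS = bs ; full = full ; splits = splits }

      -- If no index of `J` serves all directions, each lies in a set of the family that does not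
      -- contain `J`; these sets cover `J`, against `cover`. This lifts pairwise compatibility to a
      -- common point.
      clique⇒Mx : ∀ (N : List (Subset n)) → (∀ {c} → c ∈ₗ N → c ∈ₗ B) → (∀ {c d} → c ∈ₗ N → d ∈ₗ N → Adj B c d) →
        ∀ {J} → J ∈ₗ B → Σ[ i ∈ Fin n ] (i ∈ₛ J × ∀ {c} → c ∈ₗ N → Mx (normal c) J i)
      clique⇒Mx N N⊆B adj {J} J∈ with Finₚ.any? (λ i → (i Sₚ.∈? J) ×-dec All.all? (λ c → (i Sₚ.∈? c) →-dec (J Sₚ.⊆? c)) N)
      ... | yes (i , i∈ , h) = i , i∈ , λ c∈ → Mx-normal⁺ i∈ (All.lookup h c∈)
      ... | no none with SplitBS.cover S (λ c → c ∈ₗ N × J ⊈ₛ c) (N⊆B ∘ proj₁) (λ p q → adj (proj₁ p) (proj₁ q)) J∈ covered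
        where
        covered : ∀ {i} → i ∈ₛ J → Σ[ c ∈ Subset n ] ((c ∈ₗ N × J ⊈ₛ c) × i ∈ₛ c)
        covered {i} i∈ with Any.any? (λ c → (i Sₚ.∈? c) ×-dec ¬? (J Sₚ.⊆? c)) N
        ... | yes p = let c , c∈ , i∈c , J⊈c = find p in c , (c∈ , J⊈c) , i∈c
        ... | no ¬p = ⊥-elim (none (i , i∈ , All.tabulate (λ {c} c∈ i∈c →
                decidable-stable (J Sₚ.⊆? c) (λ J⊈c → ¬p (lose {P = λ c → i ∈ₛ c × J ⊈ₛ c} c∈ (i∈c , J⊈c))))))
      ...   | c , (_ , J⊈c) , J⊆c = ⊥-elim (J⊈c J⊆c)

      -- Required for the minimality of `D`: the node sets of a tree inside `D` must be known to be
      -- flag before minimality can be applied to them.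
      splits⇒flag : IsFlagPolytope B
      splits⇒flag ws facets pairwise with Mx⇒common (_∈ₗ ws) B select
        where
        normals : ∀ ws → All (IsFacet B) ws → List (Subset n)
        normals [] [] = []
        normals (w ∷ ws) (F ∷ Fs) = proj₁ (facet-normal F) ∷ normals ws Fs
        source : ∀ ws Fs {c} → c ∈ₗ normals ws Fs → Σ[ w ∈ Point n ] (w ∈ₗ ws × c ∈ₗ B × FaceSub B w (normal c))
        source (w ∷ ws) (F ∷ Fs) (here refl) = let _ , c∈ , _ , sub , _ = facet-normal F in w , here refl , c∈ , sub
        source (w ∷ ws) (F ∷ Fs) (there p) = let w , w∈ , r = source ws Fs p in w , there w∈ , r
        target : ∀ ws Fs {w} → w ∈ₗ ws → Σ[ c ∈ Subset n ] (c ∈ₗ normals ws Fs × FaceSub B (normal c) w)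
        target (w ∷ ws) (F ∷ Fs) (here refl) = let c , _ , _ , _ , sub = facet-normal F in c , here refl , sub
        target (w ∷ ws) (F ∷ Fs) (there p) = let c , c∈ , r = target ws Fs p in c , there c∈ , r
        N = normals ws facets
        adj : ∀ {c d} → c ∈ₗ N → d ∈ₗ N → Adj B c d
        adj p q with source ws facets p | source ws facets q
        ... | w , w∈ , _ , sub | v , v∈ , _ , sub' with pairwise w v w∈ v∈
        ...   | x , fw , fv = common⇒Adj (proj₁ fw) (sub x fw) (sub' x fv)
        select : ∀ {J} → J ∈ₗ B → Σ[ i ∈ Fin n ] (i ∈ₛ J × ∀ {w} → w ∈ₗ ws → Mx w J i)
        select {J} J∈ with clique⇒Mx N (λ p → proj₁ (proj₂ (proj₂ (source ws facets p)))) adj J∈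
        ... | i , i∈ , h = i , i∈ , λ {w} w∈ → let c , c∈ , sub = target ws facets w∈ in FaceSub⇒Mx ne (normal c) w sub J∈ (h c∈)
      ... | x , px , h = x , px , All.tabulate h

    Comp? : ∀ X c → Dec (Comp B X c)
    Comp? X c = map′ to from ((c ∈?ₗ B) ×-dec ((c Sₚ.⊆? X) ×-dec
        All.all? (λ d → (d Sₚ.⊆? X) →-dec ((c Sₚ.⊆? d) →-dec (d Sₚ.⊆? c))) B))
      where
      to : c ∈ₗ B × c ⊆ₛ X × All (λ d → d ⊆ₛ X → c ⊆ₛ d → d ⊆ₛ c) B → Comp B X c
      to (c∈ , c⊆X , h) = c∈ , c⊆X , λ d∈ → All.lookup h d∈
      from : Comp B X c → c ∈ₗ B × c ⊆ₛ X × All (λ d → d ⊆ₛ X → c ⊆ₛ d → d ⊆ₛ c) B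
      from (c∈ , c⊆X , h) = c∈ , c⊆X , All.tabulate (λ d∈ → h d∈)

    -- If no member complements the maximal proper part x of u, then x and the
    -- components of u ─ x are pairwise compatible but cover u.
    maximal-part-split : IsFlagPolytope B → ∀ {u x} → u ∈ₗ B → x ∈ₗ B → x ≢ u → x ⊆ₛ u →
      (∀ {d} → d ∈ₗ B → d ≢ u → d ⊆ₛ u → x ⊆ₛ d → d ⊆ₛ x) →
      ¬ (∀ {x y} → x ∈ₗ B → y ∈ₗ B → Disjoint x y → x ∪ y ≢ u)
    maximal-part-split flag {u} {x} u∈ x∈ x≢u x⊆u maxi no-split = contradiction
      where
      rest : List (Subset n)
      rest = filter (Comp? (u ─ x)) B
      rest⁻ : ∀ {c} → c ∈ₗ rest → Comp B (u ─ x) c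
      rest⁻ c∈ = proj₂ (∈ₚ.∈-filter⁻ (Comp? (u ─ x)) {xs = B} c∈)
      N = x ∷ rest
      N⊆B : ∀ {c} → c ∈ₗ N → c ∈ₗ B
      N⊆B (here refl) = x∈
      N⊆B (there p) = proj₁ (rest⁻ p)
      -- `x ∪ c` is not `u` by `no-split`, so if it were a member, maximality of `x` would put `c`
      -- inside `x`.
      x-adj : ∀ {c} → Comp B (u ─ x) c → Adj B x c
      x-adj {c} (c∈ , c⊆ , _) = inj₂ (inj₂ λ x∪c∈ → let j , j∈ = ne c∈ in
        proj₂ (∈-─ (c⊆ j∈)) (maxi x∪c∈ (no-split x∈ c∈ (λ p q → proj₂ (∈-─ (c⊆ q)) p))
          (∪-least x⊆u (proj₁ ∘ ∈-─ ∘ c⊆)) ∪ˡ (∪ʳ {p = x} j∈)))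
      N-adj : ∀ {c d} → c ∈ₗ N → d ∈ₗ N → Adj B c d
      N-adj (here refl) (here refl) = inj₁ id
      N-adj (here refl) (there q) = x-adj (rest⁻ q)
      N-adj (there p) (here refl) = Adj-sym (x-adj (rest⁻ p))
      N-adj (there p) (there q) = comp-adj bs (rest⁻ p) (rest⁻ q)
      N-proper : ∀ {c} → c ∈ₗ N → c ≢ Full
      N-proper (here refl) eq = x≢u (Sₚ.⊆-antisym x⊆u (λ _ → subst (_ ∈ₛ_) (sym eq) Sₚ.∈⊤))
      N-proper (there p) refl = let j , j∈ = ne x∈ in proj₂ (∈-─ (proj₁ (proj₂ (rest⁻ p)) (Sₚ.∈⊤ {x = j}))) j∈
      common : Common B (map normal N)
      common = flag (map normal N)
        (All.tabulate (λ w∈ → let c , c∈ , eq = ∈ₚ.∈-map⁻ normal w∈ in subst (IsFacet B) (sym eq) (normal-facet (N⊆B c∈) (N-proper c∈))))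
        pairs
        where
        pairs : ∀ w v → w ∈ₗ map normal N → v ∈ₗ map normal N → Σ[ y ∈ Point n ] (InFace B w y × InFace B v y)
        pairs w v w∈ v∈ with ∈ₚ.∈-map⁻ normal w∈ | ∈ₚ.∈-map⁻ normal v∈
        ... | c , c∈ , refl | d , d∈ , refl = Adj⇒common (N⊆B c∈) (N⊆B d∈) (N-adj c∈ d∈)
      contradiction : ⊥
      -- The common point gives some `k ∈ u` such that each member of `N` containing `k` contains
      -- all of `u`. But `N` covers `u`, and none of its members contains `u`.
      contradiction with common⇒Mx (_∈ₗ map normal N) B (proj₁ (proj₂ common)) (All.lookup (proj₂ (proj₂ common))) u∈
      ... | k , k∈u , h with k Sₚ.∈? x
      ...   | yes k∈x = x≢u (Sₚ.⊆-antisym x⊆u (Mx-normal⁻ (h (here refl)) k∈x))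
      ...   | no k∉x with comp-cover bs {u ─ x} (Sₚ.x∈p∧x∉q⇒x∈p─q k∈u k∉x)
      ...     | c , C , k∈c = let j , j∈ = ne x∈ in
                proj₂ (∈-─ (proj₁ (proj₂ C) (Mx-normal⁻ (h (there (∈ₚ.∈-map⁺ normal (∈ₚ.∈-filter⁺ (Comp? (u ─ x)) (proj₁ C) C)))) k∈c (x⊆u j∈)))) j∈

    private
      Complementary : Subset n → Subset n → Subset n → Set
      Complementary u x y = ¬ Nonempty (x ∩ y) × x ∪ y ≡ u

      complementary? : ∀ u x y → Dec (Complementary u x y)
      complementary? u x y = ¬? (Sₚ.nonempty? (x ∩ y)) ×-dec ((x ∪ y) ≟ₛ u)

      search-split : ∀ u → (Σ[ x ∈ Subset n ] Σ[ y ∈ Subset n ] (x ∈ₗ B × y ∈ₗ B × Complementary u x y)) ⊎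
        (∀ {x y} → x ∈ₗ B → y ∈ₗ B → ¬ Complementary u x y)
      search-split u with Any.any? (λ x → Any.any? (complementary? u x) B) B
      ... | yes found with find found
      ...   | x , x∈ , f with find f
      ...     | y , y∈ , comp = inj₁ (x , y , x∈ , y∈ , comp)
      search-split u | no none = inj₂ λ {x} x∈ y∈ comp →
        none (lose {P = λ x → Any.Any (Complementary u x) B} x∈ (lose {P = Complementary u x} y∈ comp))

      -- `comp-exists` does not ask for a building set, so it may be run on `B` with `u` removed; a
      -- singleton is the starting point.
      maximal-part : ∀ {u i} → i ∈ₛ u → u ≢ ⁅ i ⁆ → Σ[ x ∈ Subset n ] (x ∈ₗ B × x ≢ u × x ⊆ₛ u ×
        (∀ {d} → d ∈ₗ B → d ≢ u → d ⊆ₛ u → x ⊆ₛ d → d ⊆ₛ x))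
      maximal-part {u} {i} i∈u u≢ with comp-exists (filter (λ d → ¬? (d ≟ₛ u)) B) {u} {⁅ i ⁆}
             (∈ₚ.∈-filter⁺ (λ d → ¬? (d ≟ₛ u)) (singleton i) (u≢ ∘ sym))
             (λ j∈ → subst (_∈ₛ u) (sym (Sₚ.x∈⁅y⁆⇒x≡y i j∈)) i∈u)
      ... | x , (x∈⁻ , x⊆u , maxi) , _ with ∈ₚ.∈-filter⁻ (λ d → ¬? (d ≟ₛ u)) {xs = B} x∈⁻
      ...   | x∈ , x≢u = x , x∈ , x≢u , x⊆u , λ d∈ d≢ → maxi (∈ₚ.∈-filter⁺ (λ d → ¬? (d ≟ₛ u)) d∈ d≢)

    flag⇒splits : IsFlagPolytope B → Splits B
    flag⇒splits flag {u} u∈ with search-split u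
    ... | inj₁ (x , y , x∈ , y∈ , emp , eq) = inj₂ (x , y , x∈ , y∈ , (λ p q → emp (meet p q)) , eq)
    ... | inj₂ none with ne u∈
    ...   | i , i∈u with u ≟ₛ ⁅ i ⁆
    ...     | yes eq = inj₁ (i , eq)
    ...     | no u≢ with maximal-part i∈u u≢
    ...       | x , x∈ , x≢u , x⊆u , maxi = ⊥-elim (maximal-part-split flag u∈ x∈ x≢u x⊆u maxi
                  λ {x} {y} x∈ y∈ disj eq → none x∈ y∈ ((λ { (j , j∈) → let p , q = Sₚ.x∈p∩q⁻ x y j∈ in disj p q }) , eq))

  -- The vertices of the nested set complex. `Full` is left out because its `normal` is constant,
  -- with all of `P_B` as face.
  properMembers : List (Subset n) → List (Subset n)
  properMembers B = filter (λ c → ¬? (c ≟ₛ Full)) B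

  ∈-proper⁺ : ∀ {B c} → c ∈ₗ B → c ≢ Full → c ∈ₗ properMembers B
  ∈-proper⁺ = ∈ₚ.∈-filter⁺ (λ c → ¬? (c ≟ₛ Full))

  ∈-proper⁻ : ∀ {B c} → c ∈ₗ properMembers B → c ∈ₗ B × c ≢ Full
  ∈-proper⁻ {B} = ∈ₚ.∈-filter⁻ (λ c → ¬? (c ≟ₛ Full)) {xs = B}

  proper-unique : ∀ {B} → Unique B → Unique (properMembers B)
  proper-unique = Uniqueₚ.filter⁺ (λ c → ¬? (c ≟ₛ Full))

  ConnFlagBS⇒SplitBS : ∀ {B : List (Subset n)} → IsConnFlagBS B → SplitBS B
  ConnFlagBS⇒SplitBS (bs , full , flag) = record { isBS = bs ; full = full ; splits = Facets.flag⇒splits bs full flag }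

  SplitBS⇒ConnFlagBS : ∀ {B : List (Subset n)} → SplitBS B → IsConnFlagBS B
  SplitBS⇒ConnFlagBS S = SplitBS.isBS S , SplitBS.full S , Facets.splits⇒flag (SplitBS.isBS S) (SplitBS.full S) (SplitBS.splits S)

-- Faces of the dual boundary complex as cliques.

cl-map : ∀ {A A' : Set} (e : A → A → Bool) (f : A' → A) s W → cl e s (map f W) ≡ cl (λ p q → e (f p) (f q)) s W
cl-map e f zero W = refl
cl-map e f (suc s) [] = refl
cl-map {A} {A'} e f (suc s) (w ∷ W) = cong₂ ℕ._+_ (cl-map e f (suc s) W)
  (trans (cong (cl e s) (filterᵇ-map (e (f w)) W)) (cl-map e f s (filterᵇ (λ q → e (f w) (f q)) W)))
  where
  filterᵇ-map : ∀ (g : A → Bool) (W : List A') → filterᵇ g (map f W) ≡ map f (filterᵇ (g ∘ f) W)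
  filterᵇ-map g [] = refl
  filterᵇ-map g (w ∷ W) with g (f w)
  ... | true = cong (f w ∷_) (filterᵇ-map g W)
  ... | false = filterᵇ-map g W

module FacetCount {n : ℕ} {B : List (Subset n)} (SB : SplitBS B) {m : ℕ} {fs : Fin m → Point n} (FE : FacetEnum B m fs)
  (member : Fin m → Subset n) (member∈ : ∀ j → member j ∈ₗ B) (member≢ : ∀ j → member j ≢ Full)
  (to : ∀ j → FaceSub B (fs j) (normal (member j))) (from : ∀ j → FaceSub B (normal (member j)) (fs j)) where
  open SplitBS SB
  open FacetEnum FE
  open Facets isBS full

  private
    member-injective : ∀ {i j} → member i ≡ member j → i ≡ j
    member-injective {i} {j} eq = distinct i j
      (λ x f → from j x (subst (λ c → InFace B (normal c) x) eq (to i x f)))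
      (λ x f → from i x (subst (λ c → InFace B (normal c) x) (sym eq) (to j x f)))

    member-surjective : ∀ {c} → c ∈ₗ properMembers B → c ∈ₗ map member (allFin m)
    member-surjective {c} c∈ with ∈-proper⁻ {B = B} c∈
    ... | c∈B , c≢ with complete (normal c) (normal-facet c∈B c≢)
    ...   | j , sub , _ = subst (_∈ₗ map member (allFin m))
              (sym (normal-injective c∈B (member∈ j) (member≢ j) (λ x f → to j x (sub x f))))
              (∈ₚ.∈-map⁺ member (∈ₚ.∈-allFin j))

    members↭ : map member (allFin m) ↭ properMembers B
    members↭ = Unique-⊆⊇⇒↭ (Unique-map (λ _ _ → member-injective) (Uniqueₚ.allFin⁺ m)) (proper-unique noDup)
      (λ c∈ → let j , _ , eq = ∈ₚ.∈-map⁻ member c∈ in subst (_∈ₗ properMembers B) (sym eq) (∈-proper⁺ (member∈ j) (member≢ j)))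
      member-surjective

    a : Fin m → Fin m → Bool
    a p q = edge B (member p) (member q)

    open CliqueCount a (λ p q → edge-sym B (member p) (member q)) using (count≡cl)

  -- Each facet is that of a unique proper member, and by `clique⇒Mx` pairwise compatibility
  -- suffices for a common point.
  faceCount≡cl : ∀ {s c} → HasCount (FaceOfΔP B fs s) c → c ≡ cl (edge B) s (properMembers B)
  faceCount≡cl {s} hc = trans (count≡cl {s} (Uniqueₚ.allFin⁺ m) ∈ₚ.∈-allFin hc sound build)
    (trans (sym (cl-map (edge B) member s (allFin m))) (cl-↭ (edge B) (edge-sym B) s members↭))
    where
    sound : ∀ {S} → FaceOfΔP B fs s S → ∣ S ∣ ≡ s × (∀ {p q} → p ∈ₛ S → q ∈ₛ S → p ≢ q → a p q ≡ true)
    sound (size , x , px , h) = size , λ {p} {q} p∈ q∈ p≢q →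
      edge⁺ ((p≢q ∘ member-injective) , common⇒Adj px (to p x (h p p∈)) (to q x (h q q∈)))
    build : ∀ {S} → ∣ S ∣ ≡ s → (∀ {p q} → p ∈ₛ S → q ∈ₛ S → p ≢ q → a p q ≡ true) → FaceOfΔP B fs s S
    build {S} size clique with Mx⇒common (λ w → Σ[ p ∈ Fin m ] (p ∈ₛ S × w ≡ normal (member p))) B select
      where
      js : List (Fin m)
      js = filter (Sₚ._∈? S) (allFin m)
      N = map member js
      N⁻ : ∀ {c} → c ∈ₗ N → Σ[ p ∈ Fin m ] (p ∈ₛ S × c ≡ member p)
      N⁻ c∈ = let p , p∈ , eq = ∈ₚ.∈-map⁻ member c∈ in p , proj₂ (∈ₚ.∈-filter⁻ (Sₚ._∈? S) {xs = allFin m} p∈) , eq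
      N-adj : ∀ {c d} → c ∈ₗ N → d ∈ₗ N → Adj B c d
      N-adj c∈ d∈ with N⁻ c∈ | N⁻ d∈
      ... | p , p∈ , refl | q , q∈ , refl with p Finₚ.≟ q
      ...   | yes refl = inj₁ id
      ...   | no p≢q = proj₂ (edge⁻ {B = B} (clique p∈ q∈ p≢q))
      select : ∀ {J} → J ∈ₗ B → Σ[ i ∈ Fin n ] (i ∈ₛ J × ∀ {w} → (Σ[ p ∈ Fin m ] (p ∈ₛ S × w ≡ normal (member p))) → Mx w J i)
      select J∈ with clique⇒Mx splits N (λ c∈ → let p , _ , eq = N⁻ c∈ in subst (_∈ₗ B) (sym eq) (member∈ p)) N-adj J∈
      ... | i , i∈ , h = i , i∈ , λ { (p , p∈ , refl) → h (∈ₚ.∈-map⁺ member (∈ₚ.∈-filter⁺ (Sₚ._∈? S) (∈ₚ.∈-allFin p) p∈)) }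
    ... | x , px , h = size , x , px , λ p p∈ → from p x (h (p , p∈ , refl))

faceCount : ∀ {n} {B : List (Subset n)} → SplitBS B → ∀ {m} {fs : Fin m → Point n} → FacetEnum B m fs →
  ∀ {s c} → HasCount (FaceOfΔP B fs s) c → c ≡ cl (edge B) s (properMembers B)
faceCount {B = B} SB {fs = fs} FE = FacetCount.faceCount≡cl SB FE (proj₁ ∘ facetOf) (proj₁ ∘ proj₂ ∘ facetOf)
    (proj₁ ∘ proj₂ ∘ proj₂ ∘ facetOf) (λ j → proj₁ (proj₂ (proj₂ (proj₂ (facetOf j))))) (λ j → proj₂ (proj₂ (proj₂ (proj₂ (facetOf j)))))
  where
  open Facets (SplitBS.isBS SB) (SplitBS.full SB)
  facetOf : ∀ j → Σ[ c ∈ Subset _ ] (c ∈ₗ B × c ≢ Full × FaceSub B (fs j) (normal c) × FaceSub B (normal c) (fs j))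
  facetOf j = facet-normal (FacetEnum.isFacet FE j)

-- Minimal flag building sets

module _ {A : Set} (e : A → A → Bool) where

  -- Cross e m W: the graph on W is that of the m-dimensional cross-polytope.
  data Cross : ℕ → List A → Set where
    []   : Cross 0 []
    pair : ∀ {m W W' x y} → W ↭ x ∷ y ∷ W' → e x y ≡ false → (∀ {c} → c ∈ₗ W' → e x c ≡ true) →
           (∀ {c} → c ∈ₗ W' → e y c ≡ true) → Cross m W' → Cross (suc m) W

  Cross-↭ : ∀ {m W W'} → W ↭ W' → Cross m W → Cross m W'
  Cross-↭ p [] rewrite Permₚ.↭-empty-inv (↭-sym p) = []
  Cross-↭ p (pair q n f g C) = pair (↭-trans (↭-sym p) q) n f g C

  Cross-++ : ∀ {m m' W W'} → (∀ {c d} → c ∈ₗ W → d ∈ₗ W' → e c d ≡ true) → Cross m W → Cross m' W' → Cross (m + m') (W ++ W')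
  Cross-++ h [] C' = C'
  Cross-++ {W' = W'} h (pair {W' = W₀} p n f g C) C' = pair (Permₚ.++⁺ʳ W' p) n
    (λ c∈ → [ f , h (back (here refl)) ]′ (∈ₚ.∈-++⁻ W₀ c∈))
    (λ c∈ → [ g , h (back (there (here refl))) ]′ (∈ₚ.∈-++⁻ W₀ c∈))
    (Cross-++ (λ c∈ → h (back (there (there c∈)))) C C')
    where
    back : ∀ {c} → c ∈ₗ _ → c ∈ₗ _
    back = Permₚ.∈-resp-↭ (↭-sym p)

  module _ (e-sym : ∀ c d → e c d ≡ e d c) where

    Cross⇒Expand : ∀ {m W g} → g ≗ δ₀ → Cross m W → Expand m g (clᵖ e W)
    Cross⇒Expand g0 [] = point g0 (clᵖ-[] e)
    Cross⇒Expand g0 (pair {W' = W'} {x} {y} p n f g C) = susp (Cross⇒Expand g0 C) λ s → begin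
        clᵖ e _ s ≡⟨ cl-↭ e e-sym s p ⟩
        clᵖ e (x ∷ y ∷ W') s ≡⟨ clᵖ-∷ e x (y ∷ W') s ⟩
        clᵖ e (y ∷ W') s + sh (clᵖ e (filterᵇ (e x) (y ∷ W'))) s
          ≡⟨ cong₂ (λ a W → a + sh (clᵖ e W) s) (clᵖ-∷ e y W' s) (trans (filterᵇ-reject (e x) y W' n) (filterᵇ-keep W' f)) ⟩
        clᵖ e W' s + sh (clᵖ e (filterᵇ (e y) W')) s + sh (clᵖ e W') s
          ≡⟨ cong (λ W → clᵖ e W' s + sh (clᵖ e W) s + sh (clᵖ e W') s) (filterᵇ-keep W' g) ⟩
        clᵖ e W' s + sh (clᵖ e W') s + sh (clᵖ e W') s ≡⟨ ℕₚ.+-assoc (clᵖ e W' s) _ _ ⟩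
        clᵖ e W' s + (sh (clᵖ e W') s + sh (clᵖ e W') s) ∎
      where open ≡-Reasoning

    module _ (irrefl : ∀ c → e c c ≡ false) where

      -- The link of a vertex loses this vertex and its antipode and keeps every other pair.
      Cross-link : ∀ {m W c} → Cross m W → c ∈ₗ W → Σ[ k ∈ ℕ ] (m ≡ suc k × Cross k (filterᵇ (λ d → e d c) W))
      Cross-link {c = c} (pair {m} {W} {W'} {x} {y} p n f g C) c∈ = m , refl , link (Permₚ.∈-resp-↭ p c∈)
        where
        N : A → Bool
        N d = e d c
        rearranged : filterᵇ N W ↭ filterᵇ N (x ∷ y ∷ W')
        rearranged = filterᵇ-↭ N p
        link : c ∈ₗ x ∷ y ∷ W' → Cross m (filterᵇ N W)
        link (here refl) = Cross-↭ (↭-sym (↭-trans rearranged (Perm.↭-reflexive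
          (trans (filterᵇ-reject N x (y ∷ W') (irrefl x)) (trans (filterᵇ-reject N y W' (trans (e-sym y x) n))
            (filterᵇ-keep W' (λ {d} d∈ → trans (e-sym d x) (f d∈)))))))) C
        link (there (here refl)) = Cross-↭ (↭-sym (↭-trans rearranged (Perm.↭-reflexive
          (trans (filterᵇ-reject N x (y ∷ W') n) (trans (filterᵇ-reject N y W' (irrefl y))
            (filterᵇ-keep W' (λ {d} d∈ → trans (e-sym d y) (g d∈)))))))) C
        link (there (there c∈')) with Cross-link C c∈'
        ... | k , refl , Ck = pair (↭-trans rearranged (Perm.↭-reflexive
          (trans (filterᵇ-accept N x (y ∷ W') (f c∈')) (cong (x ∷_) (filterᵇ-accept N y W' (g c∈')))))) n
            (λ d∈ → f (proj₁ (∈-filterᵇ⁻ W' d∈))) (λ d∈ → g (proj₁ (∈-filterᵇ⁻ W' d∈))) Ck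

      Cross-lk : ∀ {m V} → Cross m V → ∀ σ → Unique σ → (∀ {s} → s ∈ₗ σ → s ∈ₗ V) →
        (∀ {s t} → s ∈ₗ σ → t ∈ₗ σ → s ≢ t → e s t ≡ true) → Σ[ k ∈ ℕ ] (length σ + k ≡ m × Cross k (lk e σ V))
      Cross-lk {m} {V} C [] u σ⊆ cl = m , refl , subst (Cross m) (sym (filterᵇ-keep V (λ _ → refl))) C
      Cross-lk {m} {V} C (c ∷ σ) u σ⊆ cl with Cross-lk C σ (proj₂ (Unique-∷⁻ u)) (σ⊆ ∘ there) (λ p q → cl (there p) (there q))
      ... | k , eq , Ck with Cross-link Ck (∈-filterᵇ⁺ (σ⊆ (here refl))
              (all-true⁺ σ (λ {s} s∈ → cl (here refl) (there s∈) (λ { refl → proj₁ (Unique-∷⁻ u) s∈ }))))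
      ...   | k' , refl , Ck' = k' , trans (sym (ℕₚ.+-suc (length σ) k')) eq , subst (Cross k') (filterᵇ-filterᵇ (λ d → e d c) (λ d → all (e d) σ) V) Ck'

module _ {n : ℕ} where

  data Tree : Subset n → Set where
    leaf : ∀ i → Tree ⁅ i ⁆
    node : ∀ {x y u} → Tree x → Tree y → Disjoint x y → x ∪ y ≡ u → Tree u

  -- The root is kept apart because `Full` is not a vertex of the complex.
  below : ∀ {u} → Tree u → List (Subset n)
  below (leaf i) = []
  below (node {x} {y} l r _ _) = x ∷ y ∷ (below l ++ below r)

  nodes : ∀ {u} → Tree u → List (Subset n)
  nodes {u} t = u ∷ below t

  below⁻ : ∀ {x y u} (l : Tree x) (r : Tree y) (d : Disjoint x y) (eq : x ∪ y ≡ u) {c} → c ∈ₗ below (node l r d eq) → c ∈ₗ nodes l ⊎ c ∈ₗ nodes r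
  below⁻ l r d eq (here refl) = inj₁ (here refl)
  below⁻ l r d eq (there (here refl)) = inj₂ (here refl)
  below⁻ l r d eq (there (there p)) with ∈ₚ.∈-++⁻ (below l) p
  ... | inj₁ q = inj₁ (there q)
  ... | inj₂ q = inj₂ (there q)

  below⁺ˡ : ∀ {x y u} (l : Tree x) (r : Tree y) (d : Disjoint x y) (eq : x ∪ y ≡ u) {c} → c ∈ₗ nodes l → c ∈ₗ below (node l r d eq)
  below⁺ˡ l r d eq (here refl) = here refl
  below⁺ˡ l r d eq (there p) = there (there (∈ₚ.∈-++⁺ˡ p))

  below⁺ʳ : ∀ {x y u} (l : Tree x) (r : Tree y) (d : Disjoint x y) (eq : x ∪ y ≡ u) {c} → c ∈ₗ nodes r → c ∈ₗ below (node l r d eq)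
  below⁺ʳ l r d eq (here refl) = there (here refl)
  below⁺ʳ l r d eq (there p) = there (there (∈ₚ.∈-++⁺ʳ (below l) p))

  root-nonempty : ∀ {u} → Tree u → Nonempty u
  root-nonempty (leaf i) = i , Sₚ.x∈⁅x⁆ i
  root-nonempty (node l r d refl) = let i , i∈ = root-nonempty l in i , ∪ˡ i∈

  node-nonempty : ∀ {u} (t : Tree u) {c} → c ∈ₗ nodes t → Nonempty c
  node-nonempty t (here refl) = root-nonempty t
  node-nonempty (node l r d eq) (there p) = [ node-nonempty l , node-nonempty r ]′ (below⁻ l r d eq p)

  node-⊆ : ∀ {u} (t : Tree u) {c} → c ∈ₗ nodes t → c ⊆ₛ u
  node-⊆ t (here refl) = id
  node-⊆ (node l r d refl) (there p) i∈ with below⁻ l r d refl p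
  ... | inj₁ q = ∪ˡ (node-⊆ l q i∈)
  ... | inj₂ q = ∪ʳ {p = _} (node-⊆ r q i∈)

  below-≢ : ∀ {u} (t : Tree u) {c} → c ∈ₗ below t → c ≢ u
  below-≢ (node {x} l r d refl) p refl with below⁻ l r d refl p
  ... | inj₁ q = let i , i∈ = root-nonempty r in d (node-⊆ l q (∪ʳ {p = x} i∈)) i∈
  ... | inj₂ q = let i , i∈ = root-nonempty l in d i∈ (node-⊆ r q (∪ˡ i∈))

  nodes-disjoint : ∀ {x y} (l : Tree x) (r : Tree y) → Disjoint x y → ∀ {c d} → c ∈ₗ nodes l → d ∈ₗ nodes r → Disjoint c d
  nodes-disjoint l r dis p q i∈c i∈d = dis (node-⊆ l p i∈c) (node-⊆ r q i∈d)

  nodes-unique : ∀ {u} (t : Tree u) → Unique (nodes t)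
  below-unique : ∀ {u} (t : Tree u) → Unique (below t)
  nodes-unique t = Unique-∷⁺ (λ p → below-≢ t p refl) (below-unique t)
  below-unique (leaf i) = []
  below-unique (node {x} {y} l r d eq) = Unique-∷⁺ x∉ (Unique-∷⁺ y∉ (Uniqueₚ.++⁺ (below-unique l) (below-unique r)
      (λ (p , q) → apart (there p) (there q))))
    where
    apart : ∀ {c} → c ∈ₗ nodes l → c ∈ₗ nodes r → ⊥
    apart p q = let i , i∈ = node-nonempty l p in nodes-disjoint l r d p q i∈ i∈
    x∉ : x ∉ₗ y ∷ below l ++ below r
    x∉ (here refl) = apart (here refl) (here refl)
    x∉ (there p) with ∈ₚ.∈-++⁻ (below l) p
    ... | inj₁ q = below-≢ l q refl
    ... | inj₂ q = apart (here refl) (there q)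
    y∉ : y ∉ₗ below l ++ below r
    y∉ p with ∈ₚ.∈-++⁻ (below l) p
    ... | inj₁ q = apart (there q) (here refl)
    ... | inj₂ q = below-≢ r q refl

  Laminar : List (Subset n) → Set
  Laminar B = ∀ {c d} → c ∈ₗ B → d ∈ₗ B → Disjoint c d ⊎ c ⊆ₛ d ⊎ d ⊆ₛ c

  nodes-laminar : ∀ {u} (t : Tree u) → Laminar (nodes t)
  nodes-laminar t p (here refl) = inj₂ (inj₁ (node-⊆ t p))
  nodes-laminar t (here refl) q = inj₂ (inj₂ (node-⊆ t q))
  nodes-laminar (node l r d eq) (there p) (there q) with below⁻ l r d eq p | below⁻ l r d eq q
  ... | inj₁ p' | inj₁ q' = nodes-laminar l p' q'
  ... | inj₁ p' | inj₂ q' = inj₁ (nodes-disjoint l r d p' q')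
  ... | inj₂ p' | inj₁ q' = inj₁ (λ i j → nodes-disjoint l r d q' p' j i)
  ... | inj₂ p' | inj₂ q' = nodes-laminar r p' q'

  nodes-singleton : ∀ {u} (t : Tree u) {i} → i ∈ₛ u → ⁅ i ⁆ ∈ₗ nodes t
  nodes-singleton (leaf j) i∈ rewrite Sₚ.x∈⁅y⁆⇒x≡y j i∈ = here refl
  nodes-singleton (node {x} {y} l r d refl) i∈ with Sₚ.x∈p∪q⁻ x y i∈
  ... | inj₁ i∈x = there (below⁺ˡ l r d refl (nodes-singleton l i∈x))
  ... | inj₂ i∈y = there (below⁺ʳ l r d refl (nodes-singleton r i∈y))

  nodes-splits : ∀ {u} (t : Tree u) → Splits (nodes t)
  nodes-splits (leaf i) (here refl) = inj₁ (i , refl)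
  nodes-splits (node {x} {y} l r d eq) (here refl) =
    inj₂ (x , y , there (here refl) , there (there (here refl)) , d , eq)
  nodes-splits (node l r d eq) (there p) with below⁻ l r d eq p
  ... | inj₁ q with nodes-splits l q
  ...   | inj₁ s = inj₁ s
  ...   | inj₂ (x , y , x∈ , y∈ , s) = inj₂ (x , y , there (below⁺ˡ l r d eq x∈) , there (below⁺ˡ l r d eq y∈) , s)
  nodes-splits (node l r d eq) (there p) | inj₂ q with nodes-splits r q
  ...   | inj₁ s = inj₁ s
  ...   | inj₂ (x , y , x∈ , y∈ , s) = inj₂ (x , y , there (below⁺ʳ l r d eq x∈) , there (below⁺ʳ l r d eq y∈) , s)

  nodes-SplitBS : (t : Tree Full) → SplitBS (nodes t)
  nodes-SplitBS t = record
    { isBS = record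
      { noDup = nodes-unique t
      ; nonempty = All.tabulate (node-nonempty t)
      ; union = union
      ; singleton = λ i → nodes-singleton t Sₚ.∈⊤ }
    ; full = here refl
    ; splits = nodes-splits t }
    where
    union : ∀ I J → I ∈ₗ nodes t → J ∈ₗ nodes t → Nonempty (I ∩ J) → (I ∪ J) ∈ₗ nodes t
    union I J p q (i , i∈) with nodes-laminar t p q
    ... | inj₁ d = let i∈I , i∈J = Sₚ.x∈p∩q⁻ I J i∈ in ⊥-elim (d i∈I i∈J)
    ... | inj₂ (inj₁ I⊆J) = subst (_∈ₗ nodes t) (Sₚ.⊆-antisym (∪ʳ {p = I}) (∪-least I⊆J id)) q
    ... | inj₂ (inj₂ J⊆I) = subst (_∈ₗ nodes t) (Sₚ.⊆-antisym ∪ˡ (∪-least id J⊆I)) p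

  -- The two children of a node are antipodal, their union being the node; all other pairs are
  -- nested or have a union outside `B`. There is one antipodal pair for each of the |u| - 1 inner
  -- nodes.
  nodes-Cross : ∀ {B} → Laminar B → ∀ {u} (t : Tree u) → (∀ {c} → c ∈ₗ nodes t → c ∈ₗ B) →
    Σ[ m ∈ ℕ ] (∣ u ∣ ≡ suc m × Cross (edge B) m (below t))
  nodes-Cross lam (leaf i) sub = 0 , Sₚ.∣⁅x⁆∣≡1 i , []
  nodes-Cross {B} lam (node {x} {y} l r d refl) sub
    with nodes-Cross lam l (λ p → sub (there (below⁺ˡ l r d refl p))) | nodes-Cross lam r (λ p → sub (there (below⁺ʳ l r d refl p)))
  ... | m , sizeˡ , Cˡ | m' , sizeʳ , Cʳ = suc (m + m') ,
      trans (∣∪∣-disjoint x y d) (trans (cong₂ _+_ sizeˡ sizeʳ) (ℕₚ.+-suc (suc m) m')) ,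
      pair Perm.refl x≁y x-adj y-adj (Cross-++ (edge B) (λ p q → across (there p) (there q) (inj₁ (below-≢ l p))) Cˡ Cʳ)
    where
    inˡ : ∀ {c} → c ∈ₗ nodes l → c ∈ₗ B
    inˡ p = sub (there (below⁺ˡ l r d refl p))
    inʳ : ∀ {c} → c ∈ₗ nodes r → c ∈ₗ B
    inʳ p = sub (there (below⁺ʳ l r d refl p))
    x≁y : edge B x y ≡ false
    x≁y = dec-false (Edge? B x y) λ
      { (_ , inj₁ p) → let i , i∈ = root-nonempty l in d i∈ (p i∈)
      ; (_ , inj₂ (inj₁ p)) → let i , i∈ = root-nonempty r in d (p i∈) i∈
      ; (_ , inj₂ (inj₂ p)) → p (sub (here refl)) }
    -- Comparing a member `a ∪ c` with `x` and with `y` in the laminar family gives `x ⊆ a` and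
    -- `y ⊆ c`, so `a` and `c` would be the two children.
    union∉ : ∀ {a c} → a ∈ₗ nodes l → c ∈ₗ nodes r → a ≢ x ⊎ c ≢ y → a ∪ c ∉ₗ B
    union∉ {a} {c} p q ne a∪c∈ = [ (λ a≢x → a≢x (Sₚ.⊆-antisym (node-⊆ l p) x⊆a)) , (λ c≢y → c≢y (Sₚ.⊆-antisym (node-⊆ r q) y⊆c)) ]′ ne
      where
      x⊆a : x ⊆ₛ a
      x⊆a {i} i∈x with lam a∪c∈ (inˡ (here refl))
      ... | inj₁ dis = let j , j∈ = node-nonempty l p in ⊥-elim (dis (∪ˡ j∈) (node-⊆ l p j∈))
      ... | inj₂ (inj₁ a∪c⊆x) = let j , j∈ = node-nonempty r q in ⊥-elim (d (a∪c⊆x (∪ʳ {p = a} j∈)) (node-⊆ r q j∈))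
      ... | inj₂ (inj₂ x⊆) = [ id , (λ i∈c → ⊥-elim (d i∈x (node-⊆ r q i∈c))) ]′ (Sₚ.x∈p∪q⁻ a c (x⊆ i∈x))
      y⊆c : y ⊆ₛ c
      y⊆c {i} i∈y with lam a∪c∈ (inʳ (here refl))
      ... | inj₁ dis = let j , j∈ = node-nonempty r q in ⊥-elim (dis (∪ʳ {p = a} j∈) (node-⊆ r q j∈))
      ... | inj₂ (inj₁ a∪c⊆y) = let j , j∈ = node-nonempty l p in ⊥-elim (d (node-⊆ l p j∈) (a∪c⊆y (∪ˡ j∈)))
      ... | inj₂ (inj₂ y⊆) = [ (λ i∈a → ⊥-elim (d (node-⊆ l p i∈a) i∈y)) , id ]′ (Sₚ.x∈p∪q⁻ a c (y⊆ i∈y))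
    across : ∀ {a c} → a ∈ₗ nodes l → c ∈ₗ nodes r → a ≢ x ⊎ c ≢ y → edge B a c ≡ true
    across p q ne = edge⁺ {B = B} ((λ { refl → let i , i∈ = node-nonempty l p in nodes-disjoint l r d p q i∈ i∈ }) , inj₂ (inj₂ (union∉ p q ne)))
    x-adj : ∀ {c} → c ∈ₗ below l ++ below r → edge B x c ≡ true
    x-adj c∈ with ∈ₚ.∈-++⁻ (below l) c∈
    ... | inj₁ p = edge⁺ {B = B} (below-≢ l p ∘ sym , inj₂ (inj₁ (node-⊆ l (there p))))
    ... | inj₂ q = across (here refl) (there q) (inj₂ (below-≢ r q))
    y-adj : ∀ {c} → c ∈ₗ below l ++ below r → edge B y c ≡ true
    y-adj {c} c∈ with ∈ₚ.∈-++⁻ (below l) c∈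
    ... | inj₁ p = trans (edge-sym B y c) (across (there p) (here refl) (inj₁ (below-≢ l p)))
    ... | inj₂ q = edge⁺ {B = B} (below-≢ r q ∘ sym , inj₂ (inj₁ (node-⊆ r (there q))))

  tree-inside : ∀ {B} → SplitBS B → ∀ {u} → u ∈ₗ B → Σ[ t ∈ Tree u ] (∀ {c} → c ∈ₗ nodes t → c ∈ₗ B)
  tree-inside {B} S {u} u∈ = go u (<-wellFounded ∣ u ∣) u∈
    where
    open SplitBS S
    go : ∀ u → Acc _<_ ∣ u ∣ → u ∈ₗ B → Σ[ t ∈ Tree u ] (∀ {c} → c ∈ₗ nodes t → c ∈ₗ B)
    go u (acc rec) u∈ with splits u∈
    ... | inj₁ (i , refl) = leaf i , λ { (here refl) → u∈ }
    ... | inj₂ (x , y , x∈ , y∈ , d , refl)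
      with go x (rec (disjoint-∣∣<ˡ d refl (nonempty-∈ y∈))) x∈ | go y (rec (disjoint-∣∣<ʳ d refl (nonempty-∈ x∈))) y∈
    ...   | l , subˡ | r , subʳ = node l r d refl , λ
            { (here refl) → u∈
            ; (there p) → [ subˡ , subʳ ]′ (below⁻ l r d refl p) }

  module _ {D : List (Subset n)} (minimal : IsMinimalFlagBS D) (t : Tree Full) (sub : ∀ {c} → c ∈ₗ nodes t → c ∈ₗ D) where

    -- The nodes of the tree already form a connected flag building set inside `D`, so minimality
    -- leaves nothing outside them.
    minimal⊆nodes : ∀ {c} → c ∈ₗ D → c ∈ₗ nodes t
    minimal⊆nodes {c} c∈ = decidable-stable (c ∈?ₗ nodes t) λ c∉ →
      proj₂ minimal (nodes t) (λ _ → sub) (c , c∈ , c∉) (SplitBS⇒ConnFlagBS (nodes-SplitBS t))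

    module _ {B : List (Subset n)} (uB : Unique B) (D⊆B : ∀ {c} → c ∈ₗ D → c ∈ₗ B) (B⊆D : ∀ {c} → c ∈ₗ B → c ∈ₗ D) where

      below↭proper : below t ↭ properMembers B
      below↭proper = Unique-⊆⊇⇒↭ (below-unique t) (proper-unique uB) (λ p → ∈-proper⁺ (D⊆B (sub (there p))) (below-≢ t p)) proper
        where
        strip : ∀ {c} → c ≢ Full → c ∈ₗ nodes t → c ∈ₗ below t
        strip c≢ (here refl) = ⊥-elim (c≢ refl)
        strip c≢ (there p) = p
        proper : ∀ {c} → c ∈ₗ properMembers B → c ∈ₗ below t
        proper c∈ = strip (proj₂ (∈-proper⁻ {B = B} c∈)) (minimal⊆nodes (B⊆D (proj₁ (∈-proper⁻ {B = B} c∈))))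

      proper-Cross : Σ[ m ∈ ℕ ] (n ≡ suc m × Cross (edge B) m (properMembers B))
      proper-Cross = let m , size , C = nodes-Cross {B} (λ p q → nodes-laminar t (minimal⊆nodes (B⊆D p)) (minimal⊆nodes (B⊆D q))) t (λ p → D⊆B (sub p)) in
        m , trans (sym (Sₚ.∣⊤∣≡n n)) size , Cross-↭ (edge B) below↭proper C

  -- `B` is kept apart from `D` because the prefix at 0 is `D ++ []`, not literally `D`; only its
  -- members matter.
  minimal-Cross : ∀ {D B : List (Subset n)} → IsMinimalFlagBS D → Unique B → (∀ {c} → c ∈ₗ D → c ∈ₗ B) → (∀ {c} → c ∈ₗ B → c ∈ₗ D) →
    Σ[ m ∈ ℕ ] (n ≡ suc m × Cross (edge B) m (properMembers B))
  minimal-Cross minimal uB D⊆B B⊆D = let t , sub = tree-inside (ConnFlagBS⇒SplitBS (proj₁ minimal)) (proj₁ (proj₂ (proj₁ minimal))) in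
    proper-Cross minimal t sub uB D⊆B B⊆D

-- Links along an extension

module _ {n : ℕ} where

  -- Among old vertices only the edge between `x` and `y` is lost (`Adj-up`), and on the remaining
  -- ones compatibility with `v` is compatibility with both halves (`Adj-v⇒x`, `Adj-xy⇒v`).
  extension-subdivision : ∀ {B B' v x y} → Extension B B' v x y → Σ[ V₀ ∈ List (Subset n) ]
    (properMembers B ↭ x ∷ y ∷ V₀ × properMembers B' ↭ v ∷ x ∷ y ∷ V₀ × Subdivision (edge B) (edge B') x y v V₀)
  extension-subdivision {B} {B'} {v} {x} {y} E = V₀ , perm , ↭-trans perm' (prep v perm) , record
      { irrefl = edge-irrefl B ; irrefl' = edge-irrefl B' ; symm = edge-sym B ; symm' = edge-sym B'
      ; edge = edge⁺ {B = B} Edge-xy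
      ; cut = dec-false (Edge? B' x y) ¬Edge'-xy
      ; old = λ p q → same (∈B p) (∈B q) (λ { (refl , _) → x∉ p }) (λ { (refl , _) → y∉ p })
      ; oldx = λ p → same x∈B (∈B p) (λ { (_ , refl) → y∉ p }) (λ { (eq , _) → x≢y eq })
      ; oldy = λ p → same y∈B (∈B p) (λ { (eq , _) → x≢y (sym eq) }) (λ { (_ , refl) → x∉ p })
      ; newx = edge⁺ {B = B'} ((λ { refl → v∉B x∈B }) , inj₂ (inj₁ x⊆v))
      ; newy = edge⁺ {B = B'} ((λ { refl → v∉B y∈B }) , inj₂ (inj₁ y⊆v))
      ; new = λ {c} p → does-⇔ (mk⇔
          (λ { (_ , adj) → ((λ { refl → x∉ p }) , Adj-v⇒x (∈B p) (λ { refl → y∉ p }) adj)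
                         , ((λ { refl → y∉ p }) , ExtensionProps.Adj-v⇒x (Extension-swap E) (∈B p) (λ { refl → x∉ p }) adj) })
          (λ { ((_ , ax) , (_ , ay)) → (λ { refl → v∉B (∈B p) }) , Adj-xy⇒v (∈B p) ax ay }))
          (Edge? B' v c) (Edge? B x c ×-dec Edge? B y c) }
    where
    open Extension E
    open ExtensionProps E
    uV : Unique (properMembers B)
    uV = proper-unique (SplitBS.noDup old)
    x≢Full : x ≢ Full
    x≢Full refl = disj Sₚ.∈⊤ (proj₂ iy)
    y≢Full : y ≢ Full
    y≢Full refl = disj (proj₂ ix) Sₚ.∈⊤
    fst = ∈⇒↭∷ (∈-proper⁺ x∈B x≢Full)
    y∈rest : y ∈ₗ proj₁ fst
    y∈rest with Permₚ.∈-resp-↭ (proj₂ fst) (∈-proper⁺ y∈B y≢Full)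
    ... | here eq = ⊥-elim (x≢y (sym eq))
    ... | there p = p
    snd = ∈⇒↭∷ y∈rest
    V₀ : List (Subset n)
    V₀ = proj₁ snd
    perm : properMembers B ↭ x ∷ y ∷ V₀
    perm = ↭-trans (proj₂ fst) (prep x (proj₂ snd))
    u₀ : Unique (x ∷ y ∷ V₀)
    u₀ = Unique-↭ perm uV
    x∉ : x ∉ₗ V₀
    x∉ p = proj₁ (Unique-∷⁻ u₀) (there p)
    y∉ : y ∉ₗ V₀
    y∉ = proj₁ (Unique-∷⁻ (proj₂ (Unique-∷⁻ u₀)))
    ∈B : ∀ {c} → c ∈ₗ V₀ → c ∈ₗ B
    ∈B p = proj₁ (∈-proper⁻ {B = B} (Permₚ.∈-resp-↭ (↭-sym perm) (there (there p))))
    perm' : properMembers B' ↭ v ∷ properMembers B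
    perm' = Unique-⊆⊇⇒↭ (proper-unique (SplitBS.noDup new)) (Unique-∷⁺ (v∉B ∘ proj₁ ∘ ∈-proper⁻ {B = B}) uV) to from
      where
      to : ∀ {c} → c ∈ₗ properMembers B' → c ∈ₗ v ∷ properMembers B
      to {c} p with ∈-proper⁻ {B = B'} p
      ... | c∈ , c≢ with c ≟ₛ v
      ...   | yes refl = here refl
      ...   | no c≢v = there (∈-proper⁺ (B'⊆B c∈ c≢v) c≢)
      from : ∀ {c} → c ∈ₗ v ∷ properMembers B → c ∈ₗ properMembers B'
      from (here refl) = ∈-proper⁺ v∈B' (λ { refl → v∉B (SplitBS.full old) })
      from (there p) = let c∈ , c≢ = ∈-proper⁻ {B = B} p in ∈-proper⁺ (B⊆B' c∈) c≢
    same : ∀ {c d} → c ∈ₗ B → d ∈ₗ B → ¬ (c ≡ x × d ≡ y) → ¬ (c ≡ y × d ≡ x) → edge B' c d ≡ edge B c d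
    same {c} {d} c∈ d∈ n₁ n₂ = does-⇔ (mk⇔ (λ (ne , adj) → ne , Adj-down adj) (λ (ne , adj) → ne , Adj-up c∈ d∈ n₁ n₂ adj))
      (Edge? B' c d) (Edge? B c d)

  -- σ is the face of the nested set complex obtained from the sets in P by
  -- replacing each of them by its components in B.
  record Tracks (B : List (Subset n)) (P : Subset n → Set) (σ : List (Subset n)) : Set where
    field
      distinct : Unique σ
      sound    : ∀ {s} → s ∈ₗ σ → Σ[ X ∈ Subset n ] (P X × Comp B X s)
      complete : ∀ {X s} → P X → Comp B X s → s ∈ₗ σ
      clique   : ∀ {s t} → s ∈ₗ σ → t ∈ₗ σ → s ≢ t → Edge B s t
      proper   : ∀ {X} → P X → X ≢ Full

    member∈ : ∀ {s} → s ∈ₗ σ → s ∈ₗ properMembers B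
    member∈ s∈ = let X , PX , C = sound s∈ in ∈-proper⁺ (proj₁ C)
      (λ { refl → proper PX (Sₚ.⊆-antisym (λ _ → Sₚ.∈⊤) (proj₁ (proj₂ C))) })

  Tracks-↭ : ∀ {B P σ τ} → σ ↭ τ → Tracks B P σ → Tracks B P τ
  Tracks-↭ p R = record
    { distinct = Unique-↭ p distinct
    ; sound = sound ∘ Permₚ.∈-resp-↭ (↭-sym p)
    ; complete = λ PX C → Permₚ.∈-resp-↭ p (complete PX C)
    ; clique = λ s∈ t∈ → clique (Permₚ.∈-resp-↭ (↭-sym p) s∈) (Permₚ.∈-resp-↭ (↭-sym p) t∈)
    ; proper = proper }
    where open Tracks R

  linkPoly : List (Subset n) → List (Subset n) → Poly
  linkPoly B σ = clᵖ (edge B) (lk (edge B) σ (properMembers B))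

  linkPoly-↭ : ∀ B {V} σ → properMembers B ↭ V → linkPoly B σ ≗ clᵖ (edge B) (lk (edge B) σ V)
  linkPoly-↭ B σ p s = cl-↭ (edge B) (edge-sym B) s (filterᵇ-↭ (λ c → all (edge B c) σ) p)

  -- The equation ties the exponent to the size of the face, so that exponents belonging to
  -- different faces can be compared.
  LinkExpands : ℕ → Poly → List (Subset n) → List (Subset n) → Set
  LinkExpands N g B σ = Σ[ e ∈ ℕ ] (length σ + e ≡ N × Expand e g (linkPoly B σ))

  LinkExpands-↭ : ∀ {N} g B {σ τ} → σ ↭ τ → LinkExpands N g B τ → LinkExpands N g B σ
  LinkExpands-↭ g B p (e , eq , E) = e , trans (cong (_+ e) (Permₚ.↭-length p)) eq ,
    Expand-cong (λ _ → refl) (λ s → cong (cl (edge B) s) (sym (lk-↭ˡ (edge B) (properMembers B) p))) E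

  comp-x : ∀ {B B' : List (Subset n)} {v x y : Subset n} → Extension B B' v x y → Comp B v x
  comp-x {B} {v = v} {x} E = x∈B , x⊆v , maxi
    where
    open Extension E
    open ExtensionProps E
    maxi : ∀ {d} → d ∈ₗ B → d ⊆ₛ v → x ⊆ₛ d → d ⊆ₛ x
    maxi d∈ d⊆v x⊆d with inside-part d∈ d⊆v
    ... | inj₁ d⊆x = d⊆x
    ... | inj₂ d⊆y = ⊥-elim (x⊈y (d⊆y ∘ x⊆d))

  module _ {B B' : List (Subset n)} {v x y : Subset n} (E : Extension B B' v x y) where
    open Extension E
    open ExtensionProps E

    Edge-down : ∀ {c d} → Edge B' c d → Edge B c d
    Edge-down (ne , adj) = ne , Adj-down adj

    Edge-v⇒x : ∀ {c} → c ∈ₗ B → c ≢ x → c ≢ y → Edge B' v c → Edge B x c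
    Edge-v⇒x c∈ c≢x c≢y (_ , adj) = c≢x ∘ sym , Adj-v⇒x c∈ c≢y adj

    Edge-v⇒y : ∀ {c} → c ∈ₗ B → c ≢ x → c ≢ y → Edge B' v c → Edge B y c
    Edge-v⇒y c∈ c≢x c≢y (_ , adj) = c≢y ∘ sym , ExtensionProps.Adj-v⇒x (Extension-swap E) c∈ c≢x adj

    comp-inside-v : ∀ {c} → Comp B v c → c ≡ x ⊎ c ≡ y
    comp-inside-v (c∈ , c⊆v , maxi) with inside-part c∈ c⊆v
    ... | inj₁ c⊆x = inj₁ (Sₚ.⊆-antisym c⊆x (maxi x∈B x⊆v c⊆x))
    ... | inj₂ c⊆y = inj₂ (Sₚ.⊆-antisym c⊆y (maxi y∈B y⊆v c⊆y))

    module _ {P : Subset n → Set} where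

      -- As `v` is not in `σ`, it is not a component of any tracked set, and the components are the
      -- same in `B` and `B'`.
      track-same : ∀ {σ} → v ∉ₗ σ → Tracks B' P σ → Tracks B P σ
      track-same {σ} v∉ R = record
        { distinct = distinct
        ; sound = λ s∈ → let X , PX , C = sound s∈ in X , PX , comp-down C (λ { refl → v∉ s∈ })
        ; complete = complete'
        ; clique = λ p q ne → Edge-down (clique p q ne)
        ; proper = proper }
        where
        open Tracks R
        complete' : ∀ {X s} → P X → Comp B X s → s ∈ₗ σ
        complete' PX C with comp-up E C
        ... | inj₁ (C' , _) = complete PX C'
        ... | inj₂ (Cv , _) = ⊥-elim (v∉ (complete PX Cv))

      -- ρ is τ together with x and y, one of which may already be in τ.
      track-replace : ∀ {τ ρ} → Unique ρ → (∀ {s} → s ∈ₗ ρ → s ∈ₗ τ ⊎ s ≡ x ⊎ s ≡ y) → (∀ {s} → s ∈ₗ τ → s ∈ₗ ρ) → x ∈ₗ ρ → y ∈ₗ ρ →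
        Tracks B' P (v ∷ τ) → Tracks B P ρ
      track-replace {τ} {ρ} uρ ρ⊆ τ⊆ρ x∈ρ y∈ρ R = record
        { distinct = uρ ; sound = sound' ; complete = complete' ; clique = clique' ; proper = proper }
        where
        open Tracks R
        ≢v : ∀ {s} → s ∈ₗ τ → s ≢ v
        ≢v s∈ refl = proj₁ (Unique-∷⁻ distinct) s∈
        ∈B : ∀ {s} → s ∈ₗ τ → s ∈ₗ B
        ∈B s∈ = B'⊆B (proj₁ (proj₂ (proj₂ (sound (there s∈))))) (≢v s∈)
        sound' : ∀ {s} → s ∈ₗ ρ → Σ[ X ∈ Subset n ] (P X × Comp B X s)
        sound' s∈ with ρ⊆ s∈
        ... | inj₁ p = let X , PX , C = sound (there p) in X , PX , comp-down C (≢v p)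
        ... | inj₂ (inj₁ refl) = let X , PX , C = sound (here refl) in X , PX , comp-v⇒x C
        ... | inj₂ (inj₂ refl) = let X , PX , C = sound (here refl) in X , PX , comp-v⇒y E C
        complete' : ∀ {X s} → P X → Comp B X s → s ∈ₗ ρ
        complete' PX C with comp-up E C
        ... | inj₂ (_ , inj₁ refl) = x∈ρ
        ... | inj₂ (_ , inj₂ refl) = y∈ρ
        ... | inj₁ (C' , s≢v) with complete PX C'
        ...   | here eq = ⊥-elim (s≢v eq)
        ...   | there p = τ⊆ρ p
        clique-x : ∀ {s} → s ∈ₗ τ → s ≢ x → Edge B x s
        clique-x {s} p s≢x with s ≟ₛ y
        ... | yes refl = Edge-xy
        ... | no s≢y = Edge-v⇒x (∈B p) s≢x s≢y (clique (here refl) (there p) (≢v p ∘ sym))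
        clique-y : ∀ {s} → s ∈ₗ τ → s ≢ y → Edge B y s
        clique-y {s} p s≢y with s ≟ₛ x
        ... | yes refl = Edge-sym Edge-xy
        ... | no s≢x = Edge-v⇒y (∈B p) s≢x s≢y (clique (here refl) (there p) (≢v p ∘ sym))
        clique' : ∀ {s t} → s ∈ₗ ρ → t ∈ₗ ρ → s ≢ t → Edge B s t
        clique' s∈ t∈ ne with ρ⊆ s∈ | ρ⊆ t∈
        ... | inj₁ p | inj₁ q = Edge-down (clique (there p) (there q) ne)
        ... | inj₁ p | inj₂ (inj₁ refl) = Edge-sym (clique-x p ne)
        ... | inj₁ p | inj₂ (inj₂ refl) = Edge-sym (clique-y p ne)
        ... | inj₂ (inj₁ refl) | inj₁ q = clique-x q (ne ∘ sym)
        ... | inj₂ (inj₂ refl) | inj₁ q = clique-y q (ne ∘ sym)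
        ... | inj₂ (inj₁ refl) | inj₂ (inj₁ refl) = ⊥-elim (ne refl)
        ... | inj₂ (inj₁ refl) | inj₂ (inj₂ refl) = Edge-xy
        ... | inj₂ (inj₂ refl) | inj₂ (inj₁ refl) = Edge-sym Edge-xy
        ... | inj₂ (inj₂ refl) | inj₂ (inj₂ refl) = ⊥-elim (ne refl)

      -- Choosing `v` adds it to the tracked sets, and its components in `B` are `x` and `y`.
      track-choose : ∀ {σ} → v ∉ₗ σ → (∀ {s} → s ∈ₗ σ → Edge B x s × Edge B y s) → Tracks B' P σ →
        Tracks B (λ X → P X ⊎ X ≡ v) (x ∷ y ∷ σ)
      track-choose {σ} v∉ rd R = record
        { distinct = Unique-∷⁺ x∉ (Unique-∷⁺ (λ p → proj₁ (proj₂ (rd p)) refl) distinct)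
        ; sound = sound' ; complete = complete' ; clique = clique'
        ; proper = λ { (inj₁ PX) → proper PX ; (inj₂ refl) refl → v∉B (SplitBS.full old) } }
        where
        open Tracks (track-same v∉ R)
        x∉ : x ∉ₗ y ∷ σ
        x∉ (here eq) = x≢y eq
        x∉ (there p) = proj₁ (proj₁ (rd p)) refl
        sound' : ∀ {s} → s ∈ₗ x ∷ y ∷ σ → Σ[ X ∈ Subset n ] ((P X ⊎ X ≡ v) × Comp B X s)
        sound' (here refl) = v , inj₂ refl , comp-x E
        sound' (there (here refl)) = v , inj₂ refl , comp-x (Extension-swap E)
        sound' (there (there p)) = let X , PX , C = sound p in X , inj₁ PX , C
        complete' : ∀ {X s} → P X ⊎ X ≡ v → Comp B X s → s ∈ₗ x ∷ y ∷ σ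
        complete' (inj₁ PX) C = there (there (complete PX C))
        complete' (inj₂ refl) C with comp-inside-v C
        ... | inj₁ refl = here refl
        ... | inj₂ refl = there (here refl)
        clique' : ∀ {s t} → s ∈ₗ x ∷ y ∷ σ → t ∈ₗ x ∷ y ∷ σ → s ≢ t → Edge B s t
        clique' (here refl) (here refl) ne = ⊥-elim (ne refl)
        clique' (here refl) (there (here refl)) ne = Edge-xy
        clique' (here refl) (there (there q)) ne = proj₁ (rd q)
        clique' (there (here refl)) (here refl) ne = Edge-sym Edge-xy
        clique' (there (here refl)) (there (here refl)) ne = ⊥-elim (ne refl)
        clique' (there (here refl)) (there (there q)) ne = proj₂ (rd q)
        clique' (there (there p)) (here refl) ne = Edge-sym (proj₁ (rd p))
        clique' (there (there p)) (there (here refl)) ne = Edge-sym (proj₂ (rd p))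
        clique' (there (there p)) (there (there q)) ne = clique p q ne

    module _ {P : Subset n → Set} {N : ℕ} {g : Poly} (ih : ∀ {σ} → Tracks B P σ → LinkExpands N g B σ) where

      private
        sub = extension-subdivision E
        V₀ = proj₁ sub
        permV = proj₁ (proj₂ sub)
        permV' = proj₁ (proj₂ (proj₂ sub))
        SD = proj₂ (proj₂ (proj₂ sub))

      in-V₀ : ∀ {σ s} → Tracks B' P σ → s ∈ₗ σ → s ≢ v → s ≢ x → s ≢ y → s ∈ₗ V₀
      in-V₀ R s∈ nv nx ny with Permₚ.∈-resp-↭ permV' (Tracks.member∈ R s∈)
      ... | here eq = ⊥-elim (nv eq)
      ... | there (here eq) = ⊥-elim (nx eq)
      ... | there (there (here eq)) = ⊥-elim (ny eq)
      ... | there (there (there p)) = p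

      link-transfer : ∀ {σ τ e} → Expand e g (linkPoly B τ) →
        (∀ s → clᵖ (edge B') (lk (edge B') σ (v ∷ x ∷ y ∷ V₀)) s ≡ clᵖ (edge B) (lk (edge B) τ (x ∷ y ∷ V₀)) s) →
        Expand e g (linkPoly B' σ)
      link-transfer {σ} {τ} Ex h = Expand-cong (λ _ → refl)
        (λ s → trans (linkPoly-↭ B τ permV s) (trans (sym (h s)) (sym (linkPoly-↭ B' σ permV' s)))) Ex

      -- Back in `B` the set `v` is replaced by `x` and `y`: the face gains a vertex and its link
      -- loses a dimension, which the suspension restores.
      expands-v : ∀ {τ} → x ∉ₗ τ → y ∉ₗ τ → Tracks B' P (v ∷ τ) → LinkExpands N g B' (v ∷ τ)
      expands-v {τ} x∉ y∉ R with ih (track-replace uρ ρ⊆ (λ p → there (there p)) (here refl) (there (here refl)) R)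
        where
        uτ = Unique-∷⁻ (Tracks.distinct R)
        uρ : Unique (x ∷ y ∷ τ)
        uρ = Unique-∷⁺ (λ { (here eq) → x≢y eq ; (there p) → x∉ p }) (Unique-∷⁺ y∉ (proj₂ uτ))
        ρ⊆ : ∀ {s} → s ∈ₗ x ∷ y ∷ τ → s ∈ₗ τ ⊎ s ≡ x ⊎ s ≡ y
        ρ⊆ (here eq) = inj₂ (inj₁ eq)
        ρ⊆ (there (here eq)) = inj₂ (inj₂ eq)
        ρ⊆ (there (there p)) = inj₁ p
      ... | e , eq , Ex = suc e , trans (cong suc (ℕₚ.+-suc (length τ) e)) eq ,
          susp (Expand-cong (λ _ → refl) (linkPoly-↭ B (x ∷ y ∷ τ) permV) Ex)
            (λ s → trans (linkPoly-↭ B' (v ∷ τ) permV' s) (link-v SD τ⊆ v-adj s))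
        where
        v∉τ = proj₁ (Unique-∷⁻ (Tracks.distinct R))
        τ⊆ : ∀ {s} → s ∈ₗ τ → s ∈ₗ V₀
        τ⊆ p = in-V₀ R (there p) (λ { refl → v∉τ p }) (λ { refl → x∉ p }) (λ { refl → y∉ p })
        v-adj : ∀ {s} → s ∈ₗ τ → edge B' v s ≡ true
        v-adj p = edge⁺ {B = B'} (Tracks.clique R (here refl) (there p) (λ { refl → v∉τ p }))

      expands-vx : ∀ {τ} → Tracks B' P (v ∷ x ∷ τ) → LinkExpands N g B' (v ∷ x ∷ τ)
      expands-vx {τ} R with ih (track-replace {ρ = y ∷ x ∷ τ} (Unique-∷⁺ y∉ (proj₂ uτ)) ρ⊆ there (there (here refl)) (here refl) R)
        where
        uτ = Unique-∷⁻ (Tracks.distinct R)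
        y∉ : y ∉ₗ x ∷ τ
        y∉ p = ¬Edge'-xy (Tracks.clique R (there (here refl)) (there p) x≢y)
        ρ⊆ : ∀ {s} → s ∈ₗ y ∷ x ∷ τ → s ∈ₗ x ∷ τ ⊎ s ≡ x ⊎ s ≡ y
        ρ⊆ (here eq) = inj₂ (inj₂ eq)
        ρ⊆ (there p) = inj₁ p
      ... | e , eq , Ex = e , eq , link-transfer {v ∷ x ∷ τ} {y ∷ x ∷ τ} Ex (link-vx SD τ⊆)
        where
        uτ = Unique-∷⁻ (Tracks.distinct R)
        τ⊆ : ∀ {s} → s ∈ₗ τ → s ∈ₗ V₀
        τ⊆ p = in-V₀ R (there (there p)) (λ { refl → proj₁ uτ (there p) }) (λ { refl → proj₁ (Unique-∷⁻ (proj₂ uτ)) p })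
          (λ { refl → ¬Edge'-xy (Tracks.clique R (there (here refl)) (there (there p)) x≢y) })

      expands-x : ∀ {τ} → v ∉ₗ x ∷ τ → Tracks B' P (x ∷ τ) → LinkExpands N g B' (x ∷ τ)
      expands-x {τ} v∉ R with ih (track-same v∉ R)
      ... | e , eq , Ex = e , eq , link-transfer {x ∷ τ} {x ∷ τ} Ex (link-x SD τ⊆ x-adj)
        where
        x∉τ = proj₁ (Unique-∷⁻ (Tracks.distinct R))
        τ⊆ : ∀ {s} → s ∈ₗ τ → s ∈ₗ V₀
        τ⊆ p = in-V₀ R (there p) (λ { refl → v∉ (there p) }) (λ { refl → x∉τ p })
          (λ { refl → ¬Edge'-xy (Tracks.clique R (here refl) (there p) x≢y) })
        x-adj : ∀ {s} → s ∈ₗ τ → edge B' x s ≡ true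
        x-adj p = edge⁺ {B = B'} (Tracks.clique R (here refl) (there p) (λ { refl → x∉τ p }))

      expands-unready : ∀ {σ} → v ∉ₗ σ → x ∉ₗ σ → y ∉ₗ σ → all (edge B x) σ ∧ all (edge B y) σ ≡ false →
        Tracks B' P σ → LinkExpands N g B' σ
      expands-unready {σ} v∉ x∉ y∉ unready R with ih (track-same v∉ R)
      ... | e , eq , Ex = e , eq , link-transfer {σ} {σ} Ex (link-unready SD
          (λ p → in-V₀ R p (λ { refl → v∉ p }) (λ { refl → x∉ p }) (λ { refl → y∉ p })) unready)

      expands-ready : ∀ {g⁺ σ} → v ∉ₗ σ → (∀ {s} → s ∈ₗ σ → Edge B x s × Edge B y s) →
        (∀ {σ} → Tracks B (λ X → P X ⊎ X ≡ v) σ → LinkExpands N g⁺ B σ) →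
        Tracks B' P σ → LinkExpands N (λ s → g s + sh g⁺ s) B' σ
      expands-ready {g⁺} {σ} v∉ rd ih⁺ R with ih (track-same v∉ R) | ih⁺ (track-choose v∉ rd R)
      -- Both exponents are fixed by the same `N`, and the second face has two more vertices, so `e`
      -- is `2 + e⁺` as `join` demands.
      ... | e , eq , Ex | e⁺ , eq⁺ , Ex⁺ with ℕₚ.+-cancelˡ-≡ (length σ) e (2 + e⁺) (trans eq (trans (sym eq⁺) (sym len)))
        where
        len : length σ + (2 + e⁺) ≡ suc (suc (length σ + e⁺))
        len = trans (ℕₚ.+-suc (length σ) (suc e⁺)) (cong suc (ℕₚ.+-suc (length σ) e⁺))
      ...   | refl = 2 + e⁺ , eq , join Ex Ex⁺ (λ _ → refl) (λ s → trans (linkPoly-↭ B' σ permV' s)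
            (trans (link-ready SD σ⊆ (edge⁺ {B = B} ∘ proj₁ ∘ rd) (edge⁺ {B = B} ∘ proj₂ ∘ rd) s)
            (cong₂ (λ a b → a + b) (sym (linkPoly-↭ B σ permV s))
               (cong₂ _+_ (sh-cong (λ t → sym (linkPoly-↭ B (x ∷ y ∷ σ) permV t)) s)
                          (sh-cong (sh-cong (λ t → sym (linkPoly-↭ B (x ∷ y ∷ σ) permV t))) s)))))
        where
        σ⊆ : ∀ {s} → s ∈ₗ σ → s ∈ₗ V₀
        σ⊆ p = in-V₀ R p (λ { refl → v∉ p }) (λ { refl → proj₁ (proj₁ (rd p)) refl }) (λ { refl → proj₁ (proj₂ (rd p)) refl })

  module _ {B B' : List (Subset n)} {v x y : Subset n} (E : Extension B B' v x y)
    {P : Subset n → Set} {N : ℕ} {g : Poly} (ih : ∀ {σ} → Tracks B P σ → LinkExpands N g B σ) where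
    open Extension E
    open ExtensionProps E

    -- A face containing `v`, `x` or `y` is met only here, as compatibility implies `Ready`. If it
    -- contains none of them, `ready⇒compatible` shows that one of `x` and `y` is not joined to all
    -- of `σ`.
    step-incompatible : ∀ {σ} → (∀ {X} → P X → X ∉ₗ B') → ¬ (∀ {X} → P X → Compatible E X) → Tracks B' P σ → LinkExpands N g B' σ
    step-incompatible {σ} new-P incompatible R with v ∈?ₗ σ | x ∈?ₗ σ | y ∈?ₗ σ
    ... | no v∉ | yes x∈ | _ = let _ , p = ∈⇒↭∷ x∈ in
            LinkExpands-↭ g B' p (expands-x E ih (v∉ ∘ Permₚ.∈-resp-↭ (↭-sym p)) (Tracks-↭ p R))
    ... | no v∉ | no x∉ | yes y∈ = let _ , p = ∈⇒↭∷ y∈ in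
            LinkExpands-↭ g B' p (expands-x (Extension-swap E) ih (v∉ ∘ Permₚ.∈-resp-↭ (↭-sym p)) (Tracks-↭ p R))
    ... | no v∉ | no x∉ | no y∉ = expands-unready E ih v∉ x∉ y∉ (𝔹ₚ.¬-not not-ready) R
      where
      not-ready : all (edge B x) σ ∧ all (edge B y) σ ≢ true
      not-ready eq = incompatible λ PX → ready⇒compatible E (new-P PX) λ C → let s∈ = Tracks.complete R PX C in
        (λ { refl → v∉ s∈ }) , edge⁻ {B = B} (all-true⁻ {f = edge B x} (𝔹ₚ.∧-conicalˡ (all (edge B x) σ) _ eq) s∈)
                             , edge⁻ {B = B} (all-true⁻ {f = edge B y} (𝔹ₚ.∧-conicalʳ (all (edge B x) σ) _ eq) s∈)
    ... | yes v∈ | _ | _ with ∈⇒↭∷ v∈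
    ...   | ρ , p with x ∈?ₗ ρ | y ∈?ₗ ρ
    ...     | yes x∈ | _ = let _ , q = ∈⇒↭∷ x∈ ; r = ↭-trans p (prep v q) in LinkExpands-↭ g B' r (expands-vx E ih (Tracks-↭ r R))
    ...     | no x∉ | yes y∈ = let _ , q = ∈⇒↭∷ y∈ ; r = ↭-trans p (prep v q) in LinkExpands-↭ g B' r (expands-vx (Extension-swap E) ih (Tracks-↭ r R))
    ...     | no x∉ | no y∉ = LinkExpands-↭ g B' p (expands-v E ih x∉ y∉ (Tracks-↭ p R))

    step-compatible : ∀ {g⁺ σ} → (∀ {X} → P X → Compatible E X) →
      (∀ {σ} → Tracks B (λ X → P X ⊎ X ≡ v) σ → LinkExpands N g⁺ B σ) → Tracks B' P σ → LinkExpands N (λ s → g s + sh g⁺ s) B' σ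
    step-compatible {σ = σ} compatible ih⁺ R = expands-ready E ih (λ v∈ → proj₁ (ready v∈) refl) (proj₂ ∘ ready) ih⁺ R
      where
      ready : ∀ {s} → s ∈ₗ σ → s ≢ v × Edge B x s × Edge B y s
      ready s∈ = let X , PX , C = Tracks.sound R s∈ in compatible⇒ready E (compatible PX) C

-- Flag orderings

lookup-∉-take : ∀ {A : Set} {xs : List A} → Unique xs → ∀ i q → i ≤ toℕ q → lookup xs q ∉ₗ take i xs
lookup-∉-take u zero q le ()
lookup-∉-take {xs = x ∷ xs} u (suc i) (Fin.suc q) (s≤s le) (here eq) = proj₁ (Unique-∷⁻ u) (subst (_∈ₗ xs) eq (∈ₚ.∈-lookup q))
lookup-∉-take {xs = x ∷ xs} u (suc i) (Fin.suc q) (s≤s le) (there p) = lookup-∉-take (proj₂ (Unique-∷⁻ u)) i q le p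

take-⊆ : ∀ {A : Set} i (xs : List A) {c} → c ∈ₗ take i xs → c ∈ₗ xs
take-⊆ (suc i) (x ∷ xs) (here eq) = here eq
take-⊆ (suc i) (x ∷ xs) (there p) = there (take-⊆ i xs p)

module Ordering {n : ℕ} {B : List (Subset n)} (flagB : IsConnFlagBS B) (O : FlagOrdering B) where
  open FlagOrdering O

  K : ℕ
  K = length bs

  private
    D-full : Full ∈ₗ D
    D-full = proj₁ (proj₂ (proj₁ decomp))

    all-unique : Unique (D ++ bs)
    all-unique = Unique-↭ (↭-sym enum) (IsBuildingSet.noDup (proj₁ flagB))

    unique-parts : ∀ (L : List (Subset n)) {M} → Unique (L ++ M) → Unique M × (∀ {c} → c ∈ₗ L → c ∉ₗ M)
    unique-parts [] u = u , λ ()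
    unique-parts (c ∷ L) u = let uM , sep = unique-parts L (proj₂ (Unique-∷⁻ u)) in uM , λ
      { (here refl) p → proj₁ (Unique-∷⁻ u) (∈ₚ.∈-++⁺ʳ L p)
      ; (there q) p → sep q p }

    bs-unique : Unique bs
    bs-unique = proj₁ (unique-parts D all-unique)

    D∌b : ∀ q → b O q ∉ₗ D
    D∌b q p = proj₂ (unique-parts D all-unique) p (∈ₚ.∈-lookup q)

  b∉Prefix : ∀ i q → i ≤ toℕ q → b O q ∉ₗ Prefix O i
  b∉Prefix i q le p with ∈ₚ.∈-++⁻ D p
  ... | inj₁ p' = D∌b q p'
  ... | inj₂ p' = lookup-∉-take bs-unique i q le p'

  Prefix-SplitBS : ∀ i → i ≤ K → SplitBS (Prefix O i)
  Prefix-SplitBS i le = let isB , flag = flagPrefix i le in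
    ConnFlagBS⇒SplitBS (isB , ∈ₚ.∈-++⁺ˡ D-full , flag)

  Prefix-suc : ∀ p → Prefix O (suc (toℕ p)) ≡ Prefix O (toℕ p) ++ b O p ∷ []
  Prefix-suc p = trans (cong (D ++_) (Listₚ.take-suc bs p)) (sym (Listₚ.++-assoc D (take (toℕ p) bs) (b O p ∷ [])))

  Prefix-up : ∀ p {c} → c ∈ₗ Prefix O (toℕ p) → c ∈ₗ Prefix O (suc (toℕ p))
  Prefix-up p c∈ = subst (_ ∈ₗ_) (sym (Prefix-suc p)) (∈ₚ.∈-++⁺ˡ c∈)

  Prefix-new : ∀ p → b O p ∈ₗ Prefix O (suc (toℕ p))
  Prefix-new p = subst (b O p ∈ₗ_) (sym (Prefix-suc p)) (∈ₚ.∈-++⁺ʳ (Prefix O (toℕ p)) (here refl))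

  Prefix-down : ∀ p {c} → c ∈ₗ Prefix O (suc (toℕ p)) → c ≢ b O p → c ∈ₗ Prefix O (toℕ p)
  Prefix-down p c∈ ne with ∈ₚ.∈-++⁻ (Prefix O (toℕ p)) (subst (_ ∈ₗ_) (Prefix-suc p) c∈)
  ... | inj₁ q = q
  ... | inj₂ (here eq) = ⊥-elim (ne eq)

  extension : ∀ p → Σ[ x ∈ Subset n ] Σ[ y ∈ Subset n ] Extension (Prefix O (toℕ p)) (Prefix O (suc (toℕ p))) (b O p) x y
  extension p = mkExtension (Prefix-SplitBS (toℕ p) (ℕₚ.<⇒≤ (Finₚ.toℕ<n p))) (Prefix-SplitBS (suc (toℕ p)) (Finₚ.toℕ<n p))
    (b∉Prefix (toℕ p) p ℕₚ.≤-refl) (Prefix-new p) (Prefix-up p) (Prefix-down p)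

  private
    member-dec : ∀ {P : Subset n → Set} → (∀ c → Dec (P c)) → (L : List (Subset n)) → Dec (Σ[ c ∈ Subset n ] (c ∈ₗ L × P c))
    member-dec P? L = map′ find (λ (c , c∈ , p) → lose c∈ p) (Any.any? P? L)

    InU? : ∀ p q → Dec (InU O p q)
    InU? p q = ¬? (b O p Sₚ.⊆? b O q) ×-dec ¬? (member-dec (λ c → (c ─ b O q) ≟ₛ (b O p ─ b O q)) (Prefix O (toℕ p)))

    InV? : ∀ p q → Dec (InV O p q)
    InV? p q = (b O p Sₚ.⊆? b O q) ×-dec member-dec (λ c → (b O p Sₚ.⊂? c) ×-dec (c Sₚ.⊂? b O q)) (Prefix O (toℕ p))

    Adjacent? : ∀ p q → Dec (Adjacent O p q)
    Adjacent? p q = (p Fin.<? q) →-dec (InU? p q ⊎-dec InV? p q)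

  -- `Adjacent` is vacuous unless its arguments increase, so the conjunction of both orders is the
  -- symmetric adjacency of Γ(O). It also holds on the diagonal, but the vertices compared below are
  -- always distinct.
  γ-edge : Fin K → Fin K → Bool
  γ-edge p q = does (Adjacent? p q) ∧ does (Adjacent? q p)

  γ-edge-sym : ∀ p q → γ-edge p q ≡ γ-edge q p
  γ-edge-sym p q = 𝔹ₚ.∧-comm (does (Adjacent? p q)) (does (Adjacent? q p))

  γ-edge⁻ : ∀ {p q} → γ-edge p q ≡ true → Adjacent O p q
  γ-edge⁻ {p} {q} eq = does⁻ (Adjacent? p q) (𝔹ₚ.∧-conicalˡ _ (does (Adjacent? q p)) eq)

  γ-edge⁺ : ∀ {p q} → Adjacent O p q → Adjacent O q p → γ-edge p q ≡ true
  γ-edge⁺ {p} {q} f g = cong₂ _∧_ (dec-true (Adjacent? p q) f) (dec-true (Adjacent? q p) g)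

  γ-edge⁺-< : ∀ {p q} → toℕ p < toℕ q → InU O p q ⊎ InV O p q → γ-edge p q ≡ true
  γ-edge⁺-< {p} {q} p<q h = γ-edge⁺ (λ _ → h) (λ q<p → ⊥-elim (ℕₚ.<-asym p<q q<p))

  -- The latest index stands first, so that one step of the ordering is one cons.
  earlier : ℕ → List (Fin K)
  earlier zero = []
  earlier (suc i) with i ℕ.<? K
  ... | yes i<K = Fin.fromℕ< i<K ∷ earlier i
  ... | no _ = earlier i

  earlier-suc : ∀ p → earlier (suc (toℕ p)) ≡ p ∷ earlier (toℕ p)
  earlier-suc p with toℕ p ℕ.<? K
  ... | yes lt = cong (_∷ earlier (toℕ p)) (Finₚ.fromℕ<-toℕ p lt)
  ... | no nlt = ⊥-elim (nlt (Finₚ.toℕ<n p))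

  ∈-earlier⁻ : ∀ i {p} → p ∈ₗ earlier i → toℕ p < i
  ∈-earlier⁻ (suc i) p∈ with i ℕ.<? K
  ∈-earlier⁻ (suc i) (here refl) | yes lt = s≤s (ℕₚ.≤-reflexive (Finₚ.toℕ-fromℕ< lt))
  ∈-earlier⁻ (suc i) (there p∈) | yes lt = ℕₚ.m<n⇒m<1+n (∈-earlier⁻ i p∈)
  ∈-earlier⁻ (suc i) p∈ | no _ = ℕₚ.m<n⇒m<1+n (∈-earlier⁻ i p∈)

  ∈-earlier⁺ : ∀ i {p} → toℕ p < i → p ∈ₗ earlier i
  ∈-earlier⁺ (suc i) {p} (s≤s le) with i ℕ.<? K | ℕₚ.m≤n⇒m<n∨m≡n le
  ... | yes lt | inj₁ p<i = there (∈-earlier⁺ i p<i)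
  ... | yes lt | inj₂ refl = here (sym (Finₚ.fromℕ<-toℕ p lt))
  ... | no _ | inj₁ p<i = ∈-earlier⁺ i p<i
  ... | no nlt | inj₂ refl = ⊥-elim (nlt (Finₚ.toℕ<n p))

  earlier-unique : ∀ i → Unique (earlier i)
  earlier-unique zero = []
  earlier-unique (suc i) with i ℕ.<? K
  ... | no _ = earlier-unique i
  ... | yes lt = Unique-∷⁺ (λ p → ℕₚ.<-irrefl (Finₚ.toℕ-fromℕ< lt) (∈-earlier⁻ i p)) (earlier-unique i)

  Γ-link : ℕ → List (Fin K) → Poly
  Γ-link i T = clᵖ γ-edge (lk γ-edge T (earlier i))

  Chosen : List (Fin K) → Subset n → Set
  Chosen T X = Σ[ q ∈ Fin K ] (q ∈ₗ T × X ≡ b O q)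

  -- `T` holds the indices chosen on the way back from the end, all at least `i`, so none of the
  -- corresponding sets is in the prefix yet. The γ-polynomial claimed is that of the link of `T` in
  -- Γ(O), restricted to the indices before `i`.
  LinksExpand : ℕ → ℕ → Set
  LinksExpand N i = ∀ T → (∀ {q} → q ∈ₗ T → i ≤ toℕ q) → ∀ {σ} → Tracks (Prefix O i) (Chosen T) σ → LinkExpands N (Γ-link i T) (Prefix O i) σ

  Tracks-resp : ∀ {A P Q} {σ : List (Subset n)} → (∀ {X} → P X → Q X) → (∀ {X} → Q X → P X) → Tracks A P σ → Tracks A Q σ
  Tracks-resp f g R = record
    { distinct = distinct ; sound = λ s∈ → let X , PX , C = sound s∈ in X , f PX , C
    ; complete = complete ∘ g ; clique = clique ; proper = proper ∘ g }
    where open Tracks R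

  -- If `p` is adjacent to all of `T`, it is a vertex of the link in Γ(O), and the cliques without
  -- and with `p` are the two summands of `join`. If not, neither side changes its γ-polynomial.
  links-expand-step : ∀ {N} p → LinksExpand N (toℕ p) → LinksExpand N (suc (toℕ p))
  links-expand-step {N} p ih T T≥ {σ} R = by-cases (all (γ-edge p) T) refl
    where
    i = toℕ p
    B₁ = Prefix O (toℕ p)
    B₂ = Prefix O (suc (toℕ p))
    x = proj₁ (extension p)
    y = proj₁ (proj₂ (extension p))
    E : Extension B₁ B₂ (b O p) x y
    E = proj₂ (proj₂ (extension p))
    later : ∀ {X} → Chosen T X → X ∉ₗ B₂
    later (q , q∈ , refl) = b∉Prefix (suc (toℕ p)) q (T≥ q∈)
    ih₁ : ∀ {σ} → Tracks B₁ (Chosen T) σ → LinkExpands N (Γ-link i T) B₁ σ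
    ih₁ = ih T (λ q∈ → ℕₚ.≤-trans (ℕₚ.n≤1+n _) (T≥ q∈))
    by-cases : ∀ r → all (γ-edge p) T ≡ r → LinkExpands N (Γ-link (suc i) T) B₂ σ
    by-cases false eq = let e , len , Ex = step-incompatible E ih₁ later incompatible R in
        e , len , Expand-cong (λ s → cong (cl γ-edge s) (sym skip)) (λ _ → refl) Ex
      where
      skip : lk γ-edge T (earlier (suc i)) ≡ lk γ-edge T (earlier i)
      skip = trans (cong (lk γ-edge T) (earlier-suc p)) (filterᵇ-reject (λ c → all (γ-edge c) T) p (earlier i) eq)
      incompatible : ¬ (∀ {X} → Chosen T X → Compatible E X)
      incompatible h with trans (sym eq) (all-true⁺ T (λ {q} q∈ → γ-edge⁺-< (T≥ q∈) (h (q , q∈ , refl))))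
      ... | ()
    by-cases true eq = let e , len , Ex = step-compatible E ih₁ compatible ih⁺ R in
        e , len , Expand-cong split (λ _ → refl) Ex
      where
      compatible : ∀ {X} → Chosen T X → Compatible E X
      compatible (q , q∈ , refl) = γ-edge⁻ (all-true⁻ {f = γ-edge p} eq q∈) (T≥ q∈)
      ih⁺ : ∀ {σ} → Tracks B₁ (λ X → Chosen T X ⊎ X ≡ b O p) σ → LinkExpands N (Γ-link i (p ∷ T)) B₁ σ
      ih⁺ R' = ih (p ∷ T) (λ { (here refl) → ℕₚ.≤-refl ; (there q∈) → ℕₚ.≤-trans (ℕₚ.n≤1+n _) (T≥ q∈) }) (Tracks-resp
        (λ { (inj₁ (q , q∈ , eq)) → q , there q∈ , eq ; (inj₂ eq) → p , here refl , eq })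
        (λ { (q , here refl , eq) → inj₂ eq ; (q , there q∈ , eq) → inj₁ (q , q∈ , eq) }) R')
      split : ∀ s → Γ-link i T s + sh (Γ-link i (p ∷ T)) s ≡ Γ-link (suc i) T s
      split s = sym (begin
        cl γ-edge s (lk γ-edge T (earlier (suc i)))
          ≡⟨ cong (cl γ-edge s) (trans (cong (lk γ-edge T) (earlier-suc p)) (filterᵇ-accept (λ c → all (γ-edge c) T) p (earlier i) eq)) ⟩
        cl γ-edge s (p ∷ lk γ-edge T (earlier i)) ≡⟨ clᵖ-∷ γ-edge p (lk γ-edge T (earlier i)) s ⟩
        Γ-link i T s + sh (clᵖ γ-edge (filterᵇ (γ-edge p) (lk γ-edge T (earlier i)))) s
          ≡⟨ cong (λ W → Γ-link i T s + sh (clᵖ γ-edge W) s)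
               (trans (filterᵇ-filterᵇ (γ-edge p) (λ c → all (γ-edge c) T) (earlier i))
                      (filterᵇ-cong (earlier i) (λ {c} _ → cong (_∧ all (γ-edge c) T) (γ-edge-sym p c)))) ⟩
        Γ-link i T s + sh (Γ-link i (p ∷ T)) s ∎)
        where open ≡-Reasoning

  private
    base : Σ[ N ∈ ℕ ] (n ≡ suc N × Cross (edge (Prefix O 0)) N (properMembers (Prefix O 0)))
    base = minimal-Cross decomp (IsBuildingSet.noDup (proj₁ (flagPrefix 0 z≤n)))
      ∈ₚ.∈-++⁺ˡ (λ c∈ → [ id , (λ ()) ]′ (∈ₚ.∈-++⁻ D c∈))

  dimension : ℕ
  dimension = proj₁ base

  -- No index is left, so Γ contributes only the empty face, and the link of a face of a
  -- cross-polytope is a cross-polytope.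
  links-expand-zero : LinksExpand dimension 0
  links-expand-zero T T≥ {σ} R =
      let e , len , C = Cross-lk e₀ (edge-sym B₀) (edge-irrefl B₀) (proj₂ (proj₂ base)) σ distinct member∈
                          (λ s∈ t∈ ne → edge⁺ {B = B₀} (clique s∈ t∈ ne)) in
      e , len , Cross⇒Expand e₀ (edge-sym B₀) (clᵖ-[] γ-edge) C
    where
    open Tracks R
    B₀ = Prefix O 0
    e₀ = edge B₀

  links-expand : ∀ i → i ≤ K → LinksExpand dimension i
  links-expand zero _ = links-expand-zero
  links-expand (suc i) lt = subst (LinksExpand dimension ∘ suc) (Finₚ.toℕ-fromℕ< lt)
    (links-expand-step (Fin.fromℕ< lt) (subst (LinksExpand dimension) (sym (Finₚ.toℕ-fromℕ< lt)) (links-expand i (ℕₚ.<⇒≤ lt))))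

  tracks-nothing : Tracks (Prefix O K) (Chosen []) []
  tracks-nothing = record { distinct = [] ; sound = λ () ; complete = λ { (_ , () , _) _ } ; clique = λ () ; proper = λ { (_ , () , _) } }

  -- The last prefix is `B` only up to order; neither clique counts nor compatibility depend on the
  -- order.
  untracked : ∀ {N} → LinkExpands N (Γ-link K []) (Prefix O K) [] → Expand N (clᵖ γ-edge (earlier K)) (clᵖ (edge B) (properMembers B))
  untracked (e , refl , Ex) = Expand-cong (λ s → cong (cl γ-edge s) (filterᵇ-keep (earlier K) (λ _ → refl)))
      (λ s → trans (cong (cl (edge B₁) s) (filterᵇ-keep (properMembers B₁) (λ _ → refl)))
        (trans (cl-↭ (edge B₁) (edge-sym B₁) s (Permₚ.filter-↭ (λ c → ¬? (c ≟ₛ Full)) B₁↭B))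
               (cl-cong s (properMembers B) (λ {c} {d} _ _ → same c d)))) Ex
    where
    B₁ = Prefix O K
    B₁↭B : B₁ ↭ B
    B₁↭B = subst (_↭ B) (cong (D ++_) (sym (Listₚ.take-all K bs ℕₚ.≤-refl))) enum
    same : ∀ c d → edge B₁ c d ≡ edge B c d
    same c d = does-⇔ (mk⇔ (adj (Permₚ.∈-resp-↭ (↭-sym B₁↭B))) (adj (Permₚ.∈-resp-↭ B₁↭B))) (Edge? B₁ c d) (Edge? B c d)
      where
      adj : ∀ {A A' : List (Subset n)} → (∀ {z} → z ∈ₗ A' → z ∈ₗ A) → Edge A c d → Edge A' c d
      adj f (ne , inj₁ p) = ne , inj₁ p
      adj f (ne , inj₂ (inj₁ p)) = ne , inj₂ (inj₁ p)
      adj f (ne , inj₂ (inj₂ p)) = ne , inj₂ (inj₂ (p ∘ f))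

  nestedComplex-expands : Expand dimension (clᵖ γ-edge (earlier K)) (clᵖ (edge B) (properMembers B))
  nestedComplex-expands = untracked (links-expand K ℕₚ.≤-refl [] (λ ()) tracks-nothing)

  cliqueCount : ∀ {s c} → HasCount (CliqueOfSize O s) c → c ≡ clᵖ γ-edge (earlier K) s
  cliqueCount {s} hc = CliqueCount.count≡cl γ-edge γ-edge-sym {s} (earlier-unique K) (λ p → ∈-earlier⁺ K (Finₚ.toℕ<n p)) hc
    (λ (size , cl) → size , λ p∈ q∈ _ → γ-edge⁺ (cl _ _ p∈ q∈) (cl _ _ q∈ p∈))
    (λ size cl → size , λ p q p∈ q∈ p<q → γ-edge⁻ (cl p∈ q∈ (λ { refl → ℕₚ.<-irrefl refl p<q })) p<q)

theorem3p5 : ∀ (n : ℕ) (B : List (Subset n)) → IsConnFlagBS B → (O : FlagOrdering B) →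
    ∀ (m : ℕ) (fs : Fin m → Point n) → FacetEnum B m fs →
    ∀ (fΔ : ℕ → ℕ) → (∀ i → HasCount (FaceOfΔP B fs i) (fΔ i)) →
    ∀ (d : ℕ) → IsTopSize fΔ d →
    ∀ (fΓ : ℕ → ℕ) → (∀ i → HasCount (CliqueOfSize O i) (fΓ i)) →
    IsGammaVector fΔ d fΓ
theorem3p5 n B flagB O m fs facets fΔ countΔ d top fΓ countΓ =
    -- The given `d` is identified with `dimension` through the top nonzero face number.
    subst (λ d → IsGammaVector fΔ d fΓ) (IsTopSize-unique (Expand⇒IsTopSize expansion) top) (Expand⇒IsGammaVector expansion)
  where
  open Ordering flagB O
  expansion : Expand dimension fΓ fΔ
  expansion = Expand-cong (λ i → sym (cliqueCount (countΓ i))) (λ i → sym (faceCount (ConnFlagBS⇒SplitBS flagB) facets (countΔ i))) nestedComplex-expands
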